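{- Let $G$ be a cactus graph. Then: 1. $HG(G)=4$ if and only if $G$ contains at least two triangles. 2. $HG(G)=3$ if and only if ($G$ contains at least two cycles, or $G$ contains a cycle whose length is $4$ or divisible by $3$) and $G$ contains fewer than two triangles. 3. $HG(G)=2$ if and only if $G$ is a pseudotree with at least one edge and $G$ contains no cycle whose length is $4$ or divisible by $3$.
   Context: All graphs are finite, simple and undirected. Given a graph $G$ and a function $h:V(G)\to\mathbb{N}$ to the positive integers (the hatness function), the hat guessing game $\langle G,h\rangle$ is as follows. A coloring assigns to each vertex $v$ a color from $[h(v)]=\{1,\dots,h(v)\}$. A strategy assigns to each vertex $v$ a deterministic guessing function $f_v$ whose input is the tuple of colors of the neighbors of $v$ in $G$ and whose output is a guess in $[h(v)]$. The players win on a coloring if at least one vertex $v$ has its guess equal to its own assigned color. The game $\langle G,h\rangle$ is winning if there is a strategy for which the players win on every coloring, and losing otherwise. The hat guessing number $HG(G)$ is the largest integer $q$ such that the game $\langle G,h\rangle$ with $h(v)=q$ for all $v\in V(G)$ is winning. A cactus graph is a connected graph in which every pair of (distinct) cycles shares at most one vertex. A pseudotree is a connected graph with at most one cycle. A triangle is a cycle of length $3$. -}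

module Defs where

open import Data.Bool using (Bool; false; T)
open import Data.Fin using (Fin; toℕ)
open import Data.Nat using (ℕ; suc; _+_; _≤_; NonZero)
open import Data.Nat.DivMod using (_mod_)
open import Data.Product using (Σ; ∃-syntax; _×_)
open import Data.Sum using (_⊎_)
open import Function.Bundles using (_⇔_)
open import Function.Definitions using (Injective)
open import Relation.Binary.Construct.Closure.ReflexiveTransitive using (Star)
open import Relation.Binary.PropositionalEquality using (_≡_)
open import Relation.Nullary using (¬_)

record Graph : Set where
  field
    order  : ℕ
    adj    : Fin order → Fin order → Bool
    sym    : ∀ u v → adj u v ≡ adj v u
    irrefl : ∀ v → adj v v ≡ false

  Vertex : Set
  Vertex = Fin order

  Adj : Vertex → Vertex → Set
  Adj u v = T (adj u v)

record Hatness (G : Graph) : Set where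
  open Graph G
  field
    hats     : Vertex → ℕ
    positive : ∀ v → NonZero (hats v)

constant : (G : Graph) (q : ℕ) → NonZero q → Hatness G
constant G q q≢0 = record { hats = λ _ → q ; positive = λ _ → q≢0 }

-- The colours [h(v)] = {1, …, h(v)} are represented by Fin (h v).
module Game (G : Graph) (h : Hatness G) where
  open Graph G
  open Hatness h

  Colouring : Set
  Colouring = ∀ v → Fin (hats v)

  NeighbourColours : Vertex → Set
  NeighbourColours v = ∀ u → Adj v u → Fin (hats u)

  visible : Colouring → ∀ v → NeighbourColours v
  visible c v u _ = c u

  -- Two tuples of colours are the same when they agree entrywise; without
  -- function extensionality, guesses have to respect this explicitly.
  record Strategy : Set where
    field
      guess      : ∀ v → NeighbourColours v → Fin (hats v)
      guess-cong : ∀ v (x y : NeighbourColours v) →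
                   (∀ u (a : Adj v u) → x u a ≡ y u a) →
                   guess v x ≡ guess v y

  WinsOn : Strategy → Colouring → Set
  WinsOn s c = ∃[ v ] Strategy.guess s v (visible c v) ≡ c v

Winning : (G : Graph) → Hatness G → Set
Winning G h = ∃[ s ] (∀ c → WinsOn s c)
  where open Game G h

WinningWith : Graph → ℕ → Set
WinningWith G q = Σ (NonZero q) λ q≢0 → Winning G (constant G q q≢0)

-- HG G is q: the largest-integer definition, as a relation between G and q.
HG_is_ : Graph → ℕ → Set
HG G is q = WinningWith G q × (∀ r → WinningWith G r → r ≤ q)

next : ∀ {n} → Fin (suc n) → Fin (suc n)
next {n} i = suc (toℕ i) mod suc n

-- A cycle together with a choice of starting point and direction; the
-- underlying subgraphs are compared by _≈_ below.
record Cycle (G : Graph) : Set where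
  open Graph G
  field
    excess : ℕ

  length : ℕ
  length = 3 + excess

  field
    vertex   : Fin length → Vertex
    distinct : Injective _≡_ _≡_ vertex
    step     : ∀ i → Adj (vertex i) (vertex (next i))

  Through : Vertex → Set
  Through v = ∃[ i ] vertex i ≡ v

  HasEdge : Vertex → Vertex → Set
  HasEdge u v = ∃[ i ] ((vertex i ≡ u × vertex (next i) ≡ v)
                      ⊎ (vertex i ≡ v × vertex (next i) ≡ u))

open Cycle public using (length; Through; HasEdge)

infix 4 _≈_

_≈_ : {G : Graph} → Cycle G → Cycle G → Set
C ≈ D = ∀ u v → HasEdge C u v ⇔ HasEdge D u v

Triangle : {G : Graph} → Cycle G → Set
Triangle C = length C ≡ 3

-- The graph with no vertices is not considered connected.
Connected : Graph → Set
Connected G = Vertex × (∀ u v → Star Adj u v)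
  where open Graph G

Cactus : Graph → Set
Cactus G = Connected G ×
  (∀ (C D : Cycle G) → ¬ (C ≈ D) →
   ∀ u v → Through C u → Through D u → Through C v → Through D v → u ≡ v)

Pseudotree : Graph → Set
Pseudotree G = Connected G × (∀ (C D : Cycle G) → C ≈ D)

HasEdges : Graph → Set
HasEdges G = ∃[ u ] ∃[ v ] Adj u v
  where open Graph G

AtLeastTwoCycles : Graph → Set
AtLeastTwoCycles G = ∃[ C ] ∃[ D ] ¬ (_≈_ {G} C D)

AtLeastTwoTriangles : Graph → Set
AtLeastTwoTriangles G =
  ∃[ C ] ∃[ D ] Triangle C × Triangle D × ¬ (_≈_ {G} C D)

{-# OPTIONS --safe #-}
-- Lower bounds.  On a cycle all of whose vertices but the root v have three
-- colours (four on a triangle), the others can play such that, if they are all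
-- wrong, v learns one prescribed bit of its colour.  Such information can be
-- passed along a path, each vertex betting one bit for another, so two cycles
-- let some vertex learn both bits of its colour.
--
-- Upper bounds.  If a branch hanging off a vertex u loses even when u has two
-- colours, then u has at most one bad colour for each view of the rest of the
-- graph; letting u guess that colour there removes the branch.  This strips a
-- cactus down to a single cycle, where the case of three colours is the hard one.
-- There a state is a pair of consecutive colours and a move is a wrong guess.
-- Counting the returns to the initial state forces each colour to occur exactly
-- three times in each guessing table.  A state with a single successor leads to
-- another such state, and the resulting sequence, when followed around the cycle,
-- permutes the colours without fixed points, which yields explicit colourings that
-- beat the players.  Without such states all tables are Latin squares, and these
-- lose because almost every state becomes reachable.
module Submission where

open import Defs
open import Data.Bool as Bool using (Bool; true; false; not)
open import Data.Bool.Properties using (T?; ¬-not; not-involutive)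
open import Data.Empty using (⊥; ⊥-elim)
open import Data.Fin using (Fin; zero; suc; toℕ; inject≤; fromℕ<)
open import Data.Fin.Properties as Fin using (_≟_; all?; any?; toℕ<n; toℕ-inject≤; toℕ-injective; toℕ-fromℕ<)
open import Data.Fin.Subset using (Subset; _∈_; _∉_; _⊆_; _⊂_; ⊤)
open import Data.Fin.Subset.Induction using (⊂-wellFounded)
open import Data.Fin.Subset.Properties using (_∈?_; ∈⊤)
open import Data.List as List using (List; []; _∷_)
import Data.List.Membership.DecPropositional
open import Data.List.Membership.Propositional using () renaming (_∈_ to _∈ₗ_; _∉_ to _∉ₗ_)
open import Data.List.Membership.Propositional.Properties using (∈-map⁺; ∈-++⁺ˡ; ∈-++⁺ʳ)
open import Data.List.Properties using (length-map; length-++)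
open import Data.List.Relation.Unary.Any as Any using (here; there)
open import Data.List.Relation.Unary.Any.Properties using (lookup-index)
open import Data.Nat as ℕ′ using (ℕ; zero; suc; _+_; _*_; _∸_; _≤_; _<_; z≤n; s≤s; NonZero; _%_; _<ᵇ_)
open import Data.Nat.DivMod using (m≡m%n+[m/n]*n; m%n<n; m%n%n≡m%n; m<n⇒m%n≡m; n%n≡0; [m+n]%n≡m%n; %-distribˡ-+; _mod_)
open import Data.Nat.Divisibility using (_∣_; divides; _∣?_; ∣-refl)
open import Data.Nat.Induction using (<-wellFounded)
open import Data.Nat.Properties as ℕ using (+-suc; +-comm; +-assoc)
open import Data.Nat.Solver using (module +-*-Solver)
open import Data.Product using (Σ; ∃; ∃-syntax; _×_; _,_; proj₁; proj₂)
open import Data.Sum using (_⊎_; inj₁; inj₂; [_,_]′)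
import Data.Unit as Unit
open import Data.Vec using (lookup; tabulate)
open import Data.Vec.Properties using (lookup∘tabulate; tabulate-cong; []=⇒lookup; lookup⇒[]=)
open import Function.Bundles using (_⇔_; mk⇔; Equivalence)
open import Function.Definitions using (Injective)
open import Induction.WellFounded using (Acc; acc)
open import Relation.Binary.Construct.Closure.ReflexiveTransitive as Star using (Star; ε; _◅_; _◅◅_)
open import Relation.Binary.PropositionalEquality
  using (_≡_; _≢_; refl; sym; trans; cong; cong₂; subst; subst₂; module ≡-Reasoning)
open import Relation.Nullary using (¬_; Dec; yes; no; does; contradiction)
open import Relation.Nullary.Decidable
  using (from-yes; ¬?; _→-dec_; _×-dec_; _⊎-dec_; decidable-stable; dec-true; map′)
open import Algebra.Properties.CommutativeMonoid.Sum ℕ.+-0-commutativeMonoid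
  using (sum; ∑-comm; ∑-distrib-+; sum-cong-≗)

-- Walks in the state space of a cycle

-- Behind every upper bound for cycles is one remark: once the two neighbours of a vertex are
-- coloured, its guess excludes a single colour. So two walks that differ only in their last colour
-- are never both blocked by the same next colour, and a large enough set of reachable states stays
-- large. "All colours but one" persists with at least three colours, "at least two colours" with
-- four or five; these two invariants treat all long cycles at once. With three colours the remark
-- is also applied to the vertex that closes the cycle: initial states `(s , x)` and `(s′ , x)` with
-- `s ≢ s′` cannot return through the same last colour `y`. All restrictions on the tables come from
-- this. It yields injectivity of rows only, whereas a Latin square also needs injective columns;
-- these come from running the same argument on the reversed cycle. Losing is stated as a negation,
-- so that reachability inside vertex sets may be treated classically; finite searches over cycles
-- then turn the classification into positive statements.

pattern 0F = zero
pattern 1F = suc zero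
pattern 2F = suc (suc zero)

Guesses : ℕ → Set
Guesses q = ℕ → Fin q → Fin q → Fin q

-- A walk of k steps from (a , b) to (d , e): colours of consecutive positions
-- starting at position i, where each interior position guesses wrong.
infixr 5 _∷_
data Walk {q} (f : Guesses q) : ℕ → ℕ → (a b d e : Fin q) → Set where
  []  : ∀ {i a b} → Walk f 0 i a b a b
  _∷_ : ∀ {k i a b c d e} → f i a c ≢ b → Walk f k (suc i) b c d e →
        Walk f (suc k) i a b d e

snoc : ∀ {q} {f : Guesses q} {k i a b c d e} →
       Walk f k i a b c d → f (k + i) c e ≢ d → Walk f (suc k) i a b d e
snoc                 []      s = s ∷ []
snoc {f = f} {suc k} {i} {c = c} {d} {e} (r ∷ w) s =
  r ∷ snoc w (subst (λ j → f j c e ≢ d) (sym (+-suc k i)) s)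

unsnoc : ∀ {q} {f : Guesses q} {k i a b d e} → Walk f (suc k) i a b d e →
         ∃[ c ] (Walk f k i a b c d × f (k + i) c e ≢ d)
unsnoc {k = zero}  (r ∷ [])         = _ , [] , r
unsnoc {f = f} {suc k} {i} {d = d} {e} (r ∷ w@(_ ∷ _)) with unsnoc w
... | c , v , s = c , r ∷ v , subst (λ j → f j c e ≢ d) (+-suc k i) s

infixr 5 _++_
_++_ : ∀ {q} {f : Guesses q} {k l i a b c d e g} →
       Walk f k i a b c d → Walk f l (k + i) c d e g → Walk f (k + l) i a b e g
[] ++ w = w
_++_ {f = f} {suc k} {l} {i} {c = c} {d} {e} {g} (r ∷ v) w =
  r ∷ (v ++ subst (λ j → Walk f l j c d e g) (sym (+-suc k i)) w)

fromSequence : ∀ {q} {f : Guesses q} {i} (x : ℕ → Fin q) (k : ℕ) →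
               (∀ j → j < k → f (j + i) (x j) (x (2 + j)) ≢ x (1 + j)) →
               Walk f k i (x 0) (x 1) (x k) (x (suc k))
fromSequence x zero    steps = []
fromSequence x (suc k) steps =
  snoc (fromSequence x k λ j j<k → steps j (ℕ.m<n⇒m<1+n j<k)) (steps k ℕ.≤-refl)

toSequence : ∀ {q} {f : Guesses q} {k i a b d e} → Walk f k i a b d e →
             Σ (ℕ → Fin q) λ x → x 0 ≡ a × x 1 ≡ b × x k ≡ d × x (suc k) ≡ e ×
               (∀ j → j < k → f (j + i) (x j) (x (2 + j)) ≢ x (1 + j))
toSequence {a = a} {b} [] = (λ { zero → a ; (suc _) → b }) , refl , refl , refl , refl , λ _ ()
toSequence {q} {f} {suc k} {i} {a} (r ∷ w) with toSequence w
... | x , refl , refl , refl , refl , steps = y , refl , refl , refl , refl , ysteps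
  where
  y : ℕ → Fin q
  y zero    = a
  y (suc j) = x j
  ysteps : ∀ j → j < suc k → f (j + i) (y j) (y (2 + j)) ≢ y (1 + j)
  ysteps zero    _         = r
  ysteps (suc j) (s≤s j<k) =
    subst (λ l → f l (x j) (x (2 + j)) ≢ x (1 + j)) (+-suc j i) (steps j j<k)

-- Phrased with pairs, so that the exceptional colour need be neither named nor decided.
AllButOne : ∀ {q} → (Fin q → Set) → Set
AllButOne P = ∀ x y → x ≢ y → P x ⊎ P y

0≢1 : ∀ {q} → _≢_ {A = Fin (2 + q)} 0F 1F
0≢1 ()
0≢2 : ∀ {q} → _≢_ {A = Fin (3 + q)} 0F 2F
0≢2 ()
1≢2 : ∀ {q} → _≢_ {A = Fin (3 + q)} 1F 2F
1≢2 ()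

allButOne⇒two : ∀ {q} {P : Fin (3 + q) → Set} → AllButOne P →
                ∃[ x ] ∃[ y ] (x ≢ y × P x × P y)
allButOne⇒two P with P 0F 1F 0≢1
... | inj₁ p = [ (λ r → _ , _ , 0≢1 , p , r) , (λ r → _ , _ , 0≢2 , p , r) ]′ (P 1F 2F 1≢2)
... | inj₂ p = [ (λ r → _ , _ , 0≢1 , r , p) , (λ r → _ , _ , 1≢2 , p , r) ]′ (P 0F 2F 0≢2)

allButOne-∩ : ∀ {q} {P Q : Fin (3 + q) → Set} → AllButOne P → AllButOne Q → ∃[ x ] (P x × Q x)
allButOne-∩ P Q with allButOne⇒two P
... | x , y , x≢y , px , py = [ (λ r → x , px , r) , (λ r → y , py , r) ]′ (Q x y x≢y)

≢-one : ∀ {q} {x y : Fin q} → x ≢ y → (z : Fin q) → z ≢ x ⊎ z ≢ y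
≢-one {x = x} x≢y z with z ≟ x
... | no z≢x = inj₁ z≢x
... | yes refl = inj₂ x≢y

module _ {q} {f : Guesses q} where

  -- The vertex coloured `x` or `y` sees `p` and `z` in both cases, so its guess can rule out only
  -- one of the two extensions.
  branch : ∀ {k i a b p x y} → x ≢ y → Walk f k i a b p x → Walk f k i a b p y → ∀ z →
           Walk f (suc k) i a b x z ⊎ Walk f (suc k) i a b y z
  branch {k} {i} {p = p} x≢y v w z with ≢-one x≢y (f (k + i) p z)
  ... | inj₁ r = inj₁ (snoc v r)
  ... | inj₂ r = inj₂ (snoc w r)

Fork : ∀ {q} (f : Guesses q) (k i : ℕ) (a b : Fin q) → Set
Fork f k i a b = ∃[ p ] ∃[ x ] ∃[ y ] (x ≢ y × Walk f k i a b p x × Walk f k i a b p y)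

Dense : ∀ {q} (f : Guesses q) (k i : ℕ) (a b : Fin q) → Set
Dense f k i a b = ∀ z → AllButOne λ y → Walk f k i a b y z

module _ {q} {f : Guesses (3 + q)} where

  fork-start : ∀ {i a b x y} → x ≢ y → f i a x ≢ b → f i a y ≢ b → Fork f 1 i a b
  fork-start x≢y r s = _ , _ , _ , x≢y , r ∷ [] , s ∷ []

  -- Of the three walks ending in 0, 1 and 2, two have the same penultimate colour.
  fork-suc : ∀ {k i a b} → Fork f k i a b → Fork f (suc k) i a b
  fork-suc (p , x , y , x≢y , v , w)
    with branch x≢y v w 0F | branch x≢y v w 1F | branch x≢y v w 2F
  ... | inj₁ r | inj₁ s | _      = _ , _ , _ , 0≢1 , r , s
  ... | inj₂ r | inj₂ s | _      = _ , _ , _ , 0≢1 , r , s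
  ... | inj₁ r | inj₂ _ | inj₁ s = _ , _ , _ , 0≢2 , r , s
  ... | inj₂ r | inj₁ _ | inj₂ s = _ , _ , _ , 0≢2 , r , s
  ... | inj₁ _ | inj₂ r | inj₂ s = _ , _ , _ , 1≢2 , r , s
  ... | inj₂ _ | inj₁ r | inj₁ s = _ , _ , _ , 1≢2 , r , s

  fork-reaches : ∀ {i a b} k → Fork f 1 i a b → ∀ z → ∃[ y ] Walk f (2 + k) i a b y z
  fork-reaches {i} {a} {b} k F z with iterate k
    where
    iterate : ∀ k → Fork f (suc k) i a b
    iterate zero    = F
    iterate (suc k) = fork-suc (iterate k)
  ... | p , x , y , x≢y , v , w = [ (λ r → x , r) , (λ r → y , r) ]′ (branch x≢y v w z)

  dense-start : ∀ {i a b} → (∀ z → f i a z ≢ b) → Dense f 2 i a b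
  dense-start {i} {a} {b} free z x y x≢y with ≢-one x≢y (f (suc i) b z)
  ... | inj₁ r = inj₁ (free x ∷ r ∷ [])
  ... | inj₂ r = inj₂ (free y ∷ r ∷ [])

  -- The penultimate colours before `x` and those before `y` each omit at most one of three or more
  -- colours, so some `p` serves both and `branch` applies there.
  dense-suc : ∀ {k i a b} → Dense f k i a b → Dense f (suc k) i a b
  dense-suc D z x y x≢y with allButOne-∩ (D x) (D y)
  ... | p , v , w = branch x≢y v w z

  dense-+ : ∀ {k i a b} j → Dense f k i a b → Dense f (j + k) i a b
  dense-+ zero    D = D
  dense-+ (suc j) D = dense-suc (dense-+ j D)

-- Three colours on a cycle

Distinct : (a b c : Fin 3) → Set
Distinct a b c = a ≢ b × a ≢ c × b ≢ c

-- Only meaningful for a ≢ b.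
third : (a b : Fin 3) → Fin 3
third 0F 1F = 2F
third 0F 2F = 1F
third 1F 0F = 2F
third 1F 2F = 0F
third 2F 0F = 1F
third 2F 1F = 0F
third a  _  = a

abstract
  third-comm : ∀ a b → third a b ≡ third b a
  third-comm = from-yes (all? λ a → all? λ b → third a b ≟ third b a)

abstract
  third-distinct : ∀ a b → a ≢ b → Distinct a b (third a b)
  third-distinct = from-yes (all? λ a → all? λ b → ¬? (a ≟ b) →-dec
    (¬? (a ≟ b) ×-dec ¬? (a ≟ third a b) ×-dec ¬? (b ≟ third a b)))

others : (a : Fin 3) → ∃[ b ] ∃[ c ] Distinct a b c
others 0F = 1F , 2F , 0≢1 , 0≢2 , 1≢2
others 1F = 0F , 2F , (λ ()) , 1≢2 , 0≢2
others 2F = 0F , 1F , (λ ()) , (λ ()) , 0≢1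

avoid : ∀ (p p′ : Fin 3) → ∃[ z ] (z ≢ p × z ≢ p′)
avoid p p′ with p ≟ p′
... | no p≢p′ = let _ , q , r = third-distinct p p′ p≢p′ in _ , (λ e → q (sym e)) , λ e → r (sym e)
... | yes refl = let z , _ , q , _ = others p in z , (λ e → q (sym e)) , λ e → q (sym e)

abstract
  third-unique : ∀ a b c → Distinct a b c → c ≡ third a b
  third-unique = from-yes (all? λ a → all? λ b → all? λ c →
    (¬? (a ≟ b) ×-dec ¬? (a ≟ c) ×-dec ¬? (b ≟ c)) →-dec (c ≟ third a b))

total : (Fin 3 → ℕ) → ℕ
total g = g 0F + (g 1F + g 2F)

sum-distinct : ∀ (g : Fin 3 → ℕ) {a b c} → Distinct a b c →
               g a + (g b + g c) ≡ total g
sum-distinct g {0F} {1F} {2F} _ = refl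
sum-distinct g {0F} {2F} {1F} _ = cong (g 0F +_) (+-comm (g 2F) (g 1F))
sum-distinct g {1F} {0F} {2F} _ = swap₁₂ (g 1F) (g 0F) (g 2F)
  where
  swap₁₂ : ∀ x y z → x + (y + z) ≡ y + (x + z)
  swap₁₂ x y z = trans (sym (+-assoc x y z)) (trans (cong (_+ z) (+-comm x y)) (+-assoc y x z))
sum-distinct g {1F} {2F} {0F} _ = trans (sym (+-assoc (g 1F) _ _)) (+-comm _ (g 0F))
sum-distinct g {2F} {0F} {1F} _ = trans (+-comm (g 2F) _) (+-assoc (g 0F) _ _)
sum-distinct g {2F} {1F} {0F} _ = trans (sym (+-assoc (g 2F) _ _))
  (trans (+-comm _ (g 0F)) (cong (g 0F +_) (+-comm (g 2F) _)))
sum-distinct g {0F} {0F} (d , _)          = contradiction refl d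
sum-distinct g {1F} {1F} (d , _)          = contradiction refl d
sum-distinct g {2F} {2F} (d , _)          = contradiction refl d
sum-distinct g {0F} {1F} {0F} (_ , d , _) = contradiction refl d
sum-distinct g {0F} {2F} {0F} (_ , d , _) = contradiction refl d
sum-distinct g {1F} {0F} {1F} (_ , d , _) = contradiction refl d
sum-distinct g {1F} {2F} {1F} (_ , d , _) = contradiction refl d
sum-distinct g {2F} {0F} {2F} (_ , d , _) = contradiction refl d
sum-distinct g {2F} {1F} {2F} (_ , d , _) = contradiction refl d
sum-distinct g {0F} {1F} {1F} (_ , _ , d) = contradiction refl d
sum-distinct g {0F} {2F} {2F} (_ , _ , d) = contradiction refl d
sum-distinct g {1F} {0F} {0F} (_ , _ , d) = contradiction refl d
sum-distinct g {1F} {2F} {2F} (_ , _ , d) = contradiction refl d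
sum-distinct g {2F} {0F} {0F} (_ , _ , d) = contradiction refl d
sum-distinct g {2F} {1F} {1F} (_ , _ , d) = contradiction refl d

-- Counting the values of a function on three colours

hit : ∀ {A : Set} → Dec A → ℕ
hit (yes _) = 1
hit (no  _) = 0

cnt : (Fin 3 → Fin 3) → Fin 3 → ℕ
cnt φ y = hit (φ 0F ≟ y) + (hit (φ 1F ≟ y) + hit (φ 2F ≟ y))

abstract
  cnt-sum : ∀ φ → total (cnt φ) ≡ 3
  cnt-sum φ = table (φ 0F) (φ 1F) (φ 2F)
    where
    row : (a b c y : Fin 3) → ℕ
    row a b c y = hit (a ≟ y) + (hit (b ≟ y) + hit (c ≟ y))
    table : ∀ a b c → row a b c 0F + (row a b c 1F + row a b c 2F) ≡ 3
    table = from-yes (all? λ a → all? λ b → all? λ c →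
      (row a b c 0F + (row a b c 1F + row a b c 2F)) ℕ.≟ 3)

cnt≤1⇒two-misses : ∀ φ y → cnt φ y ≤ 1 → ∃[ x ] ∃[ z ] (x ≢ z × φ x ≢ y × φ z ≢ y)
cnt≤1⇒two-misses φ y c≤1 with φ 0F ≟ y | φ 1F ≟ y | φ 2F ≟ y
... | no p  | no q  | _     = _ , _ , 0≢1 , p , q
... | no p  | yes _ | no q  = _ , _ , 0≢2 , p , q
... | yes _ | no p  | no q  = _ , _ , 1≢2 , p , q
... | yes _ | yes _ | yes _ = contradiction c≤1 λ { (s≤s ()) }
... | yes _ | yes _ | no _  = contradiction c≤1 λ { (s≤s ()) }
... | yes _ | no _  | yes _ = contradiction c≤1 λ { (s≤s ()) }
... | no _  | yes _ | yes _ = contradiction c≤1 λ { (s≤s ()) }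

two-hits⇒2≤cnt : ∀ φ y {x z} → x ≢ z → φ x ≡ y → φ z ≡ y → 2 ≤ cnt φ y
two-hits⇒2≤cnt φ y {x} {z} x≢z p q with φ 0F ≟ y | φ 1F ≟ y | φ 2F ≟ y
two-hits⇒2≤cnt φ y {x} {z} x≢z p q | yes _ | yes _ | _     = s≤s (s≤s z≤n)
two-hits⇒2≤cnt φ y {x} {z} x≢z p q | yes _ | no _  | yes _ = s≤s (s≤s z≤n)
two-hits⇒2≤cnt φ y {x} {z} x≢z p q | no _  | yes _ | yes _ = s≤s (s≤s z≤n)
two-hits⇒2≤cnt φ y {0F} {0F} x≢z p q | _ | _ | _ = contradiction refl x≢z
two-hits⇒2≤cnt φ y {1F} {1F} x≢z p q | _ | _ | _ = contradiction refl x≢z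
two-hits⇒2≤cnt φ y {2F} {2F} x≢z p q | _ | _ | _ = contradiction refl x≢z
two-hits⇒2≤cnt φ y {0F} {1F} x≢z p q | no r | _ | _ = contradiction p r
two-hits⇒2≤cnt φ y {0F} {2F} x≢z p q | no r | _ | _ = contradiction p r
two-hits⇒2≤cnt φ y {1F} {0F} x≢z p q | no r | _ | _ = contradiction q r
two-hits⇒2≤cnt φ y {2F} {0F} x≢z p q | no r | _ | _ = contradiction q r
two-hits⇒2≤cnt φ y {1F} {0F} x≢z p q | _ | no r | _ = contradiction p r
two-hits⇒2≤cnt φ y {1F} {2F} x≢z p q | _ | no r | _ = contradiction p r
two-hits⇒2≤cnt φ y {0F} {1F} x≢z p q | _ | no r | _ = contradiction q r
two-hits⇒2≤cnt φ y {2F} {1F} x≢z p q | _ | no r | _ = contradiction q r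
two-hits⇒2≤cnt φ y {2F} {0F} x≢z p q | _ | _ | no r = contradiction p r
two-hits⇒2≤cnt φ y {2F} {1F} x≢z p q | _ | _ | no r = contradiction p r
two-hits⇒2≤cnt φ y {0F} {2F} x≢z p q | _ | _ | no r = contradiction q r
two-hits⇒2≤cnt φ y {1F} {2F} x≢z p q | _ | _ | no r = contradiction q r

cnt≡2⇒one-miss : ∀ φ y → cnt φ y ≡ 2 → ∃[ p ] (φ p ≢ y × (∀ z → z ≢ p → φ z ≡ y))
cnt≡2⇒one-miss φ y c≡2 with φ 0F ≟ y | φ 1F ≟ y | φ 2F ≟ y
... | no p  | yes q | yes r = _ , p , λ { 0F z≢ → contradiction refl z≢ ; 1F _ → q ; 2F _ → r }
... | yes q | no p  | yes r = _ , p , λ { 0F _ → q ; 1F z≢ → contradiction refl z≢ ; 2F _ → r }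
... | yes q | yes r | no p  = _ , p , λ { 0F _ → q ; 1F _ → r ; 2F z≢ → contradiction refl z≢ }
cnt≡2⇒one-miss φ y () | yes _ | yes _ | yes _
cnt≡2⇒one-miss φ y () | yes _ | no _  | no _
cnt≡2⇒one-miss φ y () | no _  | yes _ | no _
cnt≡2⇒one-miss φ y () | no _  | no _  | yes _
cnt≡2⇒one-miss φ y () | no _  | no _  | no _

cnt≡0⇒no-hit : ∀ φ y → cnt φ y ≡ 0 → ∀ z → φ z ≢ y
cnt≡0⇒no-hit φ y c≡0 with φ 0F ≟ y | φ 1F ≟ y | φ 2F ≟ y
... | no p | no q | no r = λ { 0F → p ; 1F → q ; 2F → r }
cnt≡0⇒no-hit φ y () | yes _ | _     | _
cnt≡0⇒no-hit φ y () | no _  | yes _ | _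
cnt≡0⇒no-hit φ y () | no _  | no _  | yes _

no-hit⇒cnt≡0 : ∀ φ y → (∀ z → φ z ≢ y) → cnt φ y ≡ 0
no-hit⇒cnt≡0 φ y miss with φ 0F ≟ y | φ 1F ≟ y | φ 2F ≟ y
... | yes p | _     | _     = contradiction p (miss 0F)
... | no _  | yes p | _     = contradiction p (miss 1F)
... | no _  | no _  | yes p = contradiction p (miss 2F)
... | no _  | no _  | no _  = refl

-- The nine entries sum to 9 by rows, so three columns of at least 3 leave no slack.
tight-columns : ∀ (g : Fin 3 → Fin 3 → ℕ) → (∀ s → total (g s) ≡ 3) →
  (∀ x → 3 ≤ total λ s → g s x) → ∀ x → total (λ s → g s x) ≡ 3
tight-columns g rows cols = λ { 0F → proj₁ all ; 1F → proj₁ (proj₂ all) ; 2F → proj₂ (proj₂ all) }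
  where
  open +-*-Solver
  sum≡9 : ∀ a₀ a₁ a₂ b₀ b₁ b₂ c₀ c₁ c₂ →
    a₀ + (a₁ + a₂) ≡ 3 → b₀ + (b₁ + b₂) ≡ 3 → c₀ + (c₁ + c₂) ≡ 3 →
    (a₀ + (b₀ + c₀)) + ((a₁ + (b₁ + c₁)) + (a₂ + (b₂ + c₂))) ≡ 9
  sum≡9 a₀ a₁ a₂ b₀ b₁ b₂ c₀ c₁ c₂ ra rb rc = trans
    (solve 9 (λ a₀ a₁ a₂ b₀ b₁ b₂ c₀ c₁ c₂ →
       (a₀ :+ (b₀ :+ c₀)) :+ ((a₁ :+ (b₁ :+ c₁)) :+ (a₂ :+ (b₂ :+ c₂))) :=
       (a₀ :+ (a₁ :+ a₂)) :+ ((b₀ :+ (b₁ :+ b₂)) :+ (c₀ :+ (c₁ :+ c₂))))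
       refl a₀ a₁ a₂ b₀ b₁ b₂ c₀ c₁ c₂)
    (cong₂ _+_ ra (cong₂ _+_ rb rc))
  tight : ∀ {x y z} → 3 ≤ x → 3 ≤ y → 3 ≤ z → x + (y + z) ≡ 9 → x ≡ 3 × y ≡ 3 × z ≡ 3
  tight {x} {y} {z} p q r e = low p q r e , low q p r e′ , low r p q e″
    where
    low : ∀ {x y z} → 3 ≤ x → 3 ≤ y → 3 ≤ z → x + (y + z) ≡ 9 → x ≡ 3
    low {x} {y} {z} p q r e = ℕ.≤-antisym (ℕ.+-cancelʳ-≤ 6 x 3 (begin
      x + 6       ≤⟨ ℕ.+-monoʳ-≤ x (ℕ.+-mono-≤ q r) ⟩
      x + (y + z) ≡⟨ e ⟩
      9 ∎)) p
      where open ℕ.≤-Reasoning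
    e′ : y + (x + z) ≡ 9
    e′ = trans (solve 3 (λ x y z → y :+ (x :+ z) := x :+ (y :+ z)) refl x y z) e
    e″ : z + (x + y) ≡ 9
    e″ = trans (solve 3 (λ x y z → z :+ (x :+ y) := x :+ (y :+ z)) refl x y z) e
  all = tight (cols 0F) (cols 1F) (cols 2F)
    (sum≡9 (g 0F 0F) (g 0F 1F) (g 0F 2F) (g 1F 0F) (g 1F 1F) (g 1F 2F) (g 2F 0F) (g 2F 1F) (g 2F 2F)
      (rows 0F) (rows 1F) (rows 2F))

column≥3 : ∀ (g : Fin 3 → ℕ) →
  (∀ {s s′ s″} → Distinct s s′ s″ → g s ≡ 0 → g s′ ≢ 0) →
  (∀ {s s′ s″} → Distinct s s′ s″ → g s ≡ 0 → g s′ ≤ 1 → ¬ g s″ ≤ 1) →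
  3 ≤ total g
column≥3 g noTwo noOne = byCases (g 0F ℕ.≟ 0) (g 1F ℕ.≟ 0) (g 2F ℕ.≟ 0)
  where
  big : ∀ {x y} → x ≢ 0 → y ≢ 0 → (x ≤ 1 → ¬ y ≤ 1) → 3 ≤ x + y
  big {zero}          p _ _ = contradiction refl p
  big {suc x} {zero}  _ p _ = contradiction refl p
  big {1} {1}         _ _ r = contradiction (s≤s z≤n) (r (s≤s z≤n))
  big {1} {suc (suc y)} _ _ _ = s≤s (s≤s (s≤s z≤n))
  big {suc (suc x)} {suc y} _ _ _ = s≤s (s≤s (ℕ.≤-trans (s≤s z≤n) (ℕ.m≤n+m (suc y) x)))
  zeroCase : ∀ {s s′ s″} → Distinct s s′ s″ → g s ≡ 0 → 3 ≤ total g
  zeroCase {s} {s′} {s″} d@(p , q , r) e = subst (3 ≤_) (sum-distinct g d)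
    (subst (λ k → 3 ≤ k + (g s′ + g s″)) (sym e)
      (big (noTwo d e) (noTwo (q , p , λ x → r (sym x)) e) (noOne d e)))
  byCases : Dec (g 0F ≡ 0) → Dec (g 1F ≡ 0) → Dec (g 2F ≡ 0) → 3 ≤ total g
  byCases (yes e) _ _ = zeroCase (0≢1 , 0≢2 , 1≢2) e
  byCases _ (yes e) _ = zeroCase {1F} {2F} {0F} (1≢2 , (λ ()) , λ ()) e
  byCases _ _ (yes e) = zeroCase ((λ ()) , (λ ()) , 0≢1) e
  byCases (no p) (no q) (no r) = ℕ.+-mono-≤ (ℕ.n≢0⇒n>0 p) (ℕ.+-mono-≤ (ℕ.n≢0⇒n>0 q) (ℕ.n≢0⇒n>0 r))

flip : ℕ → Bool → Bool
flip zero    b = b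
flip (suc k) b = not (flip k b)

flip-even : ∀ h b → flip (h * 2) b ≡ b
flip-even zero    b = refl
flip-even (suc h) b = trans (not-involutive _) (flip-even h b)

flip-not : ∀ k b → flip k (not b) ≡ not (flip k b)
flip-not zero    b = refl
flip-not (suc k) b = cong not (flip-not k b)

flip-flip : ∀ k b → flip k (flip k b) ≡ b
flip-flip zero    b = refl
flip-flip (suc k) b = trans (cong not (flip-not k (flip k b)))
  (trans (not-involutive _) (flip-flip k b))

halves : ∀ k → ∃[ h ] (k ≡ h * 2 ⊎ k ≡ 1 + h * 2)
halves zero    = 0 , inj₁ refl
halves (suc k) with halves k
... | h , inj₁ refl = h , inj₂ refl
... | h , inj₂ refl = suc h , inj₁ refl

-- A winning strategy for three colours on a cycle of length n = 5 + k: no walk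
-- of n steps returns to its initial state.
module Winning3 (f : Guesses 3) (k : ℕ)
  (periodic : ∀ i → f (5 + k + i) ≡ f i)
  (noClosed : ∀ i a b → ¬ Walk f (5 + k) i a b a b) where

  m n : ℕ
  m = 4 + k
  n = 5 + k

  -- Only one vertex is left to guess, and if it were wrong the walk would close. Its guess is a
  -- function of `y` and `x`, so for fixed `x` returns from different `s` use different `y`.
  closing : ∀ {i s x y} → Walk f m i s x y s → f (m + i) y x ≡ s
  closing {i} {s} {x} {y} w = decidable-stable (f (m + i) y x ≟ s) λ r → noClosed i s x (snoc w r)

  Absent : ℕ → Fin 3 → Fin 3 → Set
  Absent i s x = ∀ z → f i s z ≢ x

  Returns : ℕ → Fin 3 → Fin 3 → Set
  Returns i s x = ∃[ y ] Walk f m i s x y s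

  count : ℕ → Fin 3 → Fin 3 → ℕ
  count i s x = cnt (f i s) x

  absent⇒dense : ∀ {i s x} → Absent i s x → Dense f m i s x
  absent⇒dense {i} {s} {x} a = subst (λ j → Dense f j i s x) (+-comm (2 + k) 2)
    (dense-+ (2 + k) (dense-start a))

  dense-clash : ∀ {i s s′ x} → s ≢ s′ → Dense f m i s x → ¬ Dense f m i s′ x
  dense-clash {i} {s} {s′} {x} s≢s′ D D′ =
    let y , v , w = allButOne-∩ {P = λ y → Walk f m i s x y s} (D s) (D′ s′) in
    s≢s′ (trans (sym (closing v)) (closing w))

  rows-cover : ∀ {i s s′ x} → s ≢ s′ → Absent i s x → ¬ Absent i s′ x
  rows-cover s≢s′ a a′ = dense-clash s≢s′ (absent⇒dense a) (absent⇒dense a′)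

  -- The returns of `s′` and `s″` use different colours `y` and `z`. Density lets `s` return through
  -- one of these, where `closing` would then name two colours.
  absent-returns : ∀ {i s s′ s″ x} → Distinct s s′ s″ → Absent i s x → Returns i s′ x → ¬ Returns i s″ x
  absent-returns {i} {s} {s′} {s″} {x} (p , q , r) a (y , v) (z , w) =
    [ (λ u → p (trans (sym (closing u)) (closing v))) ,
      (λ u → q (trans (sym (closing u)) (closing w))) ]′
      (absent⇒dense a s y z y≢z)
    where
    y≢z : y ≢ z
    y≢z e = r (trans (sym (closing v)) (trans (cong (λ y → f (m + i) y x) e) (closing w)))

  few⇒returns : ∀ {i s x} → count i s x ≤ 1 → Returns i s x
  few⇒returns {i} {s} {x} c = go (cnt≤1⇒two-misses (f i s) x c)
    where
    go : ∃[ y ] ∃[ z ] (y ≢ z × f i s y ≢ x × f i s z ≢ x) → Returns i s x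
    go (_ , _ , z≢z′ , r , r′) = fork-reaches (2 + k) (fork-start z≢z′ r r′) s

  absent-few : ∀ {i s s′ s″ x} → Distinct s s′ s″ → count i s x ≡ 0 → count i s′ x ≤ 1 → ¬ count i s″ x ≤ 1
  absent-few d c c′ c″ = absent-returns d (cnt≡0⇒no-hit _ _ c) (few⇒returns c′) (few⇒returns c″)

  zero-unique : ∀ {i s s′ x} → s ≢ s′ → count i s x ≡ 0 → count i s′ x ≢ 0
  zero-unique s≢s′ c c′ = rows-cover s≢s′ (cnt≡0⇒no-hit _ _ c) (cnt≡0⇒no-hit _ _ c′)

  column≡3 : ∀ {i x s s′ s″} → Distinct s s′ s″ → count i s x + (count i s′ x + count i s″ x) ≡ 3
  column≡3 {i} {x} d = trans (sum-distinct (λ s → count i s x) d)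
    (tight-columns (count i) (λ s → cnt-sum (f i s)) at-least x)
    where
    at-least : ∀ x → 3 ≤ total λ s → count i s x
    at-least x = column≥3 (λ s → count i s x) (λ d → zero-unique (proj₁ d)) absent-few

  -- The column sums to 3 and has at most one zero, which excludes an entry 3.
  two⇒others : ∀ {i s s′ s″ x} → Distinct s s′ s″ → 2 ≤ count i s x →
               count i s x ≡ 2 × (count i s′ x ≡ 0 × count i s″ x ≤ 1 ⊎ count i s″ x ≡ 0 × count i s′ x ≤ 1)
  two⇒others {i} {s} {s′} {s″} {x} d@(p , q , r) two =
    split (count i s x) (count i s′ x) (count i s″ x) two (column≡3 d) (zero-unique r)
    where
    split : ∀ a b c → 2 ≤ a → a + (b + c) ≡ 3 → (b ≡ 0 → c ≢ 0) → a ≡ 2 × (b ≡ 0 × c ≤ 1 ⊎ c ≡ 0 × b ≤ 1)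
    split 2 0 1 _ _ _ = refl , inj₁ (refl , s≤s z≤n)
    split 2 1 0 _ _ _ = refl , inj₂ (refl , s≤s z≤n)
    split 3 0 0 _ _ z = contradiction refl (z refl)
    split 0 _ _ () _ _
    split 1 _ _ (s≤s ()) _ _
    split 2 0 0 _ () _
    split 2 0 (suc (suc _)) _ () _
    split 2 1 (suc _) _ () _
    split 2 (suc (suc _)) _ _ () _
    split 3 0 (suc _) _ () _
    split 3 (suc _) _ _ () _
    split (suc (suc (suc (suc _)))) _ _ _ () _

  -- Of the two other rows one never guesses `x` and the other guesses it at most once, hence
  -- returns; `absent-returns` leaves no room for a further return.
  two⇒¬returns : ∀ {i s x} → 2 ≤ count i s x → ¬ Returns i s x
  two⇒¬returns {i} {s} {x} two ret =
    let s′ , s″ , d@(p , q , r) = others s in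
    [ (λ c → absent-returns ((λ e → p (sym e)) , r , q) (cnt≡0⇒no-hit (f i s′) x (proj₁ c)) ret (few⇒returns (proj₂ c))) ,
      (λ c → absent-returns ((λ e → q (sym e)) , (λ e → r (sym e)) , p) (cnt≡0⇒no-hit (f i s″) x (proj₁ c)) ret (few⇒returns (proj₂ c))) ]′
      (proj₂ (two⇒others d two))

  -- A state (s , x) whose only successor is (x , p).
  TrapOf : (Fin 3 → Fin 3 → Fin 3) → (s x p : Fin 3) → Set
  TrapOf φ s x p = φ s p ≢ x × (∀ z → z ≢ p → φ s z ≡ x)

  Trap : ℕ → (s x p : Fin 3) → Set
  Trap i = TrapOf (f i)

  trap⇒two : ∀ {i s x p} → Trap i s x p → 2 ≤ count i s x
  trap⇒two {p = p} (_ , hits) with others p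
  ... | z , z′ , z≢p , z′≢p , z≢z′ =
    two-hits⇒2≤cnt _ _ z≢z′ (hits z λ e → z≢p (sym e)) (hits z′ λ e → z′≢p (sym e))

  two⇒trap : ∀ {i s x} → 2 ≤ count i s x → ∃[ p ] Trap i s x p
  two⇒trap {i} {s} {x} two =
    let _ , _ , d = others s in cnt≡2⇒one-miss (f i s) x (proj₁ (two⇒others d two))

  -- If the successor `(x , p)` had two continuations, they would form a fork, which after the
  -- forced first step still has time to reach `s`. The trap would then return within `m` steps,
  -- against `two⇒¬returns`.
  trap-next : ∀ {i s x p} → Trap i s x p → ∃[ p′ ] Trap (suc i) x p p′
  trap-next {i} {s} {x} {p} T = byCount (2 ℕ.≤? count (suc i) x p)
    where
    byCount : Dec (2 ≤ count (suc i) x p) → ∃[ p′ ] Trap (suc i) x p p′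
    byCount (yes two) = two⇒trap two
    byCount (no ¬two) =
      let _ , _ , z≢z′ , r , r′ = cnt≤1⇒two-misses (f (suc i) x) p (ℕ.≤-pred (ℕ.≰⇒> ¬two))
          y , w = fork-reaches (1 + k) (fork-start z≢z′ r r′) s
      in ⊥-elim (two⇒¬returns (trap⇒two T) (y , proj₁ T ∷ w))

  trap-injective : ∀ {i s s′ x p p′} → s ≢ s′ → Trap i s x p → ¬ Trap i s′ x p′
  trap-injective {i} {s} {s′} {x} s≢s′ T T′ =
    [ (λ c → contradiction (subst (2 ≤_) (proj₁ c) two′) λ ()) ,
      (λ c → contradiction (ℕ.≤-trans two′ (proj₂ c)) λ { (s≤s ()) }) ]′
      (proj₂ (two⇒others (third-distinct s s′ s≢s′) (trap⇒two T)))
    where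
    two′ : 2 ≤ count i s′ x
    two′ = trap⇒two T′

  trap-functional : ∀ {i s x x′ p p′} → Trap i s x p → Trap i s x′ p′ → x ≡ x′
  trap-functional {p = p} {p′} (_ , h) (_ , h′) =
    let z , q , r = avoid p p′ in trans (sym (h z q)) (h′ z r)

  TrapSequence : ℕ → (ℕ → Fin 3) → Set
  TrapSequence i t = ∀ j → Trap (j + i) (t j) (t (1 + j)) (t (2 + j))

  trapSequence : ∀ {i s x p} → Trap i s x p → ∃[ t ] (t 0 ≡ s × TrapSequence i t)
  trapSequence {i} {s} {x} {p} T = (λ j → proj₁ (state j)) , refl , λ j → proj₂ (proj₂ (proj₂ (state j)))
    where
    state : ∀ j → ∃[ s ] ∃[ x ] ∃[ p ] Trap (j + i) s x p
    state zero    = s , x , p , T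
    state (suc j) = proj₁ (proj₂ (state j)) , proj₁ (proj₂ (proj₂ (state j))) ,
                    trap-next (proj₂ (proj₂ (proj₂ (state j))))

  module _ {i t} (T : TrapSequence i t) where

    tail : TrapSequence (suc i) (λ j → t (suc j))
    tail j = subst (λ l → Trap l (t (1 + j)) (t (2 + j)) (t (3 + j))) (sym (+-suc j i)) (T (suc j))

    shift : TrapSequence i (λ j → t (j + n))
    shift j = subst (λ φ → TrapOf φ (t (j + n)) (t (1 + (j + n))) (t (2 + (j + n))))
                (trans (cong f (trans (cong (_+ i) (+-comm j n)) (+-assoc n j i))) (periodic (j + i))) (T (j + n))

  -- Following `t` is itself a walk, since the successor of a trap is a wrong guess. If it came back
  -- to its first colour after a full turn, a trap would return.
  never-returns : ∀ {i t} → TrapSequence i t → ∀ j → t (j + n) ≢ t j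
  never-returns {i} {t} T zero e = two⇒¬returns (trap⇒two (T 0))
    (t m , subst (Walk f m i (t 0) (t 1) (t m)) e (fromSequence t m λ j _ → proj₁ (T j)))
  never-returns T (suc j) = never-returns (tail T) j

  coincide : ∀ {i t t′} → TrapSequence i t → TrapSequence i t′ → t 0 ≡ t′ 0 → ∀ j → t j ≡ t′ j
  coincide T T′ e zero    = e
  coincide {i} {t} {t′} T T′ e (suc j) = coincide (tail T) (tail T′)
    (trap-functional (T 0) (subst (λ s → Trap i s (t′ 1) (t′ 2)) (sym e) (T′ 0))) j

  separate : ∀ {i t t′} → TrapSequence i t → TrapSequence i t′ → t 0 ≢ t′ 0 → ∀ j → t j ≢ t′ j
  separate T T′ d zero    = d
  separate {i} {t} {t′} T T′ d (suc j) = separate (tail T) (tail T′)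
    (λ e → trap-injective d (T 0) (subst (λ x → Trap i (t′ 0) x (t′ 2)) (sym e) (T′ 0))) j

  turn : (ℕ → Fin 3) → ℕ → ℕ → Fin 3
  turn t zero    j = t j
  turn t (suc l) j = turn t l (j + n)

  turn-seq : ∀ {i t} → TrapSequence i t → ∀ l → TrapSequence i (turn t l)
  turn-seq T zero    = T
  turn-seq T (suc l) = shift (turn-seq T l)

  -- If the turns of t by 0, n and 2n are the three colours everywhere, colour
  -- position j by the turn number j δ, where n δ ≡ -1 mod 3.
  module ThreeTurns {i t} (T : TrapSequence i t) (second : ∀ j → turn t 2 j ≢ t j) (3∤n : ¬ 3 ∣ n) where

    τ : ℕ → ℕ → Fin 3
    τ = turn t

    τ₁ : ∀ l j → τ (1 + l) j ≢ τ l j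
    τ₁ l = never-returns (turn-seq T l)

    τ₂ : ∀ l j → τ (2 + l) j ≢ τ l j
    τ₂ zero    j = second j
    τ₂ (suc l) j = τ₂ l (j + n)

    τ₃ : ∀ l j → τ (3 + l) j ≡ τ l j
    τ₃ l j = trans (third-unique (τ (2 + l) j) (τ (1 + l) j) (τ (3 + l) j) (τ₁ (1 + l) j , (λ e → τ₁ (2 + l) j (sym e)) , λ e → τ₂ (1 + l) j (sym e)))
      (sym (third-unique (τ (2 + l) j) (τ (1 + l) j) (τ l j) (τ₁ (1 + l) j , τ₂ l j , τ₁ l j)))

    τ₃ₖ : ∀ K l j → τ (K * 3 + l) j ≡ τ l j
    τ₃ₖ zero    l j = refl
    τ₃ₖ (suc K) l j = trans (τ₃ (K * 3 + l) j) (τ₃ₖ K l j)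

    escape : ∀ δ K → 1 + n * δ ≡ K * 3 → (∀ l j → τ (δ + l) j ≢ τ l j) →
             (∀ l j → τ (δ + (δ + l)) j ≢ τ l j) → ⊥
    escape δ K e d₁ d₂ = noClosed i (x 0) (x 1) (subst₂′ xₙ xₙ₊₁ (fromSequence x n λ j _ → steps j))
      where
      x : ℕ → Fin 3
      x j = τ (j * δ) j
      -- Neither `δ` nor `2 δ` is a multiple of 3. So `x (2 + j)` is not the one successor of the
      -- trap at turn `j δ`, the guess is the colour of that turn at `1 + j`, and `x (1 + j)` is
      -- another turn's colour.
      steps : ∀ j → f (j + i) (x j) (x (2 + j)) ≢ x (1 + j)
      steps j e = d₁ (j * δ) (1 + j)
        (trans (sym e) (proj₂ (turn-seq T (j * δ) j) (x (2 + j)) (d₂ (j * δ) (2 + j))))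
      -- Position `n` at turn `n δ` is position 0 at turn `1 + n δ`, a multiple of 3.
      xₙ : x n ≡ x 0
      xₙ = trans (cong (λ l → τ l 0) (trans e (sym (ℕ.+-identityʳ (K * 3))))) (τ₃ₖ K 0 0)
      xₙ₊₁ : x (suc n) ≡ x 1
      xₙ₊₁ = trans (cong (λ l → τ l 1) (trans (sym (+-suc δ (n * δ))) (trans (cong (δ +_) e) (+-comm δ (K * 3)))))
        (trans (τ₃ₖ K δ 1) (cong (λ l → τ l 1) (sym (ℕ.+-identityʳ δ))))
      subst₂′ : ∀ {c d} → c ≡ x 0 → d ≡ x 1 → Walk f n i (x 0) (x 1) c d → Walk f n i (x 0) (x 1) (x 0) (x 1)
      subst₂′ refl refl w = w

    impossible : ⊥
    impossible = byResidue (n % 3) (n ℕ′./ 3) (m%n<n n 3) (m≡m%n+[m/n]*n n 3)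
      where
      open +-*-Solver
      byResidue : ∀ r q → r < 3 → n ≡ r + q * 3 → ⊥
      byResidue 0 q _ e = 3∤n (divides q e)
      byResidue 1 q _ e = escape 2 (1 + q * 2)
        (trans (cong (λ n → 1 + n * 2) e)
          (solve 1 (λ q → con 1 :+ (con 1 :+ q :* con 3) :* con 2 := (con 1 :+ q :* con 2) :* con 3) refl q))
        τ₂ (λ l j e → τ₁ l j (trans (sym (τ₃ (1 + l) j)) e))
      byResidue 2 q _ e = escape 1 (1 + q)
        (trans (cong (λ n → 1 + n * 1) e)
          (solve 1 (λ q → con 1 :+ (con 2 :+ q :* con 3) :* con 1 := (con 1 :+ q) :* con 3) refl q))
        τ₁ τ₂
      byResidue (suc (suc (suc _))) _ (s≤s (s≤s (s≤s ()))) _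

  -- Otherwise the two turns of t swap two colours, and u j is the third one.
  module TwoTurns {i t} (T : TrapSequence i t) (second : ∀ j → t (j + n + n) ≡ t j) where

    col : Bool → ℕ → Fin 3
    col false j = t j
    col true  j = t (j + n)

    col-seq : ∀ b → TrapSequence i (col b)
    col-seq false = T
    col-seq true  = shift T

    col-n : ∀ b j → col b (j + n) ≡ col (not b) j
    col-n false j = refl
    col-n true  j = second j

    col-≢ : ∀ b j → col b j ≢ col (not b) j
    col-≢ false j e = never-returns T j (sym e)
    col-≢ true  j e = never-returns T j e

    u : ℕ → Fin 3
    u j = third (col false j) (col true j)

    u-n : ∀ j → u (j + n) ≡ u j
    u-n j = trans (cong (third (t (j + n))) (second j)) (third-comm (t (j + n)) (t j))

    col-u : ∀ b j → Distinct (col b j) (col (not b) j) (u j)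
    col-u false j = third-distinct (t j) (t (j + n)) (col-≢ false j)
    col-u true  j = let p , q , r = col-u false j in (λ e → p (sym e)) , r , q

    u≢col : ∀ b j → u j ≢ col b j
    u≢col b j e = proj₁ (proj₂ (col-u b j)) (sym e)

    col≢u : ∀ b j → col b j ≢ u j
    col≢u b j e = u≢col b j (sym e)

    u-unique : ∀ b j z → z ≢ col b j → z ≢ col (not b) j → z ≡ u j
    u-unique b j z p q = trans
      (third-unique (col b j) (col (not b) j) z (col-≢ b j , (λ e → p (sym e)) , λ e → q (sym e)))
      (sym (third-unique (col b j) (col (not b) j) (u j) (col-u b j)))

    forced : ∀ b j z → z ≢ col b (2 + j) → f (j + i) (col b j) z ≡ col b (1 + j)
    forced b j = proj₂ (col-seq b j)

    col-seq-from : ∀ b j → TrapSequence (j + i) (λ l → col b (l + j))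
    col-seq-from b j l = subst (λ p → Trap p (col b (l + j)) (col b (1 + (l + j))) (col b (2 + (l + j))))
      (+-assoc l j i) (col-seq b (l + j))

    count-u≤1 : ∀ j {s} → (∀ {p} → ¬ Trap (j + i) s (u (1 + j)) p) → count (j + i) s (u (1 + j)) ≤ 1
    count-u≤1 j {s} ¬T = ℕ.≤-pred (ℕ.≰⇒> λ two → ¬T (proj₂ (two⇒trap two)))

    count-col-u≤1 : ∀ b j → count (j + i) (col b j) (u (1 + j)) ≤ 1
    count-col-u≤1 b j = count-u≤1 j λ T′ → u≢col b (1 + j) (trap-functional T′ (col-seq b j))

    -- A third trap sequence would return to itself.
    ¬trap-u : ∀ j {p} → ¬ Trap (j + i) (u j) (u (1 + j)) p
    ¬trap-u j T′ =
      let t′ , e , T″ = trapSequence T′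
          apart : ∀ b → t′ n ≢ col (not b) j
          apart b e′ = separate T″ (col-seq-from b j) (λ e″ → u≢col b j (trans (sym e) e″)) n
            (trans e′ (sym (trans (cong (col b) (+-comm n j)) (col-n b j))))
      in never-returns T″ 0 (trans (u-unique false j (t′ n) (apart true) (apart false)) (sym e))

    -- Otherwise the row of `col b j` would never guess `u (1 + j)`, while the other two rows guess
    -- it at most once each, which `absent-few` forbids.
    exceptional : ∀ b j → f (j + i) (col b j) (col b (2 + j)) ≡ u (1 + j)
    exceptional b j = decidable-stable (v ≟ u (1 + j)) λ v≢u → absent-few (col-u b j)
        (no-hit⇒cnt≡0 (f (j + i) (col b j)) (u (1 + j)) (absent v≢u))
        (count-col-u≤1 (not b) j) (count-u≤1 j (¬trap-u j))
      where
      v : Fin 3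
      v = f (j + i) (col b j) (col b (2 + j))
      absent : v ≢ u (1 + j) → Absent (j + i) (col b j) (u (1 + j))
      absent v≢u z e with z ≟ col b (2 + j)
      ... | yes refl = v≢u e
      ... | no z≢ = u≢col b (1 + j) (trans (sym e) (forced b j z z≢))

    u-guessed : ∀ j → ∃[ z ] f (j + i) (u j) z ≡ u (1 + j)
    u-guessed j = decidable-stable (Fin.any? λ z → f (j + i) (u j) z ≟ u (1 + j)) λ none →
      let p , q , r = col-u false j in
      absent-few ((λ e → q (sym e)) , (λ e → r (sym e)) , p)
        (no-hit⇒cnt≡0 (f (j + i) (u j)) (u (1 + j)) λ z e → none (z , e))
        (count-col-u≤1 false j) (count-col-u≤1 true j)

    infixl 5 _▷_
    _▷_ : ∀ {k j a b c d e} → Walk f k (j + i) a b c d → f (k + j + i) c e ≢ d → Walk f (suc k) (j + i) a b d e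
    _▷_ {k} {j} {c = c} {d} {e} w r = snoc w (subst (λ p → f p c e ≢ d) (+-assoc k j i) r)

    ¬closed : ∀ {j a b c d} → c ≡ a → d ≡ b → ¬ Walk f n j a b c d
    ¬closed refl refl w = noClosed _ _ _ w

    -- Every vertex sees the exceptional entry of its row and therefore guesses `u`. As a full turn
    -- swaps the two trap sequences, the alternation closes up when `n` is odd.
    alternate : ∀ k j b → Walk f k (j + i) (col b j) (col (not b) (1 + j))
                            (col (flip k b) (k + j)) (col (not (flip k b)) (1 + k + j))
    alternate zero    j b = []
    alternate (suc k) j b = alternate k j b ▷ λ e → u≢col (not (flip k b)) (1 + k + j)
      (trans (sym (exceptional (flip k b) (k + j)))
        (trans (cong (λ c → f (k + j + i) (col (flip k b) (k + j)) (col c (2 + (k + j)))) (sym (not-involutive (flip k b)))) e))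

    odd-impossible : ∀ h → k ≡ h * 2 → ⊥
    odd-impossible h e = ¬closed (trans (cong (λ b → col b (n + 0)) n-flips) (col-end 0))
        (trans (cong (λ b → col (not b) (1 + n + 0)) n-flips) (trans (cong (λ p → col false p) (cong suc (ℕ.+-identityʳ n))) refl))
        (alternate n 0 false)
      where
      n-flips : flip n false ≡ true
      n-flips = trans (cong (λ k → flip (5 + k) false) e) (cong (λ b → not (not (not (not (not b))))) (flip-even h false))
      col-end : ∀ j → col true (n + j) ≡ col false j
      col-end j = trans (cong (col true) (+-comm n j)) (col-n true j)

    module Even (h : ℕ) (k≡ : k ≡ 1 + h * 2) where

      n≡ : n ≡ 6 + h * 2
      n≡ = cong (5 +_) k≡

      -- A wrong guess here would allow a closed walk that leaves `u`, alternates between the trap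
      -- sequences, and uses its last two steps to pass back through `u`.
      jump : ∀ c j → f (j + i) (u j) (col (not c) (2 + j)) ≡ col c (1 + j)
      jump c j = decidable-stable (_ ≟ _) λ r → ¬closed u-end refl (subst (λ n → Walk f n (j + i) (u j) (col c (1 + j)) (u (2 + p)) (col c (1 + j))) (sym n≡)
          (r ∷ (alternate (3 + h * 2) (1 + j) c ▷ into-u ▷ out-of-u)))
        where
        p = 3 + h * 2 + (1 + j)
        b = flip (3 + h * 2) c
        b≡ : b ≡ not c
        b≡ = trans (cong (λ b → not (not (not b))) (flip-even h c)) (not-involutive (not c))
        into-u : f (p + i) (col b p) (u (2 + p)) ≢ col (not b) (1 + p)
        into-u e = col-≢ b (1 + p) (trans (sym (forced b p (u (2 + p)) (u≢col b (2 + p)))) e)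
        3+p≡ : 3 + p ≡ 1 + j + n
        3+p≡ = trans (cong (λ k → k + (1 + j)) (sym n≡)) (+-comm n (1 + j))
        out-of-u : f (1 + p + i) (col (not b) (1 + p)) (col c (1 + j)) ≢ u (2 + p)
        out-of-u e = col≢u (not b) (2 + p) (trans (sym (forced (not b) (1 + p) (col c (1 + j)) λ e′ →
          col-≢ c (1 + j) (trans e′ (trans (cong (λ l → col (not b) l) 3+p≡) (trans (col-n (not b) (1 + j))
            (cong (λ b → col b (1 + j)) (trans (not-involutive b) b≡))))))) e)
        u-end : u (2 + p) ≡ u j
        u-end = trans (cong u (ℕ.suc-injective (trans 3+p≡ refl))) (u-n j)

      -- The row of `u j` contains `u (1 + j)` somewhere, and `jump` has filled the other two places
      -- with trap colours.
      u-fixed : ∀ j → f (j + i) (u j) (u (2 + j)) ≡ u (1 + j)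
      u-fixed j = let z , e = u-guessed j in subst (λ z → f (j + i) (u j) z ≡ u (1 + j))
        (u-unique false (2 + j) z
          (λ e′ → u≢col true (1 + j) (trans (sym e) (trans (cong (f (j + i) (u j)) e′) (jump true j))))
          (λ e′ → u≢col false (1 + j) (trans (sym e) (trans (cong (f (j + i) (u j)) e′) (jump false j))))) e

      zu : ∀ b j → Walk f 1 (j + i) (col b j) (u (1 + j)) (u (1 + j)) (u (2 + j))
      zu b j = (λ e → col≢u b (1 + j) (trans (sym (forced b j (u (2 + j)) (u≢col b (2 + j)))) e)) ∷ []

      zuz : ∀ b j → Walk f 1 (j + i) (col b j) (u (1 + j)) (u (1 + j)) (col (not b) (2 + j))
      zuz b j = (λ e → col≢u b (1 + j)
        (trans (sym (forced b j (col (not b) (2 + j)) λ e′ → col-≢ b (2 + j) (sym e′))) e)) ∷ []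

      uuz : ∀ b j → Walk f 1 (j + i) (u j) (u (1 + j)) (u (1 + j)) (col b (2 + j))
      uuz b j = (λ e → col≢u (not b) (1 + j) (trans (sym (trans
        (cong (λ b → f (j + i) (u j) (col b (2 + j))) (sym (not-involutive b))) (jump (not b) j))) e)) ∷ []

      uzu : ∀ b j → Walk f 1 (j + i) (u j) (col b (1 + j)) (col b (1 + j)) (u (2 + j))
      uzu b j = (λ e → u≢col b (1 + j) (trans (sym (u-fixed j)) e)) ∷ []

      three : ∀ b b′ j → Walk f 3 (j + i) (col b j) (u (1 + j)) (col b′ (3 + j)) (u (4 + j))
      three b b′ j = zu b j ++ uuz b′ (1 + j) ++ uzu b′ (2 + j)

      two : ∀ b j → Walk f 2 (j + i) (col b j) (u (1 + j)) (col (not b) (2 + j)) (u (3 + j))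
      two b j = zuz b j ++ uzu (not b) (1 + j)

      twos : ∀ h b j → Walk f (h * 2) (j + i) (col b j) (u (1 + j)) (col (flip h b) (j + h * 2)) (u (1 + j + h * 2))
      twos zero    b j rewrite ℕ.+-identityʳ j = []
      twos (suc h) b j = two b j ++ subst₂ (λ b′ p → Walk f (h * 2) (2 + j + i) (col (not b) (2 + j)) (u (3 + j)) (col b′ p) (u (1 + p)))
        (flip-not h b) (sym (trans (+-suc j (suc (h * 2))) (cong suc (+-suc j (h * 2))))) (twos h (not b) (2 + j))

      impossible : ⊥
      -- Only a piece of length 3 lets its final trap sequence be chosen. As `n` is even, two of
      -- them are taken; the second one makes up for the `h` swaps made by the pieces of length 2,
      -- so that the walk ends on `col true`, which a full turn identifies with `col false`.
      impossible = ¬closed end₀ end₁ (subst (λ n → Walk f n i (col false 0) (u 1) (col (flip h b) (6 + h * 2)) (u (7 + h * 2)))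
          (sym n≡) (three false false 0 ++ three false b 3 ++ twos h b 6))
        where
        b = flip h true
        end₀ : col (flip h b) (6 + h * 2) ≡ col false 0
        end₀ = trans (cong₂ col (flip-flip h true) (sym n≡)) (col-n true 0)
        end₁ : u (7 + h * 2) ≡ u 1
        end₁ = trans (cong (λ l → u (suc l)) (sym n≡)) (u-n 1)

    impossible : ⊥
    impossible = let h , parity = halves k in [ odd-impossible h , Even.impossible h ]′ parity

  no-trap : ¬ 3 ∣ n → ∀ {i s x p} → ¬ Trap i s x p
  no-trap 3∤n T = let t , _ , S = trapSequence T in bySecond S (turn t 2 0 ≟ t 0)
    where
    bySecond : ∀ {i t} → TrapSequence i t → Dec (turn t 2 0 ≡ t 0) → ⊥
    bySecond {i} {t} S (yes e) = TwoTurns.impossible S (coincide (turn-seq S 2) S e)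
    bySecond S (no d)  = ThreeTurns.impossible S (separate (turn-seq S 2) S d) 3∤n

  rows-injective : ¬ 3 ∣ n → ∀ i s {z z′} → f i s z ≡ f i s z′ → z ≡ z′
  rows-injective 3∤n i s {z} {z′} e = decidable-stable (z ≟ z′) λ z≢z′ →
    no-trap 3∤n (proj₂ (two⇒trap (two-hits⇒2≤cnt (f i s) (f i s z′) z≢z′ e refl)))

  periodic-* : ∀ l i → f (l * n + i) ≡ f i
  periodic-* zero    i = refl
  periodic-* (suc l) i = trans (cong f (+-assoc n (l * n) i)) (trans (periodic (l * n + i)) (periodic-* l i))

  ¬latin : (∀ i s {z z′} → f i s z ≡ f i s z′ → z ≡ z′) →
           (∀ i z {s s′} → f i s z ≡ f i s′ z → s ≡ s′) → ⊥
  ¬latin rows cols = dense-clash {0} {0F} {1F} {0F} 0≢1 (dense 0F) (dense 1F)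
    where
    onto : ∀ i s y → ∃[ z ] f i s z ≡ y
    onto i s y with f i s 0F ≟ y | f i s 1F ≟ y
    ... | yes e | _     = 0F , e
    ... | no _  | yes e = 1F , e
    ... | no d  | no d′ = 2F , trans
      (third-unique _ _ _ ((λ e → 0≢1 (rows i s e)) , (λ e → 0≢2 (rows i s e)) , λ e → 1≢2 (rows i s e)))
      (sym (third-unique _ _ _ ((λ e → 0≢1 (rows i s e)) , d , d′)))
    -- The state `(s , x)` excludes only `z₀`, and `a`, `c` are chosen so that `(q , a)`, `(p , c)`
    -- and `(q , c)` are all reached in two steps. By injectivity of columns, `p` and `q` together
    -- lead from `c` to every `w`. Unless `w` is the one colour for which `q` makes `a` the guess,
    -- `(a , w)` is reached as well, and `(a , w)` and `(c , w)` together lead to every `z`.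
    dense₄ : ∀ i s x → Dense f 4 i s x
    dense₄ i s x z w w′ w≢w′ = byGuess (f (2 + i) q w ≟ a)
      where
      z₀ = proj₁ (onto i s x)
      p  = proj₁ (others z₀)
      q  = proj₁ (proj₂ (others z₀))
      d  = proj₂ (proj₂ (others z₀))
      a  = proj₁ (onto (1 + i) x p)
      c  = proj₁ (onto (1 + i) x z₀)
      misses : ∀ y → z₀ ≢ y → f i s y ≢ x
      misses y z₀≢y e = z₀≢y (rows i s (trans (proj₂ (onto i s x)) (sym e)))
      a≢c : a ≢ c
      a≢c e = proj₁ d (trans (sym (proj₂ (onto (1 + i) x z₀)))
        (trans (cong (f (1 + i) x) (sym e)) (proj₂ (onto (1 + i) x p))))
      qa : Walk f 2 i s x q a
      qa = misses q (proj₁ (proj₂ d)) ∷ (λ e → proj₂ (proj₂ d) (trans (sym (proj₂ (onto (1 + i) x p))) e)) ∷ []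
      pc : Walk f 2 i s x p c
      pc = misses p (proj₁ d) ∷ (λ e → proj₁ d (trans (sym (proj₂ (onto (1 + i) x z₀))) e)) ∷ []
      qc : Walk f 2 i s x q c
      qc = misses q (proj₁ (proj₂ d)) ∷ (λ e → proj₁ (proj₂ d) (trans (sym (proj₂ (onto (1 + i) x z₀))) e)) ∷ []
      cw : ∀ w → Walk f 3 i s x c w
      cw w with f (2 + i) p w ≟ c
      ... | no r  = snoc pc r
      ... | yes e = snoc qc λ e′ → proj₂ (proj₂ d) (cols (2 + i) w (trans e (sym e′)))
      good : ∀ w → f (2 + i) q w ≢ a → Walk f 4 i s x w z
      good w r with f (3 + i) c z ≟ w
      ... | no r′ = snoc (cw w) r′
      ... | yes e = snoc (snoc qa r) λ e′ → a≢c (cols (3 + i) z (trans e′ (sym e)))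
      byGuess : Dec (f (2 + i) q w ≡ a) → Walk f 4 i s x w z ⊎ Walk f 4 i s x w′ z
      byGuess (no r)  = inj₁ (good w r)
      byGuess (yes e) = inj₂ (good w′ λ e′ → w≢w′ (rows (2 + i) q (trans e (sym e′))))
    dense : ∀ s → Dense f m 0 s 0F
    dense s = subst (λ j → Dense f j 0 s 0F) (+-comm k 4) (dense-+ k (dense₄ 0 s 0F))

-- On the cycle traversed backwards, injectivity of rows becomes that of columns.
module _ (f : Guesses 3) (k : ℕ)
  (periodic : ∀ i → f (5 + k + i) ≡ f i)
  (noClosed : ∀ i a b → ¬ Walk f (5 + k) i a b a b) where

  private
    open module W = Winning3 f k periodic noClosed using (m; n; periodic-*)
    open +-*-Solver using (solve; _:+_; _:*_; _:=_; con)

    -- Since `m` is -1 modulo `n`, the index `m * i` stands for position `- i` without any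
    -- subtraction.
    reversed : Guesses 3
    reversed i a b = f (m * i) b a

    reversed-periodic : ∀ i → reversed (n + i) ≡ reversed i
    reversed-periodic i = cong (λ φ a b → φ b a)
      (trans (cong f (ℕ.*-distribˡ-+ m n i)) (W.periodic-* m (m * i)))

    reversed-noClosed : ∀ i a b → ¬ Walk reversed n i a b a b
    reversed-noClosed i a b w =
      let x , x₀ , x₁ , xₙ , xₙ₊₁ , steps = toSequence w
          y : ℕ → Fin 3
          y l = x (2 + m ∸ l)
          ysteps : ∀ l → l < n → f (l + m * (m + i)) (y l) (y (2 + l)) ≢ y (1 + l)
          ysteps l l<n = let l≤m = ℕ.≤-pred l<n in subst₂ (λ a b → f (l + m * (m + i)) a (y (2 + l)) ≢ b)
            (cong x (sym (ℕ.+-∸-assoc 2 l≤m))) (cong x (sym (ℕ.+-∸-assoc 1 l≤m)))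
            (subst (λ φ → φ (x (2 + (m ∸ l))) (x (m ∸ l)) ≢ x (1 + (m ∸ l)))
              (sym (trans (cong f (index l (m ∸ l) m i (ℕ.m+[n∸m]≡n l≤m))) (periodic-* l (m * (m ∸ l + i)))))
              (steps (m ∸ l) (s≤s (ℕ.m∸n≤m m l))))
      in noClosed (m * (m + i)) b a
           (subst₂ (λ c d → Walk f n (m * (m + i)) c d b a) xₙ₊₁ xₙ
             (subst₂ (λ c d → Walk f n (m * (m + i)) (x (2 + m)) (x (1 + m)) c d)
               (trans (cong x (ℕ.m+n∸n≡m 1 (1 + m))) x₁) (trans (cong x (ℕ.n∸n≡0 (2 + m))) x₀)
               (fromSequence y n ysteps)))
      where
      index : ∀ l j m i → l + j ≡ m → l + m * (m + i) ≡ l * (1 + m) + m * (j + i)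
      index l j _ i refl = solve 3 (λ l j i → l :+ (l :+ j) :* ((l :+ j) :+ i) :=
        l :* (con 1 :+ (l :+ j)) :+ (l :+ j) :* (j :+ i)) refl l j i

    m²≡1 : ∀ i → m * (m * i) ≡ (3 + k) * i * n + i
    m²≡1 i = solve 2 (λ k i → (con 4 :+ k) :* ((con 4 :+ k) :* i) :=
      (con 3 :+ k) :* i :* (con 5 :+ k) :+ i) refl k i

  three-colours-lose : ¬ 3 ∣ 5 + k → ⊥
  three-colours-lose 3∤n = W.¬latin (W.rows-injective 3∤n) λ i z {s} {s′} e →
    Winning3.rows-injective reversed k reversed-periodic reversed-noClosed 3∤n (m * i) z
      (subst (λ φ → φ s z ≡ φ s′ z) (sym (trans (cong f (m²≡1 i)) (periodic-* ((3 + k) * i) i))) e)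

-- Cycles with two colours at the root

module _ {n : ℕ} where
  open Data.List.Membership.DecPropositional (_≟_ {n}) using () renaming (_∈?_ to _∈ₗ?_)

  abstract
    fresh : (es : List (Fin n)) → List.length es < n → ∃[ p ] p ∉ₗ es
    fresh es es<n = decidable-stable (Fin.any? λ p → ¬? (p ∈ₗ? es)) λ none →
      let covered : ∀ p → p ∈ₗ es
          covered p = decidable-stable (p ∈ₗ? es) λ p∉es → none (p , p∉es)
          i , j , i<j , e = Fin.pigeonhole es<n (λ p → Any.index (covered p))
      in Fin.<⇒≢ i<j (trans (lookup-index (covered i))
           (trans (cong (List.lookup es) e) (sym (lookup-index (covered j)))))
    
abstract
  support : ∀ {n} {P : Fin n → Set} (P? : ∀ i → Dec (P i)) →
            ∃[ es ] (List.length es ≡ sum (λ i → hit (P? i)) × (∀ i → P i → i ∈ₗ es))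
  support {zero}  P? = [] , refl , λ ()
  support {suc n} P? with support (λ i → P? (suc i)) | P? zero
  ... | es , e , all | yes _ = zero ∷ List.map suc es , cong suc (trans (length-map suc es) e) ,
    λ { zero _ → here refl ; (suc i) p → there (∈-map⁺ suc (all i p)) }
  ... | es , e , all | no ¬p = List.map suc es , trans (length-map suc es) e ,
    λ { zero p → contradiction p ¬p ; (suc i) p → ∈-map⁺ suc (all i p) }

abstract
  below-average : ∀ {n} (g : Fin n → ℕ) c → sum g < n * suc c → ∃[ i ] g i ≤ c
  below-average g c low = decidable-stable (Fin.any? λ i → g i ℕ.≤? c) λ none →
    ℕ.<⇒≱ low (large g λ i → ℕ.≰⇒> λ gi≤c → none (i , gi≤c))
    where
    large : ∀ {n} (g : Fin n → ℕ) → (∀ i → c < g i) → n * suc c ≤ sum g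
    large {zero}  g c<g = z≤n
    large {suc n} g c<g = ℕ.+-mono-≤ (c<g zero) (large (λ i → g (suc i)) λ i → c<g (suc i))

sum-const : ∀ n c → sum {n} (λ _ → c) ≡ n * c
sum-const zero    c = refl
sum-const (suc n) c = cong (c +_) (sum-const n c)

module _ {q : ℕ} (φ : Fin q → Fin q) where

  hits : Fin q → ℕ
  hits y = sum λ z → hit (φ z ≟ y)

  abstract
    sum-hits : sum hits ≡ q
    sum-hits = trans (∑-comm λ y z → hit (φ z ≟ y))
      (trans (sum-cong-≗ (λ z → one z (φ z))) (trans (sum-const q 1) (ℕ.*-identityʳ q)))
      where
      indicator : ∀ {n} (x : Fin n) → sum (λ y → hit (x ≟ y)) ≡ 1
      indicator {suc n} zero = cong suc (trans (sum-const n 0) (ℕ.*-zeroʳ n))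
      indicator (suc x) = trans (sum-cong-≗ λ y → hit-suc x y) (indicator x)
        where
        hit-suc : ∀ {n} (x y : Fin n) → hit (suc x ≟ suc y) ≡ hit (x ≟ y)
        hit-suc x y with x ≟ y
        ... | yes _ = refl
        ... | no  _ = refl
      one : ∀ (z x : Fin q) → sum (λ y → hit (x ≟ y)) ≡ 1
      one _ = indicator

abstract
  pigeonhole₃ : ∀ {q} → q < 6 → {a a′ b b′ c c′ : Fin q} → a ≢ a′ → b ≢ b′ → c ≢ c′ →
    ((a ≡ b ⊎ a ≡ b′ ⊎ a′ ≡ b ⊎ a′ ≡ b′) ⊎ (a ≡ c ⊎ a ≡ c′ ⊎ a′ ≡ c ⊎ a′ ≡ c′)) ⊎
    (b ≡ c ⊎ b ≡ c′ ⊎ b′ ≡ c ⊎ b′ ≡ c′)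
  pigeonhole₃ {q} q<6 {a} {a′} {b} {b′} {c} {c′} a≢a′ b≢b′ c≢c′ with Fin.pigeonhole q<6 pick
    where
    pick : Fin 6 → Fin q
    pick zero                         = a
    pick (suc zero)                   = a′
    pick (suc (suc zero))             = b
    pick (suc (suc (suc zero)))       = b′
    pick (suc (suc (suc (suc zero)))) = c
    pick (suc (suc (suc (suc (suc zero))))) = c′
  ... | zero , suc zero , _ , e = contradiction e a≢a′
  ... | zero , suc (suc zero) , _ , e = inj₁ (inj₁ (inj₁ e))
  ... | zero , suc (suc (suc zero)) , _ , e = inj₁ (inj₁ (inj₂ (inj₁ e)))
  ... | zero , suc (suc (suc (suc zero))) , _ , e = inj₁ (inj₂ (inj₁ e))
  ... | zero , suc (suc (suc (suc (suc zero)))) , _ , e = inj₁ (inj₂ (inj₂ (inj₁ e)))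
  ... | suc zero , suc (suc zero) , _ , e = inj₁ (inj₁ (inj₂ (inj₂ (inj₁ e))))
  ... | suc zero , suc (suc (suc zero)) , _ , e = inj₁ (inj₁ (inj₂ (inj₂ (inj₂ e))))
  ... | suc zero , suc (suc (suc (suc zero))) , _ , e = inj₁ (inj₂ (inj₂ (inj₂ (inj₁ e))))
  ... | suc zero , suc (suc (suc (suc (suc zero)))) , _ , e = inj₁ (inj₂ (inj₂ (inj₂ (inj₂ e))))
  ... | suc (suc zero) , suc (suc (suc zero)) , _ , e = contradiction e b≢b′
  ... | suc (suc zero) , suc (suc (suc (suc zero))) , _ , e = inj₂ (inj₁ e)
  ... | suc (suc zero) , suc (suc (suc (suc (suc zero)))) , _ , e = inj₂ (inj₂ (inj₁ e))
  ... | suc (suc (suc zero)) , suc (suc (suc (suc zero))) , _ , e = inj₂ (inj₂ (inj₂ (inj₁ e)))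
  ... | suc (suc (suc zero)) , suc (suc (suc (suc (suc zero)))) , _ , e = inj₂ (inj₂ (inj₂ (inj₂ e)))
  ... | suc (suc (suc (suc zero))) , suc (suc (suc (suc (suc zero)))) , _ , e = contradiction e c≢c′
  ... | suc _ , suc zero , s≤s () , _
  ... | suc (suc _) , suc (suc zero) , s≤s (s≤s ()) , _
  ... | suc (suc (suc _)) , suc (suc (suc zero)) , s≤s (s≤s (s≤s ())) , _
  ... | suc (suc (suc (suc _))) , suc (suc (suc (suc zero))) , s≤s (s≤s (s≤s (s≤s ()))) , _
  ... | suc (suc (suc (suc (suc _)))) , suc (suc (suc (suc (suc zero)))) , s≤s (s≤s (s≤s (s≤s (s≤s ())))) , _

pigeonhole₂ : ∀ {A : Set} {p p′ a b c : A} → (a ≡ p ⊎ a ≡ p′) → (b ≡ p ⊎ b ≡ p′) → (c ≡ p ⊎ c ≡ p′) →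
  (a ≡ b ⊎ a ≡ c) ⊎ b ≡ c
pigeonhole₂ (inj₁ refl) (inj₁ refl) _           = inj₁ (inj₁ refl)
pigeonhole₂ (inj₂ refl) (inj₂ refl) _           = inj₁ (inj₁ refl)
pigeonhole₂ (inj₁ refl) (inj₂ refl) (inj₁ refl) = inj₁ (inj₂ refl)
pigeonhole₂ (inj₂ refl) (inj₁ refl) (inj₂ refl) = inj₁ (inj₂ refl)
pigeonhole₂ (inj₁ refl) (inj₂ refl) (inj₂ refl) = inj₂ refl
pigeonhole₂ (inj₂ refl) (inj₁ refl) (inj₁ refl) = inj₂ refl

AllButTwo : ∀ {q} → (Fin q → Set) → Set
AllButTwo P = ∀ x y z → x ≢ y → x ≢ z → y ≢ z → P x ⊎ P y ⊎ P z

TwoOf : ∀ {q} → (Fin q → Set) → Set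
TwoOf P = ∃[ x ] ∃[ y ] (x ≢ y × P x × P y)

module _ {r : ℕ} where

  private
    q = 4 + r

  ∉⇒≢ : ∀ {x y : Fin q} {es} → x ∉ₗ es → y ∈ₗ es → x ≢ y
  ∉⇒≢ x∉ y∈ refl = x∉ y∈

  abstract
    allButTwo⇒two : {P : Fin q → Set} → AllButTwo P → TwoOf P
    allButTwo⇒two {P} good = let x , px = first ; y , y≢x , py = second x in x , y , (λ e → y≢x (sym e)) , px , py
      where
      pick : ∀ x y z → x ≢ y → x ≢ z → y ≢ z → ∃[ w ] ((w ≡ x ⊎ w ≡ y ⊎ w ≡ z) × P w)
      pick x y z a b c = [ (λ p → x , inj₁ refl , p) , [ (λ p → y , inj₂ (inj₁ refl) , p) , (λ p → z , inj₂ (inj₂ refl) , p) ]′ ]′ (good x y z a b c)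
      oneOf : ∀ {x a b c w : Fin q} → a ≢ x → b ≢ x → c ≢ x → w ≡ a ⊎ w ≡ b ⊎ w ≡ c → w ≢ x
      oneOf p _ _ (inj₁ refl)        = p
      oneOf _ p _ (inj₂ (inj₁ refl)) = p
      oneOf _ _ p (inj₂ (inj₂ refl)) = p
      first : ∃ P
      first = let w , _ , p = pick 0F 1F 2F 0≢1 0≢2 1≢2 in w , p
      second : ∀ x → ∃[ y ] (y ≢ x × P y)
      second x =
        let a , a∉ = fresh (x ∷ []) (s≤s (s≤s z≤n))
            b , b∉ = fresh (x ∷ a ∷ []) (s≤s (s≤s (s≤s z≤n)))
            c , c∉ = fresh (x ∷ a ∷ b ∷ []) (s≤s (s≤s (s≤s (s≤s z≤n))))
            w , w≡ , p = pick a b c (λ e → ∉⇒≢ b∉ (there (here refl)) (sym e))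
              (λ e → ∉⇒≢ c∉ (there (here refl)) (sym e)) (λ e → ∉⇒≢ c∉ (there (there (here refl))) (sym e))
        in w , oneOf (∉⇒≢ a∉ (here refl)) (∉⇒≢ b∉ (here refl)) (∉⇒≢ c∉ (here refl)) w≡ , p

  module _ {f : Guesses q} where

    TwoDense : ℕ → ℕ → (a b : Fin q) → Set
    TwoDense k i a b = ∀ z → TwoOf λ y → Walk f k i a b y z

    -- Three last colours come with a pair of penultimate colours each. Six entries from at most
    -- five colours must coincide, necessarily across two pairs, and `branch` applies there. Missing
    -- at most two of at least four colours leaves two.
    twoDense-suc : q < 6 → ∀ {k i a b} → TwoDense k i a b → TwoDense (suc k) i a b
    twoDense-suc q<6 {k} {i} {a} {b} D z = allButTwo⇒two good
      where
      good : AllButTwo λ y → Walk f (suc k) i a b y z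
      good x y w x≢y x≢w y≢w =
        let p , p′ , p≢p′ , px , px′ = D x
            s , s′ , s≢s′ , sy , sy′ = D y
            t , t′ , t≢t′ , tw , tw′ = D w
        in [ [ (λ o → [ inj₁ , (λ v → inj₂ (inj₁ v)) ]′ (crossing x≢y px px′ sy sy′ o)) ,
               (λ o → [ inj₁ , (λ v → inj₂ (inj₂ v)) ]′ (crossing x≢w px px′ tw tw′ o)) ]′ ,
               (λ o → inj₂ (crossing y≢w sy sy′ tw tw′ o)) ]′ (pigeonhole₃ q<6 p≢p′ s≢s′ t≢t′)
        where
        meet : ∀ {x y} → x ≢ y → ∀ {p p′} → Walk f k i a b p x → Walk f k i a b p′ y → p ≡ p′ →
               Walk f (suc k) i a b x z ⊎ Walk f (suc k) i a b y z
        meet x≢y v w refl = branch x≢y v w z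
        crossing : ∀ {x y} → x ≢ y → ∀ {p p′ s s′} → Walk f k i a b p x → Walk f k i a b p′ x →
                  Walk f k i a b s y → Walk f k i a b s′ y → p ≡ s ⊎ p ≡ s′ ⊎ p′ ≡ s ⊎ p′ ≡ s′ →
                  Walk f (suc k) i a b x z ⊎ Walk f (suc k) i a b y z
        crossing x≢y v v′ w w′ = [ meet x≢y v w , [ meet x≢y v w′ , [ meet x≢y v′ w , meet x≢y v′ w′ ]′ ]′ ]′

    twoDense-start : ∀ {i a b p p′} → p ≢ p′ → f i a p ≢ b → f i a p′ ≢ b → TwoDense 3 i a b
    twoDense-start {i} {a} {b} {p} {p′} p≢p′ r r′ z = allButTwo⇒two good
      where
      via : ∀ y → ∃[ w ] ((w ≡ p ⊎ w ≡ p′) × Walk f 2 i a b w y)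
      via y = [ (λ s → p , inj₁ refl , r ∷ s ∷ []) , (λ s → p′ , inj₂ refl , r′ ∷ s ∷ []) ]′ (≢-one p≢p′ (f (suc i) b y))
      meet : ∀ {x y} → x ≢ y → proj₁ (via x) ≡ proj₁ (via y) → Walk f 3 i a b x z ⊎ Walk f 3 i a b y z
      meet {x} {y} x≢y e = branch x≢y (proj₂ (proj₂ (via x)))
        (subst (λ w → Walk f 2 i a b w y) (sym e) (proj₂ (proj₂ (via y)))) z
      good : AllButTwo λ y → Walk f 3 i a b y z
      good x y w x≢y x≢w y≢w =
        [ [ (λ e → [ inj₁ , (λ v → inj₂ (inj₁ v)) ]′ (meet x≢y e)) ,
            (λ e → [ inj₁ , (λ v → inj₂ (inj₂ v)) ]′ (meet x≢w e)) ]′ ,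
            (λ e → inj₂ (meet y≢w e)) ]′
          (pigeonhole₂ (proj₁ (proj₂ (via x))) (proj₁ (proj₂ (via y))) (proj₁ (proj₂ (via w))))

    twoDense-+ : q < 6 → ∀ {k i a b} j → TwoDense k i a b → TwoDense (j + k) i a b
    twoDense-+ q<6 zero    D = D
    twoDense-+ q<6 (suc j) D = twoDense-suc q<6 (twoDense-+ q<6 j D)

    -- Three values have to be avoided, so a fourth colour `p` can precede both `x` and `y`.
    dense-start₁ : ∀ {i a b e} → (∀ z → z ≢ e → f i a z ≢ b) → Dense f 3 i a b
    dense-start₁ {i} {a} {b} {e} free z x y x≢y =
      let p , p∉ = fresh (e ∷ f (suc i) b x ∷ f (suc i) b y ∷ []) (s≤s (s≤s (s≤s (s≤s z≤n))))
          r = free p (∉⇒≢ p∉ (here refl))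
      in branch x≢y (r ∷ (λ e → ∉⇒≢ p∉ (there (here refl)) (sym e)) ∷ [])
                    (r ∷ (λ e → ∉⇒≢ p∉ (there (there (here refl))) (sym e)) ∷ []) z

  module _ (f : Guesses q) {a b : Fin q} (a≢b : a ≢ b) where

    private
      d : Fin q → Fin q → ℕ
      d s x = hits (f 0 s) x

      -- Both walks show the root the same `y` and `x`, so its guess is wrong for `a` or for `b`.
      ends : ∀ {m} {x : Fin q} → ∃[ y ] (Walk f m 0 a x y a × Walk f m 0 b x y b) →
             ∃[ s ] ((s ≡ a ⊎ s ≡ b) × ∃[ x ] Walk f (suc m) 0 s x s x)
      ends {m} {x} (y , v , w) = [ (λ r → a , inj₁ refl , x , snoc v r) , (λ r → b , inj₂ refl , x , snoc w r) ]′
        (≢-one a≢b (f (m + 0) y x))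

      -- On average, two pairs (root colour, colour of vertex 2) make vertex 1 guess x.
      second-colour : ∃[ x ] d a x + d b x ≤ 2
      second-colour = below-average (λ x → d a x + d b x) 2 (begin-strict
        sum (λ x → d a x + d b x) ≡⟨ ∑-distrib-+ (d a) (d b) ⟩
        sum (d a) + sum (d b)     ≡⟨ cong₂ _+_ (sum-hits (f 0 a)) (sum-hits (f 0 b)) ⟩
        q + q                     ≡⟨ cong (q +_) (sym (ℕ.+-identityʳ q)) ⟩
        2 * q                     ≡⟨ ℕ.*-comm 2 q ⟩
        q * 2                     <⟨ ℕ.*-monoʳ-< q {2} {3} ℕ.≤-refl ⟩
        q * 3                     ∎)
        where open ℕ.≤-Reasoning

      spread : ∀ s x → ∃[ es ] (List.length es ≡ d s x × (∀ z → f 0 s z ≡ x → z ∈ₗ es))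
      spread s x = support λ z → f 0 s z ≟ x

    -- The second colour `x` is blocked at most twice, over both root colours. If each root colour
    -- accounts for at most one block, both sides become dense and share a `y`. If one accounts for
    -- both, the other side is dense, and a set missing at most one colour meets a set with two.
    two-colours-survive : q < 6 → ∀ k → ∃[ s ] ((s ≡ a ⊎ s ≡ b) × ∃[ x ] Walk f (4 + k) 0 s x s x)
    two-colours-survive q<6 k = ends (bySpread (spread a x) (spread b x))
      where
      x : Fin q
      x = proj₁ second-colour
      da+db≤2 : d a x + d b x ≤ 2
      da+db≤2 = proj₂ second-colour
      Meets : Set
      Meets = ∃[ y ] (Walk f (3 + k) 0 a x y a × Walk f (3 + k) 0 b x y b)
      dense : ∀ {s} → (∃[ e ] (∀ z → z ≢ e → f 0 s z ≢ x)) → Dense f (3 + k) 0 s x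
      dense {s} (e , free) = subst (λ l → Dense f l 0 s x) (+-comm k 3) (dense-+ k (dense-start₁ free))
      twoDense : ∀ {s} e e′ → (∀ z → z ≢ e → z ≢ e′ → f 0 s z ≢ x) → TwoDense {f = f} (3 + k) 0 s x
      twoDense {s} e e′ free =
        let p , p∉ = fresh (e ∷ e′ ∷ []) (s≤s (s≤s (s≤s z≤n)))
            p′ , p′∉ = fresh (p ∷ e ∷ e′ ∷ []) (s≤s (s≤s (s≤s (s≤s z≤n))))
        in subst (λ l → TwoDense {f = f} l 0 s x) (+-comm k 3) (twoDense-+ q<6 k
             (twoDense-start (λ e → ∉⇒≢ p′∉ (here refl) (sym e))
               (free p (∉⇒≢ p∉ (here refl)) (∉⇒≢ p∉ (there (here refl))))
               (free p′ (∉⇒≢ p′∉ (there (here refl))) (∉⇒≢ p′∉ (there (there (here refl)))))))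
      meet-two : ∀ {P Q : Fin q → Set} → AllButOne P → TwoOf Q → ∃[ y ] (P y × Q y)
      meet-two D (y , y′ , y≢y′ , v , v′) = [ (λ w → y , w , v) , (λ w → y′ , w , v′) ]′ (D y y′ y≢y′)
      swap : ∀ {P Q : Fin q → Set} → ∃[ y ] (P y × Q y) → ∃[ y ] (Q y × P y)
      swap (y , p , r) = y , r , p
      none : ∀ {s} → (∀ z → f 0 s z ≡ x → z ∈ₗ []) → ∃[ e ] (∀ z → z ≢ e → f 0 s z ≢ x)
      none h = zero , λ z _ e → contradiction (h z e) λ ()
      one : ∀ {s e} → (∀ z → f 0 s z ≡ x → z ∈ₗ e ∷ []) → ∃[ e ] (∀ z → z ≢ e → f 0 s z ≢ x)
      one {e = e} h = e , λ z z≢e e′ → avoid₁ (h z e′) z≢e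
        where
        avoid₁ : ∀ {z : Fin q} → z ∈ₗ e ∷ [] → ¬ z ≢ e
        avoid₁ (here z≡e) z≢e = z≢e z≡e
      two : ∀ {s e e′} → (∀ z → f 0 s z ≡ x → z ∈ₗ e ∷ e′ ∷ []) → ∀ z → z ≢ e → z ≢ e′ → f 0 s z ≢ x
      two {e = e} {e′} h z z≢e z≢e′ e″ = avoid₂ (h z e″)
        where
        avoid₂ : z ∈ₗ e ∷ e′ ∷ [] → ⊥
        avoid₂ (here z≡e)          = z≢e z≡e
        avoid₂ (there (here z≡e′)) = z≢e′ z≡e′
      bySpread : ∃[ es ] (List.length es ≡ d a x × (∀ z → f 0 a z ≡ x → z ∈ₗ es)) →
                 ∃[ es ] (List.length es ≡ d b x × (∀ z → f 0 b z ≡ x → z ∈ₗ es)) → Meets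
      bySpread (es , la , ha) (es′ , lb , hb) =
        byLength es es′ (subst₂ (λ m n → m + n ≤ 2) (sym la) (sym lb) da+db≤2) ha hb
        where
        byLength : ∀ es es′ → List.length es + List.length es′ ≤ 2 → (∀ z → f 0 a z ≡ x → z ∈ₗ es) →
                   (∀ z → f 0 b z ≡ x → z ∈ₗ es′) → Meets
        byLength [] [] _ h h′ = allButOne-∩ (dense (none h) a) (dense (none h′) b)
        byLength [] (_ ∷ []) _ h h′ = allButOne-∩ (dense (none h) a) (dense (one h′) b)
        byLength (_ ∷ []) [] _ h h′ = allButOne-∩ (dense (one h) a) (dense (none h′) b)
        byLength (_ ∷ []) (_ ∷ []) _ h h′ = allButOne-∩ (dense (one h) a) (dense (one h′) b)
        byLength [] (_ ∷ _ ∷ []) _ h h′ = meet-two (dense (none h) a) (twoDense _ _ (two h′) b)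
        byLength (_ ∷ _ ∷ []) [] _ h h′ = swap (meet-two (dense (none h′) b) (twoDense _ _ (two h) a))
        byLength [] (_ ∷ _ ∷ _ ∷ _) (s≤s (s≤s ())) _ _
        byLength (_ ∷ []) (_ ∷ _ ∷ _) (s≤s (s≤s ())) _ _
        byLength (_ ∷ _ ∷ []) (_ ∷ _) (s≤s (s≤s ())) _ _
        byLength (_ ∷ _ ∷ _ ∷ _) _ (s≤s (s≤s ())) _ _

    -- The colour `y` must avoid the two guesses of its own vertex and at most two blocks by the
    -- vertex coloured `x`: four values, hence five colours.
    two-colours-survive-triangle : 5 ≤ q → ∃[ s ] ((s ≡ a ⊎ s ≡ b) × ∃[ x ] Walk f 3 0 s x s x)
    two-colours-survive-triangle 5≤q =
      let x , da+db≤2 = second-colour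
          es , la , ha = spread a x
          es′ , lb , hb = spread b x
          y , y∉ = fresh (f 1 x a ∷ f 1 x b ∷ es List.++ es′)
            (ℕ.≤-trans (s≤s (s≤s (s≤s (subst (_≤ 2) (sym (trans (length-++ es) (cong₂ _+_ la lb))) da+db≤2)))) 5≤q)
      in ends {2} (y ,
        ((λ e → y∉ (there (there (∈-++⁺ˡ (ha y e))))) ∷ (λ e → y∉ (here (sym e))) ∷ []) ,
        ((λ e → y∉ (there (there (∈-++⁺ʳ es (hb y e))))) ∷ (λ e → y∉ (there (here (sym e)))) ∷ []))

-- The average over (a , x) of the number of y for which the first or the third
-- vertex guesses right is 2, and the second vertex excludes one more y.
four-colours-triangle : ∀ {q} → 4 ≤ q → (f : Guesses q) → ∃[ a ] ∃[ x ] Walk f 3 0 a x a x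
four-colours-triangle {q} 4≤q f = first (below-average (λ a → sum (g a)) (q + q) (begin-strict
        sum (λ a → sum (g a)) ≡⟨ total-g ⟩
        q * q + q * q         ≡⟨ sym (ℕ.*-distribˡ-+ q q q) ⟩
        q * (q + q)           <⟨ ℕ.*-monoʳ-< q {q + q} {suc (q + q)} ℕ.≤-refl ⟩
        q * suc (q + q)       ∎))
  where
  open ℕ.≤-Reasoning
  instance
    q≢0 : NonZero q
    q≢0 = ℕ′.>-nonZero (ℕ.≤-trans (s≤s z≤n) 4≤q)
  g : Fin q → Fin q → ℕ
  g a x = hits (f 0 a) x + hits (λ y → f 2 y x) a
  total-g : sum (λ a → sum (g a)) ≡ q * q + q * q
  total-g = begin-equality
    sum (λ a → sum (g a))
      ≡⟨ sum-cong-≗ (λ a → ∑-distrib-+ (hits (f 0 a)) (λ x → hits (λ y → f 2 y x) a)) ⟩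
    sum (λ a → sum (hits (f 0 a)) + sum (λ x → hits (λ y → f 2 y x) a))
      ≡⟨ ∑-distrib-+ (λ a → sum (hits (f 0 a))) (λ a → sum (λ x → hits (λ y → f 2 y x) a)) ⟩
    sum (λ a → sum (hits (f 0 a))) + sum (λ a → sum (λ x → hits (λ y → f 2 y x) a))
      ≡⟨ cong₂ _+_ (trans (sum-cong-≗ (λ a → sum-hits (f 0 a))) (sum-const q q))
           (trans (∑-comm (λ a x → hits (λ y → f 2 y x) a))
             (trans (sum-cong-≗ (λ x → sum-hits (λ y → f 2 y x))) (sum-const q q))) ⟩
    q * q + q * q ∎

  Closed : Set
  Closed = ∃[ a ] ∃[ x ] Walk f 3 0 a x a x
  escape : ∀ a x → g a x ≤ 2 → (∃[ es ] (List.length es ≡ hits (f 0 a) x × (∀ y → f 0 a y ≡ x → y ∈ₗ es))) →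
           (∃[ es ] (List.length es ≡ hits (λ y → f 2 y x) a × (∀ y → f 2 y x ≡ a → y ∈ₗ es))) → Closed
  escape a x gx≤2 (es , le , he) (es′ , le′ , he′) = close (fresh (f 1 x a ∷ es List.++ es′)
        (ℕ.≤-trans (s≤s (s≤s (subst (_≤ 2) (sym (trans (length-++ es) (cong₂ _+_ le le′))) gx≤2))) 4≤q))
    where
    close : ∃[ y ] y ∉ₗ f 1 x a ∷ es List.++ es′ → Closed
    close (y , y∉) = a , x , (λ e → y∉ (there (∈-++⁺ˡ (he y e)))) ∷ (λ e → y∉ (here (sym e))) ∷
     (λ e → y∉ (there (∈-++⁺ʳ es (he′ y e)))) ∷ []
  second : ∀ a → ∃[ x ] g a x ≤ 2 → Closed
  second a (x , gx≤2) = escape a x gx≤2 (support λ y → f 0 a y ≟ x) (support λ y → f 2 y x ≟ a)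
  first : ∃[ a ] sum (g a) ≤ q + q → Closed
  first (a , ga≤) = second a (below-average (g a) 2 (begin-strict
        sum (g a)   ≤⟨ ga≤ ⟩
        q + q       ≡⟨ cong (q +_) (sym (ℕ.+-identityʳ q)) ⟩
        2 * q       ≡⟨ ℕ.*-comm 2 q ⟩
        q * 2       <⟨ ℕ.*-monoʳ-< q {2} {3} ℕ.≤-refl ⟩
        q * 3       ∎))

-- Strategies on graphs and gluing

module _ {n : ℕ} {P : Fin n → Set} (P? : ∀ i → Dec (P i)) where

  subset : Subset n
  subset = tabulate λ i → does (P? i)

  ∈-subset⁺ : ∀ {i} → P i → i ∈ subset
  ∈-subset⁺ {i} p = lookup⇒[]= i subset (trans (lookup∘tabulate _ i) (dec-true (P? i) p))

  ∈-subset⁻ : ∀ {i} → i ∈ subset → P i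
  ∈-subset⁻ {i} i∈ = decode (P? i) (trans (sym (lookup∘tabulate _ i)) ([]=⇒lookup i∈))
    where
    decode : (d : Dec (P i)) → does d ≡ true → P i
    decode (yes p) _ = p

-- Where the goal is a negation, this makes reachability decidable without a search for paths.
finite-EM : ∀ {n} (P : Fin n → Set) → ¬ ¬ (∀ i → Dec (P i))
finite-EM {zero}  P k = k λ ()
finite-EM {suc n} P k = finite-EM (λ i → P (suc i)) λ d →
  k′ λ e → k λ { zero → e ; (suc i) → d i }
  where
  k′ : ¬ ¬ Dec (P zero)
  k′ h = h (no λ p → h (yes p))

EM : (A : Set) → ¬ ¬ Dec A
EM A h = h (no λ a → h (yes a))

-- Without function extensionality, only extensional properties can be searched.
module _ {q : ℕ} where

  cons : ∀ {n} → Fin q → (Fin n → Fin q) → Fin (suc n) → Fin q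
  cons x c zero    = x
  cons x c (suc i) = c i

  search : ∀ {n} {P : (Fin n → Fin q) → Set} → (∀ c → Dec (P c)) →
           (∀ {c c′} → (∀ i → c i ≡ c′ i) → P c → P c′) → Dec (∃ P)
  search {zero} P? resp = map′ (λ p → _ , p) (λ { (c , p) → resp (λ ()) p }) (P? λ ())
  search {suc n} {P} P? resp = map′ (λ { (x , c , p) → cons x c , p })
    (λ { (c , p) → c zero , (λ i → c (suc i)) , resp (λ { zero → refl ; (suc i) → refl }) p })
    (any? λ x → search (λ c → P? (cons x c)) λ e → resp λ { zero → refl ; (suc i) → e i })

module Strategies (G : Graph) where
  open Graph G public hiding (sym)

  Adj-sym : ∀ {u v} → Adj u v → Adj v u
  Adj-sym {u} {v} = subst Bool.T (Graph.sym G u v)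

  Adj-irrefl : ∀ {v} → ¬ Adj v v
  Adj-irrefl {v} a = subst Bool.T (irrefl v) a

  Adj? : ∀ u v → Dec (Adj u v)
  Adj? u v = T? (adj u v)

  -- Guesses take the whole colouring, but only depend on the neighbours.
  record Local (q : ℕ) : Set where
    field
      guess : Vertex → (Vertex → Fin q) → Fin q
      local : ∀ v c c′ → (∀ u → Adj v u → c u ≡ c′ u) → guess v c ≡ guess v c′

  open Local public

  Wins : ∀ {q} → Local q → Set
  Wins s = ∀ c → ∃[ v ] guess s v c ≡ c v

  winning⇒local : ∀ {q} → WinningWith G q → ∃ (Wins {q})
  winning⇒local (_ , s , wins) = record
    { guess = λ v c → Game.Strategy.guess s v (λ u _ → c u)
    ; local = λ v c c′ e → Game.Strategy.guess-cong s v (λ u _ → c u) (λ u _ → c′ u) e } , wins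

  local⇒winning : ∀ {p} → ∃ (Wins {suc p}) → WinningWith G (suc p)
  local⇒winning {p} (s , wins) = _ , record
      { guess = λ v x → guess s v (extend v x)
      ; guess-cong = λ v x y e → local s v (extend v x) (extend v y) λ u _ → extend-cong v x y e u } ,
    λ c → let v , e = wins c in v , trans (local s v (extend v λ u _ → c u) c λ u a → extend-visible v c u a) e
    where
    extend : ∀ v → (∀ u → Adj v u → Fin (suc p)) → Vertex → Fin (suc p)
    extend v x u with Adj? v u
    ... | yes a = x u a
    ... | no  _ = zero
    extend-cong : ∀ v x y → (∀ u (a : Adj v u) → x u a ≡ y u a) → ∀ u → extend v x u ≡ extend v y u
    extend-cong v x y e u with Adj? v u
    ... | yes a = e u a
    ... | no  _ = refl
    extend-visible : ∀ v c u → Adj v u → extend v (λ u _ → c u) u ≡ c u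
    extend-visible v c u a with Adj? v u
    ... | yes _ = refl
    ... | no ¬a = contradiction a ¬a

  fewer-colours : ∀ {p r} → suc p ≤ r → ∃ (Wins {r}) → ∃ (Wins {suc p})
  fewer-colours {p} {r} p<r (s , wins) = record
      { guess = λ v c → lower (guess s v λ u → raise (c u))
      ; local = λ v c c′ e → cong lower (local s v (λ u → raise (c u)) (λ u → raise (c′ u)) λ u a → cong raise (e u a)) } ,
    λ c → let v , e = wins (λ u → raise (c u)) in v , trans (cong lower e) (lower-raise (c v))
    where
    raise : Fin (suc p) → Fin r
    raise x = inject≤ x p<r
    lower : Fin r → Fin (suc p)
    lower x with toℕ x ℕ.<? suc p
    ... | yes l = fromℕ< l
    ... | no  _ = zero
    lower-raise : ∀ x → lower (raise x) ≡ x
    lower-raise x with toℕ (raise x) ℕ.<? suc p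
    ... | yes l = toℕ-injective (trans (toℕ-fromℕ< l) (toℕ-inject≤ x p<r))
    ... | no ¬l = contradiction (subst (_< suc p) (sym (toℕ-inject≤ x p<r)) (toℕ<n x)) ¬l

  module _ {q : ℕ} where

    -- Against every strategy, the colours of S can be chosen, with that of v
    -- satisfying P, such that nobody in S guesses right; other vertices are fixed.
    Loses : Subset order → Vertex → (Fin q → Set) → Set
    Loses S v P = ∀ (s : Local q) (c : Vertex → Fin q) →
      ¬ (∀ (c′ : Vertex → Fin q) → (∀ u → u ∉ S → c′ u ≡ c u) → P (c′ v) → ∃[ u ] (u ∈ S × guess s u c′ ≡ c′ u))

    -- At most one colour of v is bad.
    LosesRooted : Subset order → Vertex → Set
    LosesRooted S v = ∀ {a b} → a ≢ b → Loses S v λ x → x ≡ a ⊎ x ≡ b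

    guess-ext : ∀ (s : Local q) v c c′ → (∀ u → c u ≡ c′ u) → guess s v c ≡ guess s v c′
    guess-ext s v c c′ e = local s v c c′ λ u _ → e u

    -- The vertex u guesses its bad colour with respect to S₂ instead.
    glue : ∀ {S S₁ S₂ u v P} → u ∈ S₁ → u ∈ S₂ → v ∈ S₁ →
           (∀ {x} → x ∈ S → x ∈ S₁ ⊎ x ∈ S₂) → S₁ ⊆ S → S₂ ⊆ S →
           (∀ {x} → x ∈ S₁ → x ∈ S₂ → x ≡ u) →
           (∀ {x y} → x ∈ S₁ → x ≢ u → y ∈ S₂ → y ≢ u → ¬ Adj x y) →
           Loses S₁ v P → LosesRooted S₂ u → Loses S v P
    glue {S} {S₁} {S₂} {u} {v} {P} u∈S₁ u∈S₂ v∈S₁ cover S₁⊆S S₂⊆S meet apart lose₁ lose₂ s c W =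
      lose₁ s′ c win₁
      where
      masked? : ∀ x → Dec (x ∈ S₁ × Adj u x)
      masked? x = (x ∈? S₁) ×-dec Adj? u x
      mask₀ : (Vertex → Fin q) → Vertex → Fin q
      mask₀ y x with masked? x
      ... | yes _ = y x
      ... | no  _ = c x
      -- Going through a vector turns pointwise agreement into equality of masked colourings, so
      -- `bad (mask d)` depends only on the neighbours of `u`. What is kept are the neighbours in
      -- `S₁`, since those in `S₂` are still to be recoloured.
      mask : (Vertex → Fin q) → Vertex → Fin q
      mask y = lookup (tabulate (mask₀ y))
      mask-visible : ∀ y x → x ∈ S₁ → Adj u x → mask y x ≡ y x
      mask-visible y x x∈ a = trans (lookup∘tabulate (mask₀ y) x) visible
        where
        visible : mask₀ y x ≡ y x
        visible with masked? x
        ... | yes _ = refl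
        ... | no ¬m = contradiction (x∈ , a) ¬m
      mask-outside : ∀ y x → x ∉ S₁ → mask y x ≡ c x
      mask-outside y x x∉ = trans (lookup∘tabulate (mask₀ y) x) hidden
        where
        hidden : mask₀ y x ≡ c x
        hidden with masked? x
        ... | yes (x∈ , _) = contradiction x∈ x∉
        ... | no _ = refl
      mask-cong : ∀ {y y′} → (∀ x → Adj u x → y x ≡ y′ x) → mask y ≡ mask y′
      mask-cong {y} {y′} e = cong lookup (tabulate-cong same)
        where
        same : ∀ x → mask₀ y x ≡ mask₀ y′ x
        same x with masked? x
        ... | yes (_ , a) = e x a
        ... | no _ = refl

      Extends : (Vertex → Fin q) → Fin q → (Vertex → Fin q) → Set
      Extends y t d = (∀ x → x ∉ S₂ → d x ≡ y x) × d u ≡ t × (∀ x → x ∈ S₂ → guess s x d ≢ d x)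
      Good : (Vertex → Fin q) → Fin q → Set
      Good y t = ∃ (Extends y t)
      good? : ∀ y t → Dec (Good y t)
      good? y t = search
        (λ d → all? (λ x → ¬? (x ∈? S₂) →-dec (d x ≟ y x)) ×-dec ((d u ≟ t) ×-dec
               all? (λ x → (x ∈? S₂) →-dec ¬? (guess s x d ≟ d x))))
        (λ {d} {d′} e → λ { (p , p′ , p″) → (λ x x∉ → trans (sym (e x)) (p x x∉)) , trans (sym (e u)) p′ ,
          λ x x∈ g → p″ x x∈ (trans (guess-ext s x d d′ e) (trans g (sym (e x)))) })
      choose : ∀ {y} → Dec (∃[ t ] ¬ Good y t) → Fin q
      choose (yes (t , _)) = t
      choose (no _) = c u
      bad : (Vertex → Fin q) → Fin q
      bad y = choose (any? λ t → ¬? (good? y t))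
      bad-spec : ∀ y t → ¬ Good y t → ¬ Good y (bad y)
      bad-spec y t ¬g = chosen (any? λ t → ¬? (good? y t))
        where
        chosen : (d : Dec (∃[ t ] ¬ Good y t)) → ¬ Good y (choose d)
        chosen (yes (_ , ¬g′)) = ¬g′
        chosen (no none) = contradiction (t , ¬g) none

      guess′ : Vertex → (Vertex → Fin q) → Fin q
      guess′ x d with x ≟ u
      ... | yes _ = bad (mask d)
      ... | no  _ = guess s x d
      guess′-u : ∀ d → guess′ u d ≡ bad (mask d)
      guess′-u d with u ≟ u
      ... | yes _ = refl
      ... | no u≢u = contradiction refl u≢u
      guess′-other : ∀ {x} d → x ≢ u → guess′ x d ≡ guess s x d
      guess′-other {x} d x≢u with x ≟ u
      ... | yes x≡u = contradiction x≡u x≢u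
      ... | no  _ = refl
      local′ : ∀ x d d′ → (∀ y → Adj x y → d y ≡ d′ y) → guess′ x d ≡ guess′ x d′
      local′ x d d′ e with x ≟ u
      ... | yes refl = cong bad (mask-cong e)
      ... | no _ = local s x d d′ e
      s′ : Local q
      s′ = record { guess = guess′ ; local = local′ }

      win₁ : ∀ c₁ → (∀ x → x ∉ S₁ → c₁ x ≡ c x) → P (c₁ v) → ∃[ x ] (x ∈ S₁ × guess′ x c₁ ≡ c₁ x)
      win₁ c₁ off Pv = decidable-stable (any? λ x → (x ∈? S₁) ×-dec (guess′ x c₁ ≟ c₁ x)) λ none →
          refute none (decidable-stable (good? (mask c₁) (c₁ u)) (good none))
        where
        None = ¬ (∃[ x ] (x ∈ S₁ × guess′ x c₁ ≡ c₁ x))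
        good : None → ¬ ¬ Good (mask c₁) (c₁ u)
        -- If the colour of `u` were not good, the colour guessed by `u` would not be good either.
        -- They differ because `u` guesses wrong, so `S₂` would have two bad colours at its root.
        good none ¬g = lose₂ t≢ s (mask c₁) λ d off′ dt → decidable-stable
            (any? λ x → (x ∈? S₂) ×-dec (guess s x d ≟ d x)) λ none₂ →
            [ (λ e → bad-spec (mask c₁) (c₁ u) ¬g (d , off′ , e , λ x x∈ e′ → none₂ (x , x∈ , e′))) ,
              (λ e → ¬g (d , off′ , e , λ x x∈ e′ → none₂ (x , x∈ , e′))) ]′ dt
          where
          t≢ : bad (mask c₁) ≢ c₁ u
          t≢ e = none (u , u∈S₁ , trans (guess′-u c₁) e)
        refute : None → ¬ Good (mask c₁) (c₁ u)
        refute none (c₂ , off₂ , c₂u , wrong₂) = winner (W c′ c′-off (subst P (sym (on₁ v v∈S₁)) Pv))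
          where
          c′ : Vertex → Fin q
          c′ x with x ∈? S₂
          ... | yes _ = c₂ x
          ... | no  _ = c₁ x
          on₂ : ∀ x → x ∈ S₂ → c′ x ≡ c₂ x
          on₂ x x∈ with x ∈? S₂
          ... | yes _ = refl
          ... | no x∉ = contradiction x∈ x∉
          off₂′ : ∀ x → x ∉ S₂ → c′ x ≡ c₁ x
          off₂′ x x∉ with x ∈? S₂
          ... | yes x∈ = contradiction x∈ x∉
          ... | no _ = refl
          on₁ : ∀ x → x ∈ S₁ → c′ x ≡ c₁ x
          on₁ x x∈ = byCase (x ∈? S₂)
            where
            byCase : Dec (x ∈ S₂) → c′ x ≡ c₁ x
            byCase (no x∉) = off₂′ x x∉
            byCase (yes x∈₂) = trans (on₂ x x∈₂) (subst (λ x → c₂ x ≡ c₁ x) (sym (meet x∈ x∈₂)) c₂u)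
          c′-off : ∀ x → x ∉ S → c′ x ≡ c x
          c′-off x x∉ = trans (off₂′ x λ x∈ → x∉ (S₂⊆S x∈)) (off x λ x∈ → x∉ (S₁⊆S x∈))
          agree₂ : ∀ x → x ∈ S₂ → ∀ y → Adj x y → c′ y ≡ c₂ y
          agree₂ x x∈ y a = byCase (y ∈? S₂) (y ∈? S₁) (x ≟ u)
            where
            byCase : Dec (y ∈ S₂) → Dec (y ∈ S₁) → Dec (x ≡ u) → c′ y ≡ c₂ y
            byCase (yes y∈) _ _ = on₂ y y∈
            byCase (no y∉) (no y∉₁) _ = trans (off₂′ y y∉) (trans (off y y∉₁)
              (sym (trans (off₂ y y∉) (mask-outside c₁ y y∉₁))))
            byCase (no y∉) (yes y∈₁) (yes refl) = trans (off₂′ y y∉)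
              (sym (trans (off₂ y y∉) (mask-visible c₁ y y∈₁ a)))
            byCase (no y∉) (yes y∈₁) (no x≢u) =
              contradiction (Adj-sym a) (apart y∈₁ (λ { refl → y∉ u∈S₂ }) x∈ x≢u)
          agree₁ : ∀ x → x ∈ S₁ → x ≢ u → ∀ y → Adj x y → c′ y ≡ c₁ y
          agree₁ x x∈ x≢u y a = byCase (y ∈? S₂) (y ≟ u)
            where
            byCase : Dec (y ∈ S₂) → Dec (y ≡ u) → c′ y ≡ c₁ y
            byCase (no y∉) _ = off₂′ y y∉
            byCase (yes _) (yes refl) = on₁ y u∈S₁
            byCase (yes y∈) (no y≢u) = contradiction a (apart x∈ x≢u y∈ y≢u)
          lost₂ : ∀ x → x ∈ S₂ → guess s x c′ ≢ c′ x
          lost₂ x x∈ e = wrong₂ x x∈ (trans (sym (local s x c′ c₂ (agree₂ x x∈))) (trans e (on₂ x x∈)))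
          winner : ∃[ x ] (x ∈ S × guess s x c′ ≡ c′ x) → ⊥
          winner (x , x∈ , e) = byCase (x ∈? S₂) (cover x∈)
            where
            byCase : Dec (x ∈ S₂) → x ∈ S₁ ⊎ x ∈ S₂ → ⊥
            byCase (yes x∈₂) _ = lost₂ x x∈₂ e
            byCase (no x∉) (inj₂ x∈₂) = x∉ x∈₂
            byCase (no x∉) (inj₁ x∈₁) = none (x , x∈₁ ,
              trans (guess′-other c₁ x≢u) (trans (sym (local s x c′ c₁ (agree₁ x x∈₁ x≢u))) (trans e (on₁ x x∈₁))))
              where
              x≢u : x ≢ u
              x≢u refl = x∉ u∈S₂

-- Cycles in cacti

toℕ-next : ∀ {n} (i : Fin (suc n)) → toℕ (next i) ≡ suc (toℕ i) % suc n
toℕ-next {n} i = toℕ-fromℕ< (m%n<n (suc (toℕ i)) (suc n))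

next-inner : ∀ {n} (i : Fin (suc n)) → suc (toℕ i) < suc n → toℕ (next i) ≡ suc (toℕ i)
next-inner i l = trans (toℕ-next i) (m<n⇒m%n≡m l)

next-last : ∀ {n} (i : Fin (suc n)) → toℕ i ≡ n → toℕ (next i) ≡ 0
next-last {n} i e = trans (toℕ-next i) (trans (cong (λ k → suc k % suc n) e) (n%n≡0 (suc n)))

inner-or-last : ∀ {n} (i : Fin (suc n)) → suc (toℕ i) < suc n ⊎ toℕ i ≡ n
inner-or-last {n} i = [ (λ l → inj₁ (s≤s l)) , inj₂ ]′ (ℕ.m≤n⇒m<n∨m≡n (ℕ.≤-pred (toℕ<n i)))

module _ (G : Graph) where
  open Strategies G

  module MkCycle (e : ℕ) (p : ℕ → Vertex)
    (p-inj : ∀ {i j} → i < 3 + e → j < 3 + e → p i ≡ p j → i ≡ j)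
    (p-adj : ∀ {i} → suc i < 3 + e → Adj (p i) (p (suc i)))
    (p-close : Adj (p (2 + e)) (p 0)) where

    cycle : Cycle G
    cycle = record
      { excess = e
      ; vertex = λ i → p (toℕ i)
      ; distinct = λ {i} {j} eq → toℕ-injective (p-inj (toℕ<n i) (toℕ<n j) eq)
      ; step = λ i → [ (λ l → subst (λ k → Adj (p (toℕ i)) (p k)) (sym (next-inner i l)) (p-adj l))
                     , (λ l → subst₂ (λ k k′ → Adj (p k) (p k′)) (sym l) (sym (next-last i l)) p-close) ]′
                     (inner-or-last i) }

    through : ∀ {i} → i < 3 + e → Through cycle (p i)
    through l = fromℕ< l , cong p (toℕ-fromℕ< l)

    edge : ∀ {i} → suc i < 3 + e → HasEdge cycle (p i) (p (suc i))
    edge {i} l = fromℕ< (ℕ.<-trans ℕ.≤-refl l) , inj₁ (cong p e₁ ,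
        cong p (trans (next-inner (fromℕ< i<) (subst (λ k → suc k < 3 + e) (sym e₁) l)) (cong suc e₁)))
      where
      i< = ℕ.<-trans {i} ℕ.≤-refl l
      e₁ = toℕ-fromℕ< i<

    last-edge : HasEdge cycle (p (2 + e)) (p 0)
    last-edge = fromℕ< {2 + e} ℕ.≤-refl , inj₁ (cong p (toℕ-fromℕ< {2 + e} ℕ.≤-refl) ,
      cong p (next-last (fromℕ< {2 + e} ℕ.≤-refl) (toℕ-fromℕ< {2 + e} ℕ.≤-refl)))

  -- The cycle unrolled over all natural positions: rotation becomes a shift of the index, and walks
  -- can cross the seam without a case distinction.
  record Loop (C : Cycle G) : Set where
    field
      at       : ℕ → Vertex
      periodic : ∀ i → at (length C + i) ≡ at i
      at-inj   : ∀ {i j} → i < length C → j < length C → at i ≡ at j → i ≡ j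
      edge     : ∀ i → HasEdge C (at i) (at (suc i))
      edge⁻    : ∀ {u w} → HasEdge C u w → ∃[ j ] (j < length C ×
                   (at j ≡ u × at (suc j) ≡ w ⊎ at j ≡ w × at (suc j) ≡ u))
      onto     : ∀ {u} → Through C u → ∃[ j ] (j < length C × at j ≡ u)

  open Loop

  through-edge : ∀ {C : Cycle G} {u w} → HasEdge C u w → Through C u × Through C w
  through-edge (i , inj₁ (e , e′)) = (i , e) , (next i , e′)
  through-edge (i , inj₂ (e , e′)) = (next i , e′) , (i , e)

  edge-adj : ∀ {C : Cycle G} {u w} → HasEdge C u w → Adj u w
  edge-adj {C} (i , inj₁ (refl , refl)) = Cycle.step C i
  edge-adj {C} (i , inj₂ (refl , refl)) = Adj-sym (Cycle.step C i)

  module _ {C : Cycle G} where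

    private
      n = 2 + Cycle.excess C

    loop : Loop C
    loop = record
      { at = λ i → Cycle.vertex C (i mod suc n)
      ; periodic = λ i → cong (Cycle.vertex C) (mod-cong (suc n + i) i (trans (cong (_% suc n) (+-comm (suc n) i)) ([m+n]%n≡m%n i (suc n))))
      ; at-inj = λ {i} {j} i< j< e → trans (sym (m<n⇒m%n≡m i<)) (trans
          (trans (sym (toℕ-fromℕ< (m%n<n i (suc n)))) (trans (cong toℕ (Cycle.distinct C e)) (toℕ-fromℕ< (m%n<n j (suc n)))))
          (m<n⇒m%n≡m j<))
      ; edge = λ i → i mod suc n , inj₁ (refl , cong (Cycle.vertex C) (next-mod i))
      ; edge⁻ = λ { (i , inj₁ (e , e′)) → toℕ i , toℕ<n i , inj₁ (trans (cong (Cycle.vertex C) (mod-toℕ i)) e , e′)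
                  ; (i , inj₂ (e , e′)) → toℕ i , toℕ<n i , inj₂ (trans (cong (Cycle.vertex C) (mod-toℕ i)) e , e′) }
      ; onto = λ { (i , e) → toℕ i , toℕ<n i , trans (cong (Cycle.vertex C) (mod-toℕ i)) e }
      }
      where
      mod-cong : ∀ i j → i % suc n ≡ j % suc n → i mod suc n ≡ j mod suc n
      mod-cong i j e = toℕ-injective (trans (toℕ-fromℕ< (m%n<n i (suc n))) (trans e (sym (toℕ-fromℕ< (m%n<n j (suc n))))))
      mod-toℕ : ∀ i → toℕ i mod suc n ≡ i
      mod-toℕ i = toℕ-injective (trans (toℕ-fromℕ< (m%n<n (toℕ i) (suc n))) (m<n⇒m%n≡m (toℕ<n i)))
      next-mod : ∀ i → next (i mod suc n) ≡ suc i mod suc n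
      next-mod i = mod-cong (suc (toℕ (i mod suc n))) (suc i) (trans (cong (λ k → suc k % suc n) (toℕ-fromℕ< (m%n<n i (suc n)))) (suc-% i))
        where
        suc-% : ∀ i → suc (i % suc n) % suc n ≡ suc i % suc n
        suc-% i = trans (%-distribˡ-+ 1 (i % suc n) (suc n))
          (trans (cong (λ k → (1 % suc n + k) % suc n) (m%n%n≡m%n i (suc n))) (sym (%-distribˡ-+ 1 i (suc n))))

    module _ (L : Loop C) where

      at-through : ∀ i → Through C (at L i)
      at-through i = proj₁ (through-edge {C} (edge L i))

      at-adj : ∀ i → Adj (at L i) (at L (suc i))
      at-adj i = edge-adj {C} (edge L i)

      rotate₁ : Loop C
      rotate₁ = record
        { at = λ i → at L (suc i)
        ; periodic = λ i → trans (cong (at L) (sym (+-suc (suc n) i))) (periodic L (suc i))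
        ; at-inj = λ {i} {j} i< j< e → injective (ℕ.m≤n⇒m<n∨m≡n i<) (ℕ.m≤n⇒m<n∨m≡n j<) e
        ; edge = λ i → edge L (suc i)
        ; edge⁻ = λ h → edge₁ (edge⁻ L h)
        ; onto = λ t → onto₁ (onto L t)
        }
        where
        wrap : at L (suc n) ≡ at L 0
        wrap = trans (cong (at L) (sym (ℕ.+-identityʳ (suc n)))) (periodic L 0)
        wrap′ : at L (suc (suc n)) ≡ at L 1
        wrap′ = trans (cong (at L) (+-comm 1 (suc n))) (periodic L 1)
        injective : ∀ {i j} → suc i < suc n ⊎ suc i ≡ suc n → suc j < suc n ⊎ suc j ≡ suc n →
                    at L (suc i) ≡ at L (suc j) → i ≡ j
        injective (inj₁ a) (inj₁ b) e = ℕ.suc-injective (at-inj L a b e)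
        injective (inj₁ a) (inj₂ refl) e = contradiction (at-inj L a (s≤s z≤n) (trans e wrap)) λ ()
        injective (inj₂ refl) (inj₁ b) e = contradiction (at-inj L b (s≤s z≤n) (trans (sym e) wrap)) λ ()
        injective (inj₂ refl) (inj₂ refl) e = refl
        edge₁ : ∀ {u w} → ∃[ j ] (j < length C × (at L j ≡ u × at L (suc j) ≡ w ⊎ at L j ≡ w × at L (suc j) ≡ u)) →
                ∃[ j ] (j < length C × (at L (suc j) ≡ u × at L (suc (suc j)) ≡ w ⊎ at L (suc j) ≡ w × at L (suc (suc j)) ≡ u))
        edge₁ (suc j , l , e) = j , ℕ.<-trans ℕ.≤-refl l , e
        edge₁ (zero , _ , inj₁ (e , e′)) = n , ℕ.≤-refl , inj₁ (trans wrap e , trans wrap′ e′)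
        edge₁ (zero , _ , inj₂ (e , e′)) = n , ℕ.≤-refl , inj₂ (trans wrap e , trans wrap′ e′)
        onto₁ : ∀ {u} → ∃[ j ] (j < length C × at L j ≡ u) → ∃[ j ] (j < length C × at L (suc j) ≡ u)
        onto₁ (suc j , l , e) = j , ℕ.<-trans ℕ.≤-refl l , e
        onto₁ (zero , _ , e) = n , ℕ.≤-refl , trans wrap e

    rotate : ℕ → Loop C → Loop C
    rotate zero    L = L
    rotate (suc k) L = rotate k (rotate₁ L)

    at-rotate : ∀ k L i → at (rotate k L) i ≡ at L (k + i)
    at-rotate zero    L i = refl
    at-rotate (suc k) L i = at-rotate k (rotate₁ L) i

    loop-from : ∀ {u} → Through C u → Σ (Loop C) λ L → at L 0 ≡ u
    loop-from t = let j , _ , e = onto loop t in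
      rotate j loop , trans (at-rotate j loop 0) (trans (cong (at loop) (ℕ.+-identityʳ j)) e)

  -- In a cactus, a path leaving a cycle does not return to it elsewhere.
  module Ears (almost-disjoint : ∀ (C D : Cycle G) → ¬ (C ≈ D) →
                 ∀ u v → Through C u → Through D u → Through C v → Through D v → u ≡ v)
              {C : Cycle G} (L : Loop C) where

    -- The arc of `C` from position 0 to `k`, closed by `z`, is a second cycle. It differs from `C`
    -- in the edge from `z 0` to `z 1` but shares both ends of the arc. The case `l ≡ 0` is a chord.
    ear : ∀ {k l} (z : ℕ → Vertex) → 0 < k → k < length C → 3 ≤ k + suc l →
          z 0 ≡ at L k → z (suc l) ≡ at L 0 →
          (∀ {i} → i < suc l → Adj (z i) (z (suc i))) →
          (∀ {i j} → i < l → j < l → z (suc i) ≡ z (suc j) → i ≡ j) →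
          (∀ {i} → i < l → ¬ Through C (z (suc i))) →
          ¬ HasEdge C (z 0) (z 1) → ⊥
    ear {k} {l} z 0<k k< 3≤ z₀ z₁ z-adj z-inj z-off new = ℕ.<⇒≢ 0<k
        (at-inj L (s≤s z≤n) k< (almost-disjoint C D C≉D (at L 0) (at L k)
          (at-through L 0) (subst (Through D) p-0 (through (s≤s z≤n)))
          (at-through L k) (subst (Through D) p-k (through (subst (k <_) (sym len) (ℕ.m<m+n k (s≤s z≤n)))))))
      where
      e = k + suc l ∸ 3
      len : 3 + e ≡ k + suc l
      len = ℕ.m+[n∸m]≡n 3≤
      p : ℕ → Vertex
      p i with i ℕ.≤? k
      ... | yes _ = at L i
      ... | no  _ = z (i ∸ k)
      p-≤ : ∀ {i} → i ≤ k → p i ≡ at L i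
      p-≤ {i} i≤k with i ℕ.≤? k
      ... | yes _ = refl
      ... | no i≰k = contradiction i≤k i≰k
      p-> : ∀ j → p (k + suc j) ≡ z (suc j)
      p-> j with k + suc j ℕ.≤? k
      ... | yes l = contradiction l (ℕ.<⇒≱ (ℕ.m<m+n k (s≤s z≤n)))
      ... | no  _ = cong z (ℕ.m+n∸m≡n k (suc j))
      p-0 : p 0 ≡ at L 0
      p-0 = p-≤ z≤n
      p-k : p k ≡ at L k
      p-k = p-≤ ℕ.≤-refl
      split : ∀ i → i < 3 + e → i ≤ k ⊎ ∃[ j ] (j < l × i ≡ k + suc j)
      split i i< with i ℕ.≤? k
      ... | yes i≤k = inj₁ i≤k
      ... | no  i≰k = inj₂ (i ∸ suc k , ℕ.+-cancelˡ-< (suc k) (i ∸ suc k) l (subst₂ _<_ (sym i≡) (trans len (+-suc k l)) i<) , trans (sym i≡) (sym (+-suc k _)))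
        where
        i≡ : suc k + (i ∸ suc k) ≡ i
        i≡ = ℕ.m+[n∸m]≡n (ℕ.≰⇒> i≰k)
      <C : ∀ {i} → i ≤ k → i < length C
      <C i≤k = ℕ.≤-<-trans i≤k k<
      p-inj : ∀ {i j} → i < 3 + e → j < 3 + e → p i ≡ p j → i ≡ j
      p-inj {i} {j} i< j< eq = byCase (split i i<) (split j j<) eq
        where
        byCase : i ≤ k ⊎ ∃[ i′ ] (i′ < l × i ≡ k + suc i′) → j ≤ k ⊎ ∃[ j′ ] (j′ < l × j ≡ k + suc j′) → p i ≡ p j → i ≡ j
        byCase (inj₁ a) (inj₁ b) eq = at-inj L (<C a) (<C b) (trans (sym (p-≤ a)) (trans eq (p-≤ b)))
        byCase (inj₁ a) (inj₂ (j′ , b , refl)) eq = contradiction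
          (subst (Through C) (trans (sym (p-≤ a)) (trans eq (p-> j′))) (at-through L i)) (z-off b)
        byCase (inj₂ (i′ , a , refl)) (inj₁ b) eq = contradiction
          (subst (Through C) (trans (sym (p-≤ b)) (trans (sym eq) (p-> i′))) (at-through L j)) (z-off a)
        byCase (inj₂ (i′ , a , refl)) (inj₂ (j′ , b , refl)) eq =
          cong (λ m → k + suc m) (z-inj a b (trans (sym (p-> i′)) (trans eq (p-> j′))))
      z-p : ∀ j → j ≤ l → z j ≡ p (k + j)
      z-p zero    _ = trans z₀ (trans (sym p-k) (cong p (sym (ℕ.+-identityʳ k))))
      z-p (suc j) _ = sym (p-> j)
      p-adj : ∀ {i} → suc i < 3 + e → Adj (p i) (p (suc i))
      p-adj {i} i< = byCase (split (suc i) i<)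
        where
        byCase : suc i ≤ k ⊎ ∃[ j ] (j < l × suc i ≡ k + suc j) → Adj (p i) (p (suc i))
        byCase (inj₁ a) = subst₂ Adj (sym (p-≤ (ℕ.≤-trans (ℕ.n≤1+n i) a))) (sym (p-≤ a)) (at-adj L i)
        byCase (inj₂ (j , b , eq)) = subst₂ Adj
          (trans (z-p j (ℕ.<⇒≤ b)) (cong p (ℕ.suc-injective (trans (sym (+-suc k j)) (sym eq)))))
          (sym (trans (cong p eq) (p-> j))) (z-adj (ℕ.m<n⇒m<1+n b))
      2+e : 2 + e ≡ k + l
      2+e = ℕ.suc-injective (trans len (+-suc k l))
      z-last : z l ≡ p (2 + e)
      z-last = trans (z-p l ℕ.≤-refl) (cong p (sym 2+e))
      p-close : Adj (p (2 + e)) (p 0)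
      p-close = subst₂ Adj z-last (trans z₁ (sym p-0)) (z-adj ℕ.≤-refl)
      open MkCycle e p p-inj p-adj p-close renaming (edge to D-edge)
      D : Cycle G
      D = cycle
      D-has : ∀ l′ → l ≡ l′ → HasEdge D (z 0) (z 1)
      D-has zero refl = subst₂ (HasEdge D) (sym z-last) (trans p-0 (sym z₁)) last-edge
      D-has (suc l′) refl = subst₂ (HasEdge D) (trans p-k (sym z₀)) (trans (cong p (+-comm 1 k)) (p-> 0))
        (D-edge (subst₂ _<_ (+-comm k 1) (sym len) (ℕ.+-monoʳ-< k {1} {suc l} (s≤s (s≤s z≤n)))))
      C≉D : ¬ (C ≈ D)
      C≉D C≈D = new (Equivalence.from (C≈D (z 0) (z 1)) (D-has l refl))

-- Upper bounds

-- The players lose the cycle of n vertices when the colour of vertex 0 is restricted to P.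
CycleEscapes : (q n : ℕ) → (Fin q → Set) → Set
CycleEscapes q n P = ∀ (f : Guesses q) → (∀ i → f (n + i) ≡ f i) →
  ¬ ¬ (∃[ a ] ∃[ b ] (P a × Walk f n 0 a b a b))

module _ {q : ℕ} {f : Guesses q} {n : ℕ} (periodic : ∀ i → f (suc n + i) ≡ f i) where

  -- By periodicity, the last step of a closed walk can be moved to its front.
  closed-suc : ∀ {i} → (∀ a b → ¬ Walk f (suc n) i a b a b) → ∀ a b → ¬ Walk f (suc n) (suc i) a b a b
  closed-suc {i} none a b w =
    let c , v , r = unsnoc w in
    none c a (subst (λ φ → φ c b ≢ a) (trans (cong f (+-suc n i)) (periodic i)) r ∷ v)

  closed-anywhere : (∀ a b → ¬ Walk f (suc n) 0 a b a b) → ∀ i a b → ¬ Walk f (suc n) i a b a b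
  closed-anywhere none zero    = none
  closed-anywhere none (suc i) = closed-suc (closed-anywhere none i)

Always : ∀ {q} → Fin q → Set
Always _ = Unit.⊤

two-colours-escape : ∀ {r} → 4 + r < 6 → ∀ k {a b : Fin (4 + r)} → a ≢ b →
                     CycleEscapes (4 + r) (4 + k) (λ x → x ≡ a ⊎ x ≡ b)
two-colours-escape q<6 k a≢b f _ h =
  let s , s∈ , x , w = two-colours-survive f a≢b q<6 k in h (s , x , s∈ , w)

two-colours-escape-triangle : ∀ {r} → 5 ≤ 4 + r → ∀ {a b : Fin (4 + r)} → a ≢ b →
                     CycleEscapes (4 + r) 3 (λ x → x ≡ a ⊎ x ≡ b)
two-colours-escape-triangle 5≤q a≢b f _ h =
  let s , s∈ , x , w = two-colours-survive-triangle f a≢b 5≤q in h (s , x , s∈ , w)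

triangle-escapes : CycleEscapes 4 3 Always
triangle-escapes f _ h = let a , x , w = four-colours-triangle ℕ.≤-refl f in h (a , x , _ , w)

three-colours-escape : ∀ k → ¬ 3 ∣ 5 + k → CycleEscapes 3 (5 + k) Always
three-colours-escape k 3∤n f periodic h = three-colours-lose f k periodic
  (closed-anywhere {f = f} periodic λ a b w → h (a , b , _ , w)) 3∤n

module Upper (G : Graph) where
  open Strategies G public
  open Loop public

  module _ {q : ℕ} where

    abstract
      update : (Vertex → Fin q) → Vertex → Fin q → Vertex → Fin q
      update c v a x with x ≟ v
      ... | yes _ = a
      ... | no  _ = c x

      update-≡ : ∀ c v a → update c v a v ≡ a
      update-≡ c v a with v ≟ v
      ... | yes _ = refl
      ... | no v≢v = contradiction refl v≢v

      update-≢ : ∀ c {v x} a → x ≢ v → update c v a x ≡ c x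
      update-≢ c {v} {x} a x≢v with x ≟ v
      ... | yes e = contradiction e x≢v
      ... | no _ = refl

  -- Simple paths, and components attached at one vertex

  Link : (Vertex → Set) → Vertex → Vertex → Set
  Link P x y = Adj x y × P x × P y

  link-sym : ∀ {P x y} → Link P x y → Link P y x
  link-sym (a , p , p′) = Adj-sym a , p′ , p

  star-last : ∀ {P x y} → Star (Link P) x y → P x → P y
  star-last ε               Px = Px
  star-last ((_ , _ , Py) ◅ r) _ = star-last r Py

  record Chain (P : Vertex → Set) (a b : Vertex) : Set where
    field
      size  : ℕ
      node  : ℕ → Vertex
      start : node 0 ≡ a
      end   : node size ≡ b
      steps : ∀ {i} → i < size → Adj (node i) (node (suc i))
      simple : ∀ {i j} → i ≤ size → j ≤ size → node i ≡ node j → i ≡ j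
      within : ∀ {i} → i ≤ size → P (node i)

  open Chain public

  module _ {P : Vertex → Set} where

    suffix : ∀ {a b} (c : Chain P a b) {j} → j ≤ size c → Chain P (node c j) b
    suffix c {j} j≤ = record
      { size = size c ∸ j
      ; node = λ i → node c (i + j)
      ; start = refl
      ; end = trans (cong (node c) (ℕ.m∸n+n≡m j≤)) (end c)
      ; steps = λ i< → steps c (ℕ.<-≤-trans (ℕ.+-monoˡ-< j i<) (ℕ.≤-reflexive (ℕ.m∸n+n≡m j≤)))
      ; simple = λ {i} {i′} i≤ i′≤ e → ℕ.+-cancelʳ-≡ j i i′ (simple c (bound i≤) (bound i′≤) e)
      ; within = λ i≤ → within c (bound i≤) }
      where
      bound : ∀ {i} → i ≤ size c ∸ j → i + j ≤ size c
      bound i≤ = ℕ.≤-trans (ℕ.+-monoˡ-≤ j i≤) (ℕ.≤-reflexive (ℕ.m∸n+n≡m j≤))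

    prepend : ∀ {u a b} → Adj u a → P u → (c : Chain P a b) → (∀ {j} → j ≤ size c → node c j ≢ u) → Chain P u b
    prepend {u} adj Pu c fresh = record
      { size = suc (size c)
      ; node = node′
      ; start = refl
      ; end = end c
      ; steps = λ { {zero} _ → subst (Adj u) (sym (start c)) adj ; {suc i} (s≤s i<) → steps c i< }
      ; simple = λ { {zero} {zero} _ _ _ → refl
                   ; {zero} {suc j} _ (s≤s j≤) e → contradiction (sym e) (fresh j≤)
                   ; {suc i} {zero} (s≤s i≤) _ e → contradiction e (fresh i≤)
                   ; {suc i} {suc j} (s≤s i≤) (s≤s j≤) e → cong suc (simple c i≤ j≤ e) }
      ; within = λ { {zero} _ → Pu ; {suc i} (s≤s i≤) → within c i≤ } }
      where
      node′ : ℕ → Vertex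
      node′ zero    = u
      node′ (suc i) = node c i

    extend-chain : ∀ {u a b} → Adj u a → P u → Chain P a b → Chain P u b
    extend-chain {u} {a} {b} adj Pu c = byCase (ℕ.anyUpTo? (λ j → node c j ≟ u) (suc (size c)))
      where
      byCase : Dec (∃[ j ] (j < suc (size c) × node c j ≡ u)) → Chain P u b
      byCase (yes (j , s≤s j≤ , e)) = subst (λ u → Chain P u b) e (suffix c j≤)
      byCase (no none) = prepend adj Pu c λ {j} j≤ e → none (j , s≤s j≤ , e)

    chain : ∀ {a b} → P a → Star (Link P) a b → Chain P a b
    chain {a} Pa ε = record
      { size = 0 ; node = λ _ → a ; start = refl ; end = refl ; steps = λ ()
      ; simple = λ { z≤n z≤n _ → refl } ; within = λ _ → Pa }
    chain Pa ((adj , _ , Pb) ◅ s) = extend-chain adj Pa (chain Pb s)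

  Off : Subset order → Subset order → Vertex → Set
  Off S T x = x ∈ S × x ∉ T

  -- This makes a component of `S` outside `T`, together with its attaching vertex, a valid second
  -- half for `glue`.
  Gated : Subset order → Subset order → Set
  Gated T S = ∀ {a b y y′} → a ∈ T → b ∈ T → Off S T y → Adj a y → Star (Link (Off S T)) y y′ → Adj y′ b → a ≡ b

  module _ {q : ℕ} where

    -- Attach the components of S ∖ T to T one at a time.
    glue-all : ∀ {T v} {P : Fin q → Set} → v ∈ T → Loses T v P → ∀ S → Acc _⊂_ S → T ⊆ S → Gated T S →
               (∀ {X u} → u ∈ T → u ∈ X → X ⊆ S → (∀ {x} → x ∈ X → x ∈ T → x ≡ u) → LosesRooted {q} X u) →
               Loses S v P
    glue-all {T} {v} {P} v∈T lose S (acc smaller) T⊆S gated branches s c W = start-from (any? λ x → (x ∈? S) ×-dec ¬? (x ∈? T))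
      where
      module Component (x : Vertex) (x∈S : x ∈ S) (x∉T : x ∉ T)
        (R? : ∀ y → Dec (Star (Link (Off S T)) x y))
        (u : Vertex) (u∈T : u ∈ T)
        (attach : ∀ {b y} → b ∈ T → Star (Link (Off S T)) x y → Adj y b → b ≡ u) where
        Reached : Vertex → Set
        Reached = Star (Link (Off S T)) x
        reached-off : ∀ {y} → Reached y → Off S T y
        reached-off r = star-last r (x∈S , x∉T)
        in₂? : ∀ y → Dec (Reached y ⊎ y ≡ u)
        in₂? y = R? y ⊎-dec (y ≟ u)
        in₁? : ∀ y → Dec (y ∈ S × ¬ Reached y)
        in₁? y = (y ∈? S) ×-dec ¬? (R? y)
        S₁ S₂ : Subset order
        S₁ = subset in₁?
        S₂ = subset in₂?
        S₁⊆S : S₁ ⊆ S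
        S₁⊆S y∈ = proj₁ (∈-subset⁻ in₁? y∈)
        S₂⊆S : S₂ ⊆ S
        S₂⊆S {y} y∈ = [ (λ r → proj₁ (reached-off r)) , (λ e → subst (_∈ S) (sym e) (T⊆S u∈T)) ]′ (∈-subset⁻ in₂? y∈)
        T⊆S₁ : T ⊆ S₁
        T⊆S₁ y∈T = ∈-subset⁺ in₁? (T⊆S y∈T , λ r → proj₂ (reached-off r) y∈T)
        S₁⊂S : S₁ ⊂ S
        S₁⊂S = S₁⊆S , x , x∈S , λ x∈₁ → proj₂ (∈-subset⁻ in₁? x∈₁) ε
        gated₁ : Gated T S₁
        gated₁ a∈ b∈ (y∈ , y∉) a-y r y′-b = gated a∈ b∈ (S₁⊆S y∈ , y∉) a-y
          (Star.map (λ { (adj , (p , p′) , (r , r′)) → adj , (S₁⊆S p , p′) , (S₁⊆S r , r′) }) r) y′-b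
        lose₁ : Loses S₁ v P
        lose₁ = glue-all {P = P} v∈T lose S₁ (smaller S₁⊂S) T⊆S₁ gated₁
          λ u∈T u∈X X⊆S₁ → branches u∈T u∈X (λ x∈ → S₁⊆S (X⊆S₁ x∈))
        meet-T : ∀ {y} → y ∈ S₂ → y ∈ T → y ≡ u
        meet-T y∈ y∈T = [ (λ r → contradiction y∈T (proj₂ (reached-off r))) , (λ e → e) ]′ (∈-subset⁻ in₂? y∈)
        u∈S₂ : u ∈ S₂
        u∈S₂ = ∈-subset⁺ in₂? (inj₂ refl)
        cover : ∀ {y} → y ∈ S → y ∈ S₁ ⊎ y ∈ S₂
        cover {y} y∈ = byCase (R? y)
          where
          byCase : Dec (Reached y) → y ∈ S₁ ⊎ y ∈ S₂
          byCase (yes r) = inj₂ (∈-subset⁺ in₂? (inj₁ r))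
          byCase (no ¬r) = inj₁ (∈-subset⁺ in₁? (y∈ , ¬r))
        meet : ∀ {y} → y ∈ S₁ → y ∈ S₂ → y ≡ u
        meet y∈₁ y∈₂ = [ (λ r → contradiction r (proj₂ (∈-subset⁻ in₁? y∈₁))) , (λ e → e) ]′ (∈-subset⁻ in₂? y∈₂)
        apart : ∀ {y z} → y ∈ S₁ → y ≢ u → z ∈ S₂ → z ≢ u → ¬ Adj y z
        apart {y} {z} y∈ y≢u z∈ z≢u adj = [ reached , z≢u ]′ (∈-subset⁻ in₂? z∈)
          where
          reached : ¬ Reached z
          reached r = byCase (y ∈? T)
            where
            byCase : ¬ Dec (y ∈ T)
            byCase (yes y∈T) = y≢u (attach y∈T r (Adj-sym adj))
            byCase (no y∉T) = proj₂ (∈-subset⁻ in₁? y∈)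
              (r ◅◅ ((Adj-sym adj , reached-off r , S₁⊆S y∈ , y∉T) ◅ ε))
        lost : Loses S v P
        lost = glue {P = P} (T⊆S₁ u∈T) u∈S₂ (T⊆S₁ v∈T) cover S₁⊆S S₂⊆S meet apart lose₁
          (branches u∈T u∈S₂ S₂⊆S meet-T)

      start-from : ¬ Dec (∃[ x ] (x ∈ S × x ∉ T))
      start-from (no none) = lose s c λ c′ off Pv →
        let u , u∈ , e = W c′ (λ u u∉ → off u λ u∈T → u∉ (T⊆S u∈T)) Pv in
        u , decidable-stable (u ∈? T) (λ u∉T → none (u , u∈ , u∉T)) , e
      start-from (yes (x , x∈S , x∉T)) = finite-EM Reached λ R? → EM Attached (conclude R?)
        where
        Reached : Vertex → Set
        Reached = Star (Link (Off S T)) x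
        Attached : Set
        Attached = ∃[ u ] (u ∈ T × ∃[ y ] (Reached y × Adj y u))
        conclude : (∀ y → Dec (Reached y)) → ¬ Dec Attached
        conclude R? (yes (u , u∈T , y , r , y-u)) = Component.lost x x∈S x∉T R? u u∈T
          (λ b∈T r′ y′-b → sym (gated u∈T b∈T (star-last r (x∈S , x∉T)) (Adj-sym y-u)
            (Star.reverse link-sym r ◅◅ r′) y′-b)) s c W
        -- A component without neighbours in `T` is hung on the root `v`; the condition on attaching
        -- edges is then vacuous.
        conclude R? (no none) = Component.lost x x∈S x∉T R? v v∈T
          (λ b∈T r y-b → contradiction (_ , b∈T , _ , r , y-b) none) s c W

  -- A single cycle of a cactus

  module OnCycle (almost-disjoint : ∀ (C D : Cycle G) → ¬ (C ≈ D) →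
                    ∀ u v → Through C u → Through D u → Through C v → Through D v → u ≡ v)
                 (C : Cycle G) where

    open Ears G almost-disjoint {C}

    private
      n = 2 + Cycle.excess C

    through? : ∀ u → Dec (Through C u)
    through? u = any? λ i → Cycle.vertex C i ≟ u

    vertices : Subset order
    vertices = subset through?

    at∈vertices : ∀ (L : Loop G C) i → at L i ∈ vertices
    at∈vertices L i = ∈-subset⁺ through? (at-through G L i)

    -- After rotating the vertex to position 0, a neighbour on `C` at any position other than 1 and
    -- the last one would give an ear without interior.
    chordless : ∀ (L : Loop G C) i {u} → Through C u → Adj (at L (suc i)) u → u ≡ at L i ⊎ u ≡ at L (2 + i)
    chordless L i {u} t adj = byIndex (onto L′ t)
      where
      L′ : Loop G C
      L′ = rotate G (suc i) L
      at′ : ∀ j → at L′ j ≡ at L (suc i + j)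
      at′ = at-rotate G (suc i) L
      adj′ : Adj u (at L′ 0)
      adj′ = subst (Adj u) (sym (trans (at′ 0) (cong (at L) (ℕ.+-identityʳ (suc i))))) (Adj-sym adj)
      byIndex : ∃[ k ] (k < length C × at L′ k ≡ u) → u ≡ at L i ⊎ u ≡ at L (2 + i)
      byIndex (0 , _ , e) = contradiction (subst (Adj u) e adj′) Adj-irrefl
      byIndex (1 , _ , e) = inj₂ (trans (sym e) (trans (at′ 1) (cong (at L) (+-comm (suc i) 1))))
      byIndex (suc (suc k) , k< , e) = byEnd (ℕ.m≤n⇒m<n∨m≡n k<)
        where
        byEnd : 3 + k < length C ⊎ 3 + k ≡ length C → u ≡ at L i ⊎ u ≡ at L (2 + i)
        byEnd (inj₂ eq) = inj₁ (trans (sym e) (trans (at′ (2 + k)) (trans (cong (at L) index) (periodic L i))))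
          where
          index : suc i + (2 + k) ≡ length C + i
          index = trans (sym (+-suc i (2 + k))) (trans (cong (i +_) eq) (+-comm i (length C)))
        byEnd (inj₁ k+1<) = ⊥-elim (ear L′ {2 + k} {0} z (s≤s z≤n) k<
            (s≤s (s≤s (subst (1 ≤_) (+-comm 1 k) (s≤s z≤n)))) (sym e) refl
            (λ { {zero} _ → adj′ ; {suc _} (s≤s ()) }) (λ ()) (λ ()) new)
          where
          z : ℕ → Vertex
          z zero    = u
          z (suc _) = at L′ 0
          new : ¬ HasEdge C u (at L′ 0)
          new h = byEdge (edge⁻ L′ h)
            where
            byEdge : ¬ (∃[ j ] (j < length C × (at L′ j ≡ u × at L′ (suc j) ≡ at L′ 0 ⊎ at L′ j ≡ at L′ 0 × at L′ (suc j) ≡ u)))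
            byEdge (j , j< , inj₁ (p , q)) = contradiction
              (at-inj L′ k+1< (s≤s z≤n) (subst (λ j → at L′ (suc j) ≡ at L′ 0) (at-inj L′ j< k< (trans p (sym e))) q)) λ ()
            byEdge (j , j< , inj₂ (p , q)) = contradiction
              (at-inj L′ (s≤s (s≤s z≤n)) k< (trans (subst (λ j → at L′ (suc j) ≡ u) (at-inj L′ j< (s≤s z≤n) p) q) (sym e))) λ ()

    -- The path outside `C`, made simple, would be an ear from `a` to `b`.
    gated : ∀ {S} → Gated vertices S
    gated {S} {a} {b} {y} {y′} a∈ b∈ y∈ a-y r y′-b = decidable-stable (a ≟ b) λ a≢b →
        contradict a≢b (loop-from G (∈-subset⁻ through? b∈))
      where
      Z : Chain (Off S vertices) y y′
      Z = chain y∈ r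
      l : ℕ
      l = size Z
      w : ℕ → Vertex
      w = node Z
      contradict : a ≢ b → (Σ (Loop G C) λ L → at L 0 ≡ b) → ⊥
      contradict a≢b (L , e₀) = byIndex (onto L (∈-subset⁻ through? a∈))
        where
        z : ℕ → Vertex
        z zero = a
        z (suc i) with i ℕ.≤? l
        ... | yes _ = w i
        ... | no  _ = b
        z-≤ : ∀ {i} → i ≤ l → z (suc i) ≡ w i
        z-≤ {i} i≤ with i ℕ.≤? l
        ... | yes _ = refl
        ... | no i≰ = contradiction i≤ i≰
        z-end : z (suc (suc l)) ≡ b
        z-end with suc l ℕ.≤? l
        ... | yes l< = contradiction l< (ℕ.<⇒≱ ℕ.≤-refl)
        ... | no  _ = refl
        z-adj : ∀ {i} → i < 2 + l → Adj (z i) (z (suc i))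
        z-adj {zero} _ = subst (Adj a) (sym (trans (z-≤ z≤n) (start Z))) a-y
        z-adj {suc i} (s≤s i<) = byCase (ℕ.m≤n⇒m<n∨m≡n (ℕ.≤-pred i<))
          where
          byCase : i < l ⊎ i ≡ l → Adj (z (suc i)) (z (suc (suc i)))
          byCase (inj₁ i<l) = subst₂ Adj (sym (z-≤ (ℕ.<⇒≤ i<l))) (sym (z-≤ i<l)) (steps Z i<l)
          byCase (inj₂ refl) = subst₂ Adj (sym (trans (z-≤ ℕ.≤-refl) (end Z))) (sym z-end) y′-b
        off : ∀ {i} → i < suc l → ¬ Through C (z (suc i))
        off i< t = proj₂ (within Z (ℕ.≤-pred i<)) (subst (_∈ vertices) (z-≤ (ℕ.≤-pred i<)) (∈-subset⁺ through? t))
        byIndex : ¬ (∃[ k ] (k < length C × at L k ≡ a))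
        byIndex (zero , _ , e) = a≢b (trans (sym e) e₀)
        byIndex (suc k , k< , e) = ear L {suc k} {suc l} z (s≤s z≤n) k<
          (s≤s (ℕ.≤-trans (s≤s (s≤s z≤n)) (ℕ.m≤n+m (2 + l) k)))
          (sym e) (trans z-end (sym e₀)) z-adj
          (λ i< j< eq → simple Z (ℕ.≤-pred i<) (ℕ.≤-pred j<) (trans (sym (z-≤ (ℕ.≤-pred i<))) (trans eq (z-≤ (ℕ.≤-pred j<)))))
          off (λ h → off (s≤s z≤n) (proj₂ (through-edge G {C} h)))

    module _ {q : ℕ} where

      -- Without chords, a vertex of the cycle sees its two neighbours there and otherwise only
      -- colours fixed by `c`. Its strategy is thus one of the tables `f i`, and a closed walk is a
      -- colouring on which the whole cycle is wrong.
      cycle-loses : ∀ (L : Loop G C) {P : Fin q → Set} → CycleEscapes q (length C) P → Loses vertices (at L 0) P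
      cycle-loses L {P} escapes s c W = escapes f f-periodic λ { (a , b , Pa , w) → refute Pa (toSequence w) }
        where
        Φ : Vertex → Vertex → Vertex → Fin q → Fin q → Fin q
        Φ u v w a b = guess s v (update (update c u a) w b)
        f : Guesses q
        f i = Φ (at L i) (at L (1 + i)) (at L (2 + i))
        shifted : ∀ j i → at L (j + (length C + i)) ≡ at L (j + i)
        shifted j i = trans (cong (at L) index) (periodic L (j + i))
          where
          index : j + (length C + i) ≡ length C + (j + i)
          index = trans (sym (+-assoc j (length C) i)) (trans (cong (_+ i) (+-comm j (length C))) (+-assoc (length C) j i))
        f-periodic : ∀ i → f (length C + i) ≡ f i
        f-periodic i = trans (cong (λ u → Φ u (at L (1 + (length C + i))) (at L (2 + (length C + i)))) (shifted 0 i))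
          (cong₂ (Φ (at L i)) (shifted 1 i) (shifted 2 i))
        refute : ∀ {a b} → P a → Σ (ℕ → Fin q) (λ x → x 0 ≡ a × x 1 ≡ b × x (length C) ≡ a × x (suc (length C)) ≡ b ×
                   (∀ j → j < length C → f (j + 0) (x j) (x (2 + j)) ≢ x (1 + j))) → ⊥
        refute Pa (x , x₀ , x₁ , xₙ , xₙ₊₁ , escape) = winner (W c′ c′-off (subst P (sym (trans (c′-low (s≤s z≤n)) x₀)) Pa))
          where
          c′ : Vertex → Fin q
          c′ u with through? u
          ... | yes t = x (proj₁ (onto L t))
          ... | no  _ = c u
          c′-low : ∀ {j} → j < length C → c′ (at L j) ≡ x j
          c′-low {j} j< with through? (at L j)
          ... | yes t = cong x (at-inj L (proj₁ (proj₂ (onto L t))) j< (proj₂ (proj₂ (onto L t))))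
          ... | no ¬t = contradiction (at-through G L j) ¬t
          c′-wrap : ∀ {j} → j < length C → x (length C + j) ≡ x j → c′ (at L (length C + j)) ≡ x (length C + j)
          c′-wrap {j} j< e = trans (cong c′ (periodic L j)) (trans (c′-low j<) (sym e))
          c′-at : ∀ {j} → j < 2 + length C → c′ (at L j) ≡ x j
          c′-at {j} j< = byCase (ℕ.m≤n⇒m<n∨m≡n (ℕ.≤-pred j<))
            where
            wrap₀ : c′ (at L (length C)) ≡ x (length C)
            wrap₀ = subst (λ k → c′ (at L k) ≡ x k) (ℕ.+-identityʳ (length C))
              (c′-wrap (s≤s z≤n) (trans (cong x (ℕ.+-identityʳ (length C))) (trans xₙ (sym x₀))))
            wrap₁ : c′ (at L (suc (length C))) ≡ x (suc (length C))
            wrap₁ = subst (λ k → c′ (at L k) ≡ x k) (+-comm (length C) 1)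
              (c′-wrap (s≤s (s≤s z≤n)) (trans (cong x (+-comm (length C) 1)) (trans xₙ₊₁ (sym x₁))))
            byCase : j < suc (length C) ⊎ j ≡ suc (length C) → c′ (at L j) ≡ x j
            byCase (inj₂ refl) = wrap₁
            byCase (inj₁ j<) = [ c′-low , (λ { refl → wrap₀ }) ]′ (ℕ.m≤n⇒m<n∨m≡n (ℕ.≤-pred j<))
          c′-outside : ∀ {u} → ¬ Through C u → c′ u ≡ c u
          c′-outside {u} ¬t with through? u
          ... | yes t = contradiction t ¬t
          ... | no _ = refl
          c′-off : ∀ u → u ∉ vertices → c′ u ≡ c u
          c′-off u u∉ = c′-outside λ t → u∉ (∈-subset⁺ through? t)
          agree : ∀ k → k < length C → ∀ y → Adj (at L (1 + k)) y →
                  c′ y ≡ update (update c (at L k) (x k)) (at L (2 + k)) (x (2 + k)) y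
          agree k k< y adj = byCase (y ≟ at L (2 + k)) (y ≟ at L k)
            where
            d = update c (at L k) (x k)
            byCase : Dec (y ≡ at L (2 + k)) → Dec (y ≡ at L k) → c′ y ≡ update d (at L (2 + k)) (x (2 + k)) y
            byCase (yes refl) _ = trans (c′-at (s≤s (s≤s k<))) (sym (update-≡ d y (x (2 + k))))
            byCase (no ≢w) (yes refl) = trans (c′-low k<)
              (sym (trans (update-≢ d (x (2 + k)) ≢w) (update-≡ c y (x k))))
            byCase (no ≢w) (no ≢v) = trans (c′-outside λ t → [ ≢v , ≢w ]′ (chordless L k t adj))
              (sym (trans (update-≢ d (x (2 + k)) ≢w) (update-≢ c (x k) ≢v)))
          winner : ¬ (∃[ u ] (u ∈ vertices × guess s u c′ ≡ c′ u))
          -- The table `f k` belongs to the vertex at position `1 + k`, so `u` is located on the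
          -- loop rotated by one.
          winner (u , u∈ , e) = at-index (onto (rotate₁ G L) (∈-subset⁻ through? u∈))
            where
            at-index : ¬ (∃[ k ] (k < length C × at L (1 + k) ≡ u))
            at-index (k , k< , refl) = escape k k< (trans (cong (λ i → f i (x k) (x (2 + k))) (ℕ.+-identityʳ k))
              (trans (sym (local s (at L (1 + k)) c′ (update (update c (at L k) (x k)) (at L (2 + k)) (x (2 + k))) (agree k k<)))
                (trans e (c′-at (s≤s (ℕ.m<n⇒m<1+n k<))))))

    -- Provides the strict decrease for the recursion into branches: of two different vertices of
    -- the cycle, one is not `u`.
    missing : ∀ {X u} → (∀ {x} → x ∈ X → x ∈ vertices → x ≡ u) → ∃[ x ] (x ∈ vertices × x ∉ X)
    missing {X} {u} meet = byCase (at L 0 ≟ u)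
      where
      L : Loop G C
      L = loop G
      byCase : Dec (at L 0 ≡ u) → ∃[ x ] (x ∈ vertices × x ∉ X)
      byCase (no ≢u) = at L 0 , at∈vertices L 0 , λ x∈ → ≢u (meet x∈ (at∈vertices L 0))
      byCase (yes e) = at L 1 , at∈vertices L 1 , λ x∈ → contradiction
        (at-inj L (s≤s z≤n) (s≤s (s≤s z≤n)) (trans e (sym (meet x∈ (at∈vertices L 1))))) λ ()

  -- Whole cacti, by induction on vertex sets

  module Cacti (almost-disjoint : ∀ (C D : Cycle G) → ¬ (C ≈ D) →
                  ∀ u v → Through C u → Through D u → Through C v → Through D v → u ≡ v)
               (r : ℕ) where

    private
      q = 3 + r
      module O = OnCycle almost-disjoint

    Inside : Cycle G → Subset order → Set
    Inside C S = ∀ {u} → Through C u → u ∈ S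

    Escaping : Cycle G → Set
    Escaping C = ∀ {a b : Fin q} → a ≢ b → CycleEscapes q (length C) (λ x → x ≡ a ⊎ x ≡ b)

    single-loses : ∀ {S v} → v ∈ S → (∀ {x} → x ∈ S → x ≡ v) → LosesRooted {q} S v
    single-loses {S} {v} v∈S only {a} {b} a≢b s c W =
        [ refute a (inj₁ refl) , refute b (inj₂ refl) ]′ (≢-one a≢b (guess s v c))
      where
      refute : ∀ t → t ≡ a ⊎ t ≡ b → guess s v c ≢ t → ⊥
      refute t t∈ r = winner (W (update c v t) (λ u u∉ → update-≢ c t λ { refl → u∉ v∈S })
          (subst (λ x → x ≡ a ⊎ x ≡ b) (sym (update-≡ c v t)) t∈))
        where
        winner : ¬ (∃[ u ] (u ∈ S × guess s u (update c v t) ≡ update c v t u))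
        winner (u , u∈ , e) with only u∈
        ... | refl = r (trans (local s v c (update c v t) λ y adj →
                sym (update-≢ c t λ { refl → Adj-irrefl adj })) (trans e (update-≡ c v t)))

    -- Give `w` a colour that it guesses for neither of the two colours of `v`. With that colour
    -- fixed, `v` has one guess against two possible colours.
    pair-loses : ∀ {T v w} → v ∈ T → w ∈ T → w ≢ v → (∀ {x} → x ∈ T → x ≡ v ⊎ x ≡ w) → LosesRooted {q} T v
    pair-loses {T} {v} {w} v∈ w∈ w≢v only {a} {b} a≢b s c W =
        pick-w (fresh (guess s w (update c v a) ∷ guess s w (update c v b) ∷ []) (s≤s (s≤s (s≤s z≤n))))
      where
      pick-w : ¬ (∃[ t ] t ∉ₗ (guess s w (update c v a) ∷ guess s w (update c v b) ∷ []))
      pick-w (t , t∉) = [ refute a (inj₁ refl) (λ e → t∉ (here (sym e))) ,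
          refute b (inj₂ refl) (λ e → t∉ (there (here (sym e)))) ]′
          (≢-one a≢b (guess s v (update c w t)))
        where
        refute : ∀ y → y ≡ a ⊎ y ≡ b → guess s w (update c v y) ≢ t → guess s v (update c w t) ≢ y → ⊥
        refute y y∈ wrong-w wrong-v = winner (W d off (subst (λ x → x ≡ a ⊎ x ≡ b) (sym dv) y∈))
          where
          d : Vertex → Fin q
          d = update (update c v y) w t
          dv : d v ≡ y
          dv = trans (update-≢ (update c v y) t λ e → w≢v (sym e)) (update-≡ c v y)
          dw : d w ≡ t
          dw = update-≡ (update c v y) w t
          off : ∀ u → u ∉ T → d u ≡ c u
          off u u∉ = trans (update-≢ (update c v y) t λ { refl → u∉ w∈ }) (update-≢ c y λ { refl → u∉ v∈ })
          from-w : ∀ u → Adj w u → d u ≡ update c v y u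
          from-w u adj = update-≢ (update c v y) t λ { refl → Adj-irrefl adj }
          from-v : ∀ u → Adj v u → d u ≡ update c w t u
          from-v u adj = byCase (u ≟ w)
            where
            byCase : Dec (u ≡ w) → d u ≡ update c w t u
            byCase (yes refl) = trans dw (sym (update-≡ c w t))
            byCase (no u≢w) = trans (update-≢ (update c v y) t u≢w)
              (trans (update-≢ c y λ { refl → Adj-irrefl adj }) (sym (update-≢ c t u≢w)))
          winner : ¬ (∃[ u ] (u ∈ T × guess s u d ≡ d u))
          winner (u , u∈ , e) = [ (λ { refl → wrong-v (trans (sym (local s v d (update c w t) from-v)) (trans e dv)) }) ,
            (λ { refl → wrong-w (trans (sym (local s w d (update c v y) from-w)) (trans e dw)) }) ]′ (only u∈)

    -- Either the root lies on a cycle, or we attach everything to the root and a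
    -- neighbour of it (any vertex, if it has no neighbours).
    rooted-loses : ∀ S → Acc _⊂_ S → (∀ C → Inside C S → Escaping C) → ∀ {v} → v ∈ S → LosesRooted {q} S v
    rooted-loses S (acc smaller) escaping {v} v∈S {a} {b} a≢b s c W = EM OnACycle λ d → byCase d
      where
      P : Fin q → Set
      P x = x ≡ a ⊎ x ≡ b
      Rest : Vertex → Set
      Rest x = x ∈ S × x ≢ v
      OnACycle : Set
      OnACycle = ∃[ w ] ∃[ w′ ] (w ≢ w′ × Rest w × Adj v w × Adj v w′ × Star (Link Rest) w w′)
      branch-loses : ∀ {X u} → X ⊂ S → u ∈ X → LosesRooted {q} X u
      branch-loses {X} X⊂S u∈X = rooted-loses X (smaller X⊂S)
        (λ C in-X → escaping C λ t → proj₁ X⊂S (in-X t)) u∈X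

      on-cycle : ¬ OnACycle
      on-cycle (w , w′ , w≢w′ , w∈ , v-w , v-w′ , reach) = byLength (size Z) refl
        where
        Z : Chain Rest w w′
        Z = chain w∈ reach
        byLength : ∀ l → size Z ≢ l
        byLength zero l≡ = w≢w′ (trans (sym (start Z)) (trans (cong (node Z) (sym l≡)) (end Z)))
        byLength (suc e) l≡ = around (loop-from G (subst (Through C) refl (through {0} (s≤s z≤n))))
          where
          p : ℕ → Vertex
          p zero    = v
          p (suc i) = node Z i
          ≤Z : ∀ {i} → suc i < 3 + e → i ≤ size Z
          ≤Z i< = ℕ.≤-trans (ℕ.≤-pred (ℕ.≤-pred i<)) (ℕ.≤-reflexive (sym l≡))
          p-inj : ∀ {i j} → i < 3 + e → j < 3 + e → p i ≡ p j → i ≡ j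
          p-inj {zero} {zero} _ _ _ = refl
          p-inj {zero} {suc j} _ j< eq = contradiction (sym eq) (proj₂ (within Z (≤Z j<)))
          p-inj {suc i} {zero} i< _ eq = contradiction eq (proj₂ (within Z (≤Z i<)))
          p-inj {suc i} {suc j} i< j< eq = cong suc (simple Z (≤Z i<) (≤Z j<) eq)
          p-adj : ∀ {i} → suc i < 3 + e → Adj (p i) (p (suc i))
          p-adj {zero} _ = subst (Adj v) (sym (start Z)) v-w
          p-adj {suc i} i< = steps Z (≤Z i<)
          p-close : Adj (p (2 + e)) (p 0)
          p-close = subst (λ u → Adj u v) (sym (trans (cong (node Z) (sym l≡)) (end Z))) (Adj-sym v-w′)
          open MkCycle G e p p-inj p-adj p-close using (through) renaming (cycle to C)
          in-S : Inside C S
          in-S (i , refl) = p∈ (toℕ i) (toℕ<n i)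
            where
            p∈ : ∀ i → i < 3 + e → p i ∈ S
            p∈ zero _ = v∈S
            p∈ (suc i) i< = proj₁ (within Z (≤Z i<))
          T⊆S : O.vertices C ⊆ S
          T⊆S u∈ = in-S (∈-subset⁻ (O.through? C) u∈)
          around : ¬ (Σ (Loop G C) λ L → at L 0 ≡ v)
          around (L , e₀) = glue-all {P = P} (subst (_∈ O.vertices C) e₀ (O.at∈vertices C L 0))
            (subst (λ u → Loses (O.vertices C) u P) e₀ (O.cycle-loses C L (escaping C in-S a≢b)))
            S (acc smaller) T⊆S (O.gated C)
            (λ _ u∈X X⊆S meet → let x , x∈ , x∉ = O.missing C meet in branch-loses (X⊆S , x , T⊆S x∈ , x∉) u∈X) s c W

      off-cycle : ¬ OnACycle → ∀ {w} → w ∈ S → w ≢ v → (Adj v w ⊎ (∀ {y} → y ∈ S → ¬ Adj v y)) → ⊥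
      off-cycle none {w} w∈S w≢v nbr = glue-all {P = P} v∈T (pair-loses v∈T w∈T w≢v only a≢b)
          S (acc smaller) T⊆S gated (λ _ u∈X X⊆S meet → branch-loses (missing X⊆S meet) u∈X) s c W
        where
        in? : ∀ x → Dec (x ≡ v ⊎ x ≡ w)
        in? x = (x ≟ v) ⊎-dec (x ≟ w)
        T : Subset order
        T = subset in?
        v∈T : v ∈ T
        v∈T = ∈-subset⁺ in? (inj₁ refl)
        w∈T : w ∈ T
        w∈T = ∈-subset⁺ in? (inj₂ refl)
        only : ∀ {x} → x ∈ T → x ≡ v ⊎ x ≡ w
        only x∈ = ∈-subset⁻ in? x∈
        T⊆S : T ⊆ S
        T⊆S x∈ = [ (λ { refl → v∈S }) , (λ { refl → w∈S }) ]′ (only x∈)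
        missing : ∀ {X u} → X ⊆ S → (∀ {x} → x ∈ X → x ∈ T → x ≡ u) → X ⊂ S
        missing {X} {u} X⊆S meet = X⊆S , byCase′ (v ≟ u)
          where
          byCase′ : Dec (v ≡ u) → ∃[ x ] (x ∈ S × x ∉ X)
          byCase′ (no v≢u) = v , v∈S , λ v∈X → v≢u (meet v∈X v∈T)
          byCase′ (yes v≡u) = w , w∈S , λ w∈X → w≢v (trans (meet w∈X w∈T) (sym v≡u))
        rest : ∀ {x} → Off S T x → Rest x
        rest (x∈ , x∉) = x∈ , λ { refl → x∉ v∈T }
        path : ∀ {x y} → Star (Link (Off S T)) x y → Star (Link Rest) x y
        path = Star.map λ { (adj , p , p′) → adj , rest p , rest p′ }
        ≢w : ∀ {x} → Off S T x → x ≢ w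
        ≢w (_ , x∉) refl = x∉ w∈T
        -- Such a path, completed by the edge from `v` to `w`, would put the root on a cycle; if the
        -- root has no neighbours, the path cannot start.
        cross : ∀ {y y′} → Off S T y → Adj v y → Star (Link (Off S T)) y y′ → Adj y′ w → ⊥
        cross {y} {y′} y∈ v-y reach y′-w = [ (λ v-w → none (y , w , ≢w y∈ , rest y∈ , v-y , v-w ,
            path reach ◅◅ ((y′-w , rest (star-last reach y∈) , (w∈S , w≢v)) ◅ ε))) ,
          (λ isolated → isolated (proj₁ y∈) v-y) ]′ nbr
        gated : Gated T S
        gated {a} {b} a∈ b∈ y∈ a-y reach y′-b = byEnds (only a∈) (only b∈)
          where
          byEnds : a ≡ v ⊎ a ≡ w → b ≡ v ⊎ b ≡ w → a ≡ b
          byEnds (inj₁ refl) (inj₁ refl) = refl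
          byEnds (inj₂ refl) (inj₂ refl) = refl
          byEnds (inj₁ refl) (inj₂ refl) = ⊥-elim (cross y∈ a-y reach y′-b)
          byEnds (inj₂ refl) (inj₁ refl) = ⊥-elim (cross (star-last reach y∈) (Adj-sym y′-b)
            (Star.reverse link-sym reach) (Adj-sym a-y))

      byCase : ¬ Dec OnACycle
      byCase (yes o) = on-cycle o
      byCase (no none) = byNeighbour (any? λ w → (w ∈? S) ×-dec Adj? v w) (any? λ w → (w ∈? S) ×-dec ¬? (w ≟ v))
        where
        byNeighbour : Dec (∃[ w ] (w ∈ S × Adj v w)) → Dec (∃[ w ] (w ∈ S × w ≢ v)) → ⊥
        byNeighbour (yes (w , w∈ , adj)) _ = off-cycle none w∈ (λ { refl → Adj-irrefl adj }) (inj₁ adj)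
        byNeighbour (no isolated) (yes (w , w∈ , w≢v)) = off-cycle none w∈ w≢v (inj₂ λ y∈ adj → isolated (_ , y∈ , adj))
        byNeighbour (no _) (no alone) = single-loses v∈S
          (λ {x} x∈ → decidable-stable (x ≟ v) λ x≢v → alone (x , x∈ , x≢v)) a≢b s c W

    losing : ∀ {v} {P : Fin q → Set} → (∀ x → P x) → Loses ⊤ v P → ¬ ∃ (Wins {q})
    losing P lose (s , wins) = lose s (λ _ → zero) λ c _ _ → let u , e = wins c in u , ∈⊤ , e

    rooted-loses-⊤ : (∀ C → Escaping C) → Vertex → ¬ ∃ (Wins {q})
    rooted-loses-⊤ escaping v (s , wins) = rooted-loses ⊤ (⊂-wellFounded ⊤) (λ C _ → escaping C) {v} ∈⊤ {0F} {1F} (λ ())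
      s (λ _ → zero) λ c _ _ → let u , e = wins c in u , ∈⊤ , e

    -- A branch meets `C` in one vertex and so does not contain it. Hence `C` may be a cycle that
    -- needs all colours at its root in order to lose, while all cycles within branches lose with
    -- two.
    core-loses : (C : Cycle G) → CycleEscapes q (length C) Always → (∀ D → ¬ (C ≈ D) → Escaping D) → ¬ ∃ (Wins {q})
    core-loses C escapes others = losing {v = at (loop G {C}) 0} {P = Always} (λ _ → _)
      (glue-all {P = Always} (O.at∈vertices C (loop G) 0) (O.cycle-loses C (loop G) escapes) ⊤ (⊂-wellFounded ⊤)
        (λ _ → ∈⊤) (O.gated C) λ {X} {u} u∈T u∈X X⊆S meet → rooted-loses X (⊂-wellFounded X)
          (λ D D⊆X → others D λ C≈D → let x , x∈ , x∉ = O.missing C meet in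
            x∉ (D⊆X (same {D} C≈D (∈-subset⁻ (O.through? C) x∈)))) u∈X)
      where
      same : {D : Cycle G} → C ≈ D → ∀ {x} → Through C x → Through D x
      same {D} C≈D (i , refl) = proj₁ (through-edge G {D} (Equivalence.to (C≈D (Cycle.vertex C i) (Cycle.vertex C (next i))) (i , inj₁ (refl , refl))))

-- Lower bounds

-- Colours as pairs of bits; for three colours one pair is unused.
record Code (q : ℕ) : Set where
  field
    first second : Fin q → Bool
    decode : Bool → Bool → Fin q
    decode-bits : ∀ x → decode (first x) (second x) ≡ x

code₃ : Code 3
code₃ = record
  { first  = λ { 0F → false ; 1F → false ; 2F → true }
  ; second = λ { 0F → false ; 1F → true ; 2F → false }
  ; decode = λ { false false → 0F ; false true → 1F ; true _ → 2F }
  ; decode-bits = λ { 0F → refl ; 1F → refl ; 2F → refl } }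

pattern 3F = suc (suc (suc zero))

code₄ : Code 4
code₄ = record
  { first  = λ { 0F → false ; 1F → false ; 2F → true ; 3F → true }
  ; second = λ { 0F → false ; 1F → true ; 2F → false ; 3F → true }
  ; decode = λ { false false → 0F ; false true → 1F ; true false → 2F ; true true → 3F }
  ; decode-bits = λ { 0F → refl ; 1F → refl ; 2F → refl ; 3F → refl } }

-- Strategies for the vertices 1, …, n - 1 of a cycle which, when they all guess
-- wrong, reveal the bit β of the colour of vertex 0 to that vertex.
RootInfo : (q n : ℕ) → (Fin q → Bool) → Set
RootInfo q n β = Σ (Guesses q) λ f → Σ (Fin q → Fin q → Bool) λ F →
  ∀ (x : ℕ → Fin q) → x n ≡ x 0 → (∀ k → suc k < n → f k (x k) (x (2 + k)) ≢ x (1 + k)) →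
  β (x 0) ≡ F (x 1) (x (n ∸ 1))

-- Vertex 1 bets on 1 when it sees 2 on vertex 2, and vertex 2 bets on 2 unless it sees 1 on vertex
-- 1. If both are wrong, colours 0 and 2 of vertex 1 reveal the bit through `α`. If vertex 1 has
-- colour 1, then vertex 2 does not have colour 2, so its first bit is known. This starts a relay
-- around the other side: each vertex knows its first bit and bets that its second bit equals the
-- next signal, whose value is then revealed to the next vertex. The last signal is `β` of the root.
root-info₃ : ∀ e β → RootInfo 3 (3 + e) β
root-info₃ e β = f , F , informed
  where
  open Code code₃
  n = 3 + e
  -- The bit that the vertex after the root's other neighbour is to be told about.
  signal : ℕ → Fin 3 → Bool
  signal k b with 2 + k ℕ.≟ n
  ... | yes _ = β b
  ... | no  _ = first b
  signal-last : ∀ {k} b → 2 + k ≡ n → signal k b ≡ β b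
  signal-last {k} b e with 2 + k ℕ.≟ n
  ... | yes _ = refl
  ... | no ≢n = contradiction e ≢n
  signal-inner : ∀ {k} b → 2 + k ≢ n → signal k b ≡ first b
  signal-inner {k} b ≢n with 2 + k ℕ.≟ n
  ... | yes e = contradiction e ≢n
  ... | no _ = refl
  α : Bool → Fin 3 → Fin 3
  α _ 2F = 1F
  α false _ = 0F
  α true  _ = 2F
  second-guess : Fin 3 → Bool → Fin 3
  second-guess 1F b = decode false b
  second-guess _  _ = 2F
  f : Guesses 3
  f 0 a b = α (β a) b
  f 1 a b = second-guess a (signal 1 b)
  f (suc (suc k)) a b = decode (not (second a)) (signal (2 + k) b)
  F : Fin 3 → Fin 3 → Bool
  F 0F _ = true
  F 1F y = not (second y)
  F 2F _ = false
  tell : ∀ {b b′} y → decode b b′ ≢ y → first y ≡ b → b′ ≡ not (second y)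
  tell y wrong refl = ¬-not λ { refl → wrong (decode-bits y) }
  informed : ∀ x → x n ≡ x 0 → (∀ k → suc k < n → f k (x k) (x (2 + k)) ≢ x (1 + k)) → β (x 0) ≡ F (x 1) (x (2 + e))
  informed x closed wrong = byFirst (x 1) refl
    where
    wrong₁ = wrong 0 (s≤s (s≤s z≤n))
    wrong₂ = wrong 1 (s≤s (s≤s (s≤s z≤n)))
    outer : ∀ b x₁ x₂ s → α b x₂ ≢ x₁ → second-guess x₁ s ≢ x₂ →
            (x₁ ≡ 0F → b ≡ true) × (x₁ ≡ 1F → first x₂ ≡ false) × (x₁ ≡ 2F → b ≡ false)
    outer _     0F 2F _ _ r = contradiction refl r
    outer false 0F 0F _ r _ = contradiction refl r
    outer false 0F 1F _ r _ = contradiction refl r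
    outer true  0F _  _ _ _ = (λ _ → refl) , (λ ()) , λ ()
    outer _     1F 2F _ r _ = contradiction refl r
    outer _     1F 0F _ _ _ = (λ ()) , (λ _ → refl) , λ ()
    outer _     1F 1F _ _ _ = (λ ()) , (λ _ → refl) , λ ()
    outer _     2F 2F _ _ r = contradiction refl r
    outer true  2F 0F _ r _ = contradiction refl r
    outer true  2F 1F _ r _ = contradiction refl r
    outer false 2F _  _ _ _ = (λ ()) , (λ ()) , λ _ → refl
    known = outer (β (x 0)) (x 1) (x 2) (signal 1 (x 3)) wrong₁ wrong₂
    told : x 1 ≡ 1F → ∀ i → 2 + i < n → signal (1 + i) (x (3 + i)) ≡ not (second (x (2 + i)))
    told e zero l = tell (x 2) (λ e′ → wrong₂ (trans (cong (λ a → second-guess a (signal 1 (x 3))) e) e′))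
      (proj₁ (proj₂ known) e)
    told e (suc i) l = tell (x (3 + i)) (wrong (2 + i) l)
      (trans (sym (signal-inner {1 + i} (x (3 + i)) (ℕ.<⇒≢ l))) (told e i (ℕ.<-trans ℕ.≤-refl l)))
    byFirst : ∀ y → x 1 ≡ y → β (x 0) ≡ F (x 1) (x (2 + e))
    byFirst 0F eq = trans (proj₁ known eq) (cong (λ y → F y (x (2 + e))) (sym eq))
    byFirst 2F eq = trans (proj₂ (proj₂ known) eq) (cong (λ y → F y (x (2 + e))) (sym eq))
    byFirst 1F eq = begin
      β (x 0)                    ≡⟨ cong β (sym closed) ⟩
      β (x n)                    ≡⟨ sym (signal-last {1 + e} (x n) refl) ⟩
      signal (1 + e) (x (3 + e)) ≡⟨ told eq e ℕ.≤-refl ⟩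
      not (second (x (2 + e)))   ≡⟨ cong (λ y → F y (x (2 + e))) (sym eq) ⟩
      F (x 1) (x (2 + e))        ∎
      where open ≡-Reasoning

-- The weighted sum 2 β + x₁ + x₂ modulo 4 is 0, 1 or at least 2; vertices 1 and 2
-- bet on the first two values.
root-info₄ : ∀ β → RootInfo 4 3 β
root-info₄ β = f , F , λ x closed wrong → informed (β (x 0)) (x 1) (x 2)
    (λ e → wrong 0 (s≤s (s≤s z≤n)) e)
    (λ e → wrong 1 (s≤s (s≤s (s≤s z≤n))) (trans (cong (λ c → bet 1 (β c) (x 1)) closed) e))
  where
  weight : Bool → ℕ
  weight false = 0
  weight true  = 2
  bet : ℕ → Bool → Fin 4 → Fin 4
  -- The subtrahend is at most 5, and 8 is a multiple of 4 above it, so truncated subtraction acts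
  -- as subtraction modulo 4.
  bet s b y = (s + (8 ∸ (weight b + toℕ y))) mod 4
  f : Guesses 4
  f 0 a b = bet 0 (β a) b
  f _ a b = bet 1 (β b) a
  F : Fin 4 → Fin 4 → Bool
  F y z = Bool.not (1 <ᵇ (toℕ y + toℕ z) % 4)
  informed : ∀ b y z → bet 0 b z ≢ y → bet 1 b y ≢ z → b ≡ F y z
  informed true  = from-yes (all? λ y → all? λ z → ¬? (bet 0 true z ≟ y) →-dec (¬? (bet 1 true y ≟ z) →-dec (true Bool.≟ F y z)))
  informed false = from-yes (all? λ y → all? λ z → ¬? (bet 0 false z ≟ y) →-dec (¬? (bet 1 false y ≟ z) →-dec (false Bool.≟ F y z)))

-- Cycles that win with three colours on their own

CycleWins : ℕ → ℕ → Set
CycleWins q n = Σ (Guesses q) λ f → ∀ (x : ℕ → Fin q) → x n ≡ x 0 → x (suc n) ≡ x 1 →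
  ∃[ k ] (k < n × f k (x k) (x (2 + k)) ≡ x (1 + k))

-- Every vertex uses the table `t`, but colours seen across the cut between vertices 3 and 0 are
-- relabelled by the involution `w`. That some vertex is always right is checked over the 81
-- colourings.
four-cycle-wins : CycleWins 3 4
four-cycle-wins = f , λ x e₀ e₁ → win x (rows (x 0) (x 1) (x 2) (x 3)) e₀ e₁
  where
  t : Fin 3 → Fin 3 → Fin 3
  t 0F 0F = 2F
  t 0F _  = 0F
  t 1F 1F = 2F
  t 1F _  = 1F
  t 2F 0F = 1F
  t 2F 1F = 0F
  t 2F 2F = 2F
  w : Fin 3 → Fin 3
  w 0F = 1F
  w 1F = 0F
  w 2F = 2F
  f : Guesses 3
  f 2 a b = t a (w b)
  f 3 a b = w (t a (w b))
  f _ a b = t a b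
  rows : ∀ a b c d → t a c ≡ b ⊎ t b d ≡ c ⊎ t c (w a) ≡ d ⊎ w (t d (w b)) ≡ a
  rows = from-yes (all? λ a → all? λ b → all? λ c → all? λ d →
    (t a c ≟ b) ⊎-dec ((t b d ≟ c) ⊎-dec ((t c (w a) ≟ d) ⊎-dec (w (t d (w b)) ≟ a))))
  win : ∀ (x : ℕ → Fin 3) → t (x 0) (x 2) ≡ x 1 ⊎ t (x 1) (x 3) ≡ x 2 ⊎ t (x 2) (w (x 0)) ≡ x 3 ⊎ w (t (x 3) (w (x 1))) ≡ x 0 →
        x 4 ≡ x 0 → x 5 ≡ x 1 → ∃[ k ] (k < 4 × f k (x k) (x (2 + k)) ≡ x (1 + k))
  win x (inj₁ e) _ _ = 0 , s≤s z≤n , e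
  win x (inj₂ (inj₁ e)) _ _ = 1 , s≤s (s≤s z≤n) , e
  win x (inj₂ (inj₂ (inj₁ e))) e₀ _ = 2 , s≤s (s≤s (s≤s z≤n)) , trans (cong (λ c → t (x 2) (w c)) e₀) e
  win x (inj₂ (inj₂ (inj₂ e))) e₀ e₁ = 3 , ℕ.≤-refl , trans (cong (λ c → w (t (x 3) (w c))) e₁) (trans e (sym e₀))

-- Seen through a cut, across which colours are shifted by one, all vertices use
-- the same table.  If everyone is wrong, then the difference of consecutive
-- colours is constant, and no constant works.
multiple-of-three-wins : ∀ {n} → 2 ≤ n → 3 ∣ n → CycleWins 3 n
multiple-of-three-wins {n} 2≤n (divides K n≡) = f , λ x e₀ e₁ → decidable-stable
    (ℕ.anyUpTo? (λ k → f k (x k) (x (2 + k)) ≟ x (1 + k)) n) λ none → lost x e₀ e₁ λ k k< e → none (k , k< , e)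
  where
  s s⁻ : Fin 3 → Fin 3
  s 0F = 1F
  s 1F = 2F
  s 2F = 0F
  s⁻ 0F = 2F
  s⁻ 1F = 0F
  s⁻ 2F = 1F
  s⁻-s : ∀ a → s⁻ (s a) ≡ a
  s⁻-s = from-yes (all? λ a → s⁻ (s a) ≟ a)
  s³ : ∀ a → s (s (s a)) ≡ a
  s³ = from-yes (all? λ a → s (s (s a)) ≟ a)
  s≢ : ∀ a → s a ≢ a
  s≢ = from-yes (all? λ a → ¬? (s a ≟ a))
  t : Fin 3 → Fin 3 → Fin 3
  t a b with a ≟ b
  ... | yes _ = s a
  ... | no  _ = a
  cut : ℕ → Fin 3 → Fin 3
  cut j a with n ℕ.≤? j
  ... | yes _ = s a
  ... | no  _ = a
  uncut : ℕ → Fin 3 → Fin 3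
  uncut j a with n ℕ.≤? j
  ... | yes _ = s⁻ a
  ... | no  _ = a
  uncut-cut : ∀ j a → uncut j (cut j a) ≡ a
  uncut-cut j a with n ℕ.≤? j
  ... | yes _ = s⁻-s a
  ... | no  _ = refl
  cut-low : ∀ {j} a → j < n → cut j a ≡ a
  cut-low {j} a j< with n ℕ.≤? j
  ... | yes n≤j = contradiction n≤j (ℕ.<⇒≱ j<)
  ... | no _ = refl
  cut-high : ∀ {j} a → n ≤ j → cut j a ≡ s a
  cut-high {j} a n≤ with n ℕ.≤? j
  ... | yes _ = refl
  ... | no n≰ = contradiction n≤ n≰
  f : Guesses 3
  f k a b = uncut (1 + k) (t a (cut (2 + k) b))

  -- As long as all guesses are wrong, the difference of consecutive colours can only move along
  -- `Down`, `Up`, `Equal`. The cut shifts both colours alike, so the difference is the same after a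
  -- full turn and cannot have moved.
  Equal Up Down : Fin 3 → Fin 3 → Set
  Equal a b = b ≡ a
  Up    a b = b ≡ s a
  Down  a b = b ≡ s (s a)
  trichotomy : ∀ a b → (Equal a b ⊎ Up a b) ⊎ Down a b
  trichotomy = from-yes (all? λ a → all? λ b → ((b ≟ a) ⊎-dec (b ≟ s a)) ⊎-dec (b ≟ s (s a)))
  exclusive : ∀ a b → Down a b → ¬ (Equal a b ⊎ Up a b)
  exclusive = from-yes (all? λ a → all? λ b → (b ≟ s (s a)) →-dec ¬? ((b ≟ a) ⊎-dec (b ≟ s a)))
  equal-step : ∀ a b c → t a c ≢ b → Equal a b → Equal b c
  equal-step = from-yes (all? λ a → all? λ b → all? λ c → ¬? (t a c ≟ b) →-dec ((b ≟ a) →-dec (c ≟ b)))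
  up-step : ∀ a b c → t a c ≢ b → Up a b → Equal b c ⊎ Up b c
  up-step = from-yes (all? λ a → all? λ b → all? λ c → ¬? (t a c ≟ b) →-dec ((b ≟ s a) →-dec ((c ≟ b) ⊎-dec (c ≟ s b))))

  lost : ∀ x → x n ≡ x 0 → x (suc n) ≡ x 1 → (∀ k → k < n → f k (x k) (x (2 + k)) ≢ x (1 + k)) → ⊥
  lost x e₀ e₁ wrong = [ [ level , rising ]′ , falling ]′ (trichotomy (y 0) (y 1))
    where
    y : ℕ → Fin 3
    y j = cut j (x j)
    y₀ : y n ≡ s (y 0)
    y₀ = trans (cut-high (x n) ℕ.≤-refl) (cong s (trans e₀ (sym (cut-low (x 0) (ℕ.<-trans (s≤s z≤n) 2≤n)))))
    y₁ : y (suc n) ≡ s (y 1)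
    y₁ = trans (cut-high (x (suc n)) (ℕ.n≤1+n n)) (cong s (trans e₁ (sym (cut-low (x 1) 2≤n))))
    miss : ∀ k → k < n → t (y k) (y (2 + k)) ≢ y (1 + k)
    miss k k< e = wrong k k< (trans (cong (λ a → uncut (1 + k) (t a (y (2 + k)))) (sym (cut-low (x k) k<)))
      (trans (cong (uncut (1 + k)) e) (uncut-cut (1 + k) (x (1 + k)))))
    equal-run : ∀ d {k} → d + k ≡ n → Equal (y k) (y (1 + k)) → Equal (y n) (y (1 + n))
    equal-run zero refl e = e
    equal-run (suc d) {k} eq e = equal-run d (trans (+-suc d k) eq)
      (equal-step (y k) (y (1 + k)) (y (2 + k)) (miss k (subst (k <_) eq (s≤s (ℕ.m≤n+m k d)))) e)
    weak-run : ∀ d {k} → d + k ≡ n → Equal (y k) (y (1 + k)) ⊎ Up (y k) (y (1 + k)) → Equal (y n) (y (1 + n)) ⊎ Up (y n) (y (1 + n))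
    weak-run zero refl e = e
    weak-run (suc d) {k} eq e = weak-run d (trans (+-suc d k) eq)
      ([ (λ e → inj₁ (equal-step (y k) (y (1 + k)) (y (2 + k)) m e)) , up-step (y k) (y (1 + k)) (y (2 + k)) m ]′ e)
      where m = miss k (subst (k <_) eq (s≤s (ℕ.m≤n+m k d)))
    below : ∀ {k} → k ≤ n → ∃[ d ] d + k ≡ n
    below {k} k≤ = n ∸ k , ℕ.m∸n+n≡m k≤
    around : (g : Fin 3 → Fin 3) → (∀ a → g (g (g a)) ≡ a) → (∀ k → k < n → y (suc k) ≡ g (y k)) → ⊥
    around g g³ run = s≢ (y 0) (trans (sym y₀) (trans (cong y n≡) (thrice K (ℕ.≤-reflexive (sym n≡)))))
      where
      thrice : ∀ K → K * 3 ≤ n → y (K * 3) ≡ y 0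
      thrice zero    _ = refl
      thrice (suc K) l = trans (run (2 + K * 3) l) (trans (cong g (trans (run (1 + K * 3) (ℕ.<-trans ℕ.≤-refl l))
        (cong g (run (K * 3) (ℕ.<-trans ℕ.≤-refl (ℕ.<-trans ℕ.≤-refl l))))))
        (trans (g³ (y (K * 3))) (thrice K (ℕ.≤-trans (ℕ.m≤n+m (K * 3) 3) l))))
    level : Equal (y 0) (y 1) → ⊥
    level e = around (λ a → a) (λ _ → refl) λ k k< → run k (ℕ.<⇒≤ k<)
      where
      run : ∀ k → k ≤ n → Equal (y k) (y (1 + k))
      run zero    _ = e
      run (suc k) l = equal-step (y k) (y (1 + k)) (y (2 + k)) (miss k l) (run k (ℕ.<⇒≤ l))
    rising : Up (y 0) (y 1) → ⊥
    rising e = around s s³ λ k k< → run k (ℕ.<⇒≤ k<)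
      where
      run : ∀ k → k ≤ n → Up (y k) (y (1 + k))
      run zero    _ = e
      -- Had the difference dropped to `Equal`, it would remain so up to position `n`, where it has
      -- to be `Up` again.
      run (suc k) l = [ (λ e′ → let d , eq = below l in contradiction
          (trans (sym y₁) (trans (equal-run d eq e′) y₀)) (λ e″ → s≢ (s (y 0)) (trans (cong s (sym e)) e″))) ,
        (λ u → u) ]′ (up-step (y k) (y (1 + k)) (y (2 + k)) (miss k l) (run k (ℕ.<⇒≤ l)))
    falling : Down (y 0) (y 1) → ⊥
    falling e = around (λ a → s (s a)) (λ a → trans (s³ (s (s (s a)))) (s³ a)) run
      where
      run : ∀ k → k < n → Down (y k) (y (1 + k))
      run k k< = [ (λ weak → let d , eq = below (ℕ.<⇒≤ k<) in contradiction (weak-run d eq weak)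
          (exclusive (y n) (y (1 + n)) (trans y₁ (trans (cong s e) (cong (λ a → s (s a)) (sym y₀)))))) ,
        (λ d → d) ]′ (trichotomy (y k) (y (1 + k)))

-- From tables to strategies, and bits relayed along paths

module Strategise (G : Graph) where
  open Upper G public

  LocalAt : ∀ {q} {A : Set} → Vertex → ((Vertex → Fin q) → A) → Set
  LocalAt v φ = ∀ c c′ → (∀ u → Adj v u → c u ≡ c′ u) → φ c ≡ φ c′

  abstract
    assign : ∀ {q} v (φ : (Vertex → Fin q) → Fin q) → LocalAt v φ → Local q → Local q
    assign {q} v φ φ-local t = record { guess = g ; local = g-local }
      where
      g : Vertex → (Vertex → Fin q) → Fin q
      g u c with u ≟ v
      ... | yes _ = φ c
      ... | no  _ = guess t u c
      g-local : ∀ u c c′ → (∀ w → Adj u w → c w ≡ c′ w) → g u c ≡ g u c′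
      g-local u c c′ e with u ≟ v
      ... | yes refl = φ-local c c′ e
      ... | no _ = local t u c c′ e

    assign-≡ : ∀ {q} v φ l (t : Local q) c → guess (assign v φ l t) v c ≡ φ c
    assign-≡ v φ l t c with v ≟ v
    ... | yes _ = refl
    ... | no v≢v = contradiction refl v≢v

    assign-≢ : ∀ {q} {v u} φ l (t : Local q) c → u ≢ v → guess (assign v φ l t) u c ≡ guess t u c
    assign-≢ {v = v} {u} φ l t c u≢v with u ≟ v
    ... | yes e = contradiction e u≢v
    ... | no _ = refl

    split : ∀ {q} → Subset order → Local q → Local q → Local q
    split {q} X s t = record { guess = g ; local = g-local }
      where
      g : Vertex → (Vertex → Fin q) → Fin q
      g u c with u ∈? X
      ... | yes _ = guess s u c
      ... | no  _ = guess t u c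
      g-local : ∀ u c c′ → (∀ w → Adj u w → c w ≡ c′ w) → g u c ≡ g u c′
      g-local u c c′ e with u ∈? X
      ... | yes _ = local s u c c′ e
      ... | no  _ = local t u c c′ e

    split-∈ : ∀ {q X u} (s t : Local q) c → u ∈ X → guess (split X s t) u c ≡ guess s u c
    split-∈ {X = X} {u} s t c u∈ with u ∈? X
    ... | yes _ = refl
    ... | no u∉ = contradiction u∈ u∉

    split-∉ : ∀ {q X u} (s t : Local q) c → u ∉ X → guess (split X s t) u c ≡ guess t u c
    split-∉ {X = X} {u} s t c u∉ with u ∈? X
    ... | yes u∈ = contradiction u∈ u∉
    ... | no _ = refl

  record Info {q} (X : Subset order) (v : Vertex) (β : Fin q → Bool) : Set where
    field
      strategy  : Local q
      bit       : (Vertex → Fin q) → Bool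
      bit-local : LocalAt v bit
      informed  : ∀ c → (∀ u → u ∈ X → guess strategy u c ≢ c u) → β (c v) ≡ bit c

  module Signals {q} (code : Code q) where
    open Code code
    open Info

    -- v bets that its unknown second bit equals the first bit of w.
    pass : ∀ {X v w} (I : Info X v first) → v ∉ X → Adj v w →
           Info (subset λ u → (u ∈? X) ⊎-dec (u ≟ v)) w first
    pass {X} {v} {w} I v∉X v-w = record
      { strategy = s
      ; bit = λ c → not (second (c v))
      ; bit-local = λ c c′ e → cong (λ x → not (second x)) (e v (Adj-sym v-w))
      ; informed = λ c wrong → ¬-not λ e → wrong v (∈-subset⁺ in? (inj₂ refl))
          (trans (assign-≡ v φ φ-local (strategy I) c) (trans (cong₂ decode
            (sym (informed I c λ u u∈ r → wrong u (∈-subset⁺ in? (inj₁ u∈))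
              (trans (assign-≢ φ φ-local (strategy I) c λ { refl → v∉X u∈ }) r))) e)
            (decode-bits (c v)))) }
      where
      in? = λ u → (u ∈? X) ⊎-dec (u ≟ v)
      φ : (Vertex → Fin q) → Fin q
      φ c = decode (bit I c) (first (c w))
      φ-local : LocalAt v φ
      φ-local c c′ e = cong₂ (λ b x → decode b (first x)) (bit-local I c c′ e) (e w v-w)
      s : Local q
      s = assign v φ φ-local (strategy I)

    -- Disjointness allows both groups of informers to play at once. If they are all wrong, `v`
    -- knows both bits and decodes its own colour.
    join : ∀ {X Y v} → Info X v first → Info Y v second → v ∉ X → v ∉ Y → (∀ {u} → u ∈ X → u ∉ Y) → ∃ (Wins {q})
    join {X} {Y} {v} I J v∉X v∉Y disjoint = s , λ c → decidable-stable (any? λ u → guess s u c ≟ c u) λ none →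
        none (v , trans (assign-≡ v φ φ-local t c) (trans (cong₂ decode
          (sym (informed I c λ u u∈ r → none (u , trans (assign-≢ φ φ-local t c λ { refl → v∉X u∈ })
            (trans (split-∈ (strategy I) (strategy J) c u∈) r))))
          (sym (informed J c λ u u∈ r → none (u , trans (assign-≢ φ φ-local t c λ { refl → v∉Y u∈ })
            (trans (split-∉ (strategy I) (strategy J) c λ u∈X → disjoint u∈X u∈) r)))))
          (decode-bits (c v))))
      where
      φ : (Vertex → Fin q) → Fin q
      φ c = decode (bit I c) (bit J c)
      φ-local : LocalAt v φ
      φ-local c c′ e = cong₂ decode (bit-local I c c′ e) (bit-local J c c′ e)
      t s : Local q
      t = split X (strategy I) (strategy J)
      s = assign v φ φ-local t

    -- Only the first bit travels: the start of the path becomes one more informer and the next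
    -- vertex the informed one, until the end is reached, where the second bit waits.
    connect : ∀ l {X Y} (z : ℕ → Vertex) → (∀ {i} → i < l → Adj (z i) (z (suc i))) →
              (∀ {i j} → i ≤ l → j ≤ l → z i ≡ z j → i ≡ j) →
              (∀ {i} → i ≤ l → z i ∉ X × z i ∉ Y) → (∀ {u} → u ∈ X → u ∉ Y) →
              Info X (z 0) first → Info Y (z l) second → ∃ (Wins {q})
    connect zero z _ _ outside disjoint I J = join I J (proj₁ (outside z≤n)) (proj₂ (outside z≤n)) disjoint
    connect (suc l) {X} {Y} z steps simple outside disjoint I J =
      connect l (λ i → z (suc i)) (λ i< → steps (s≤s i<)) (λ i≤ j≤ e → ℕ.suc-injective (simple (s≤s i≤) (s≤s j≤) e))
        (λ i≤ → (λ u∈ → [ proj₁ (outside (s≤s i≤)) , (λ e → contradiction (simple (s≤s i≤) z≤n e) λ ()) ]′ (∈-subset⁻ in? u∈)) ,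
                proj₂ (outside (s≤s i≤)))
        (λ u∈ → [ disjoint , (λ { refl → proj₂ (outside z≤n) }) ]′ (∈-subset⁻ in? u∈))
        (pass I (proj₁ (outside z≤n)) (steps (s≤s z≤n))) J
      where
      in? = λ u → (u ∈? X) ⊎-dec (u ≟ z 0)

  module Around (C : Cycle G) where

    private
      n = length C

    through? : ∀ u → Dec (Through C u)
    through? u = any? λ i → Cycle.vertex C i ≟ u

    module _ {p : ℕ} (L : Loop G C) (f : Guesses (suc p)) where

      private
        index? : ∀ u → Dec (∃[ k ] (k < n × at L (suc k) ≡ u))
        index? u = ℕ.anyUpTo? (λ k → at L (suc k) ≟ u) n

        act : ∀ {u} → Dec (∃[ k ] (k < n × at L (suc k) ≡ u)) → (Vertex → Fin (suc p)) → Fin (suc p)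
        act (yes (k , _)) c = f k (c (at L k)) (c (at L (2 + k)))
        act (no _) c = zero

        act-local : ∀ {u} (d : Dec (∃[ k ] (k < n × at L (suc k) ≡ u))) c c′ → (∀ w → Adj u w → c w ≡ c′ w) → act d c ≡ act d c′
        act-local (yes (k , _ , refl)) c c′ e = cong₂ (f k) (e (at L k) (Adj-sym (at-adj G L k))) (e (at L (2 + k)) (at-adj G L (suc k)))
        act-local (no _) c c′ e = refl

        act-index : ∀ {k} → k < n → (d : Dec (∃[ j ] (j < n × at L (suc j) ≡ at L (suc k)))) → ∀ c →
                    act d c ≡ f k (c (at L k)) (c (at L (2 + k)))
        act-index k< (yes (j , j< , e)) c with at-inj (rotate₁ G L) j< k< e
        ... | refl = refl
        act-index k< (no none) c = contradiction (_ , k< , refl) none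

      around : Local (suc p)
      around = record { guess = λ u → act (index? u) ; local = λ u → act-local (index? u) }

      around-guess : ∀ {k} → k < n → ∀ c → guess around (at L (suc k)) c ≡ f k (c (at L k)) (c (at L (2 + k)))
      around-guess {k} k< = act-index k< (index? (at L (suc k)))

    cycle-wins : ∀ {p} → CycleWins (suc p) n → ∃ (Wins {suc p})
    cycle-wins (f , win) = around (loop G) f , λ c →
      let k , k< , e = win (λ i → c (at (loop G {C}) i))
            (cong c (trans (cong (at (loop G {C})) (sym (ℕ.+-identityʳ n))) (periodic (loop G {C}) 0)))
            (cong c (trans (cong (at (loop G {C})) (+-comm 1 n)) (periodic (loop G {C}) 1)))
      in at (loop G {C}) (suc k) , trans (around-guess (loop G) f k< c) e

    others? : ∀ v u → Dec (Through C u × u ≢ v)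
    others? v u = through? u ×-dec ¬? (u ≟ v)

    root-info : ∀ {p v} {β : Fin (suc p) → Bool} → RootInfo (suc p) n β → Through C v → Info (subset (others? v)) v β
    root-info {p} {v} {β} (f , F , known) t = build (loop-from G t)
      where
      build : (Σ (Loop G C) λ L → at L 0 ≡ v) → Info (subset (others? v)) v β
      build (L , refl) = record
        { strategy = around L f
        ; bit = λ c → F (c (at L 1)) (c (at L (n ∸ 1)))
        ; bit-local = λ c c′ e → cong₂ F (e (at L 1) (at-adj G L 0))
            (e (at L (n ∸ 1)) (Adj-sym (subst (Adj (at L (n ∸ 1))) wrap (at-adj G L (n ∸ 1)))))
        ; informed = λ c wrong → known (λ i → c (at L i)) (cong c wrap) λ k k< e →
            wrong (at L (suc k)) (∈-subset⁺ (others? v) (at-through G L (suc k) ,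
                λ e′ → contradiction (at-inj L k< (s≤s z≤n) e′) λ ()))
              (trans (around-guess L f (ℕ.<-trans ℕ.≤-refl k<) c) e) }
        where
        wrap : at L n ≡ at L 0
        wrap = trans (cong (at L) (sym (ℕ.+-identityʳ n))) (periodic L 0)

  module _ {A B : Vertex → Set} (A? : ∀ u → Dec (A u)) (B? : ∀ u → Dec (B u)) where

    record Bridge : Set where
      field
        span : ℕ
        post : ℕ → Vertex
        bridge-steps : ∀ {i} → i < span → Adj (post i) (post (suc i))
        bridge-simple : ∀ {i j} → i ≤ span → j ≤ span → post i ≡ post j → i ≡ j
        from-A : A (post 0)
        to-B : B (post span)
        leaves-A : ∀ {i} → i < span → ¬ A (post (suc i))
        avoids-B : ∀ {i} → i < span → ¬ B (post i)

    -- Stopping at an earlier vertex of `B`, or starting from a later vertex of `A`, shortens the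
    -- path; when neither is possible it is a bridge.
    trim : ∀ l → Acc _<_ l → (z : ℕ → Vertex) → (∀ {i} → i < l → Adj (z i) (z (suc i))) →
           (∀ {i j} → i ≤ l → j ≤ l → z i ≡ z j → i ≡ j) → A (z 0) → B (z l) → Bridge
    trim l (acc smaller) z steps simple a b = byEnds (ℕ.anyUpTo? (λ j → B? (z j)) l) (ℕ.anyUpTo? (λ i → A? (z (suc i))) l)
      where
      byEnds : Dec (∃[ j ] (j < l × B (z j))) → Dec (∃[ i ] (i < l × A (z (suc i)))) → Bridge
      byEnds (yes (j , j< , b′)) _ = trim j (smaller j<) z (λ i< → steps (ℕ.<-trans i< j<))
        (λ i≤ j≤ → simple (ℕ.≤-trans i≤ (ℕ.<⇒≤ j<)) (ℕ.≤-trans j≤ (ℕ.<⇒≤ j<))) a b′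
      byEnds (no _) (yes (i , i< , a′)) = trim (l ∸ suc i) (smaller (ℕ.∸-monoʳ-< (s≤s z≤n) i<)) (λ k → z (k + suc i))
          (λ k< → steps (ℕ.<-≤-trans (ℕ.+-monoˡ-< (suc i) k<) (ℕ.≤-reflexive (ℕ.m∸n+n≡m i<))))
          (λ {j} {k} j≤ k≤ e → ℕ.+-cancelʳ-≡ (suc i) j k (simple (bound j≤) (bound k≤) e)) a′
          (subst (λ k → B (z k)) (sym (ℕ.m∸n+n≡m i<)) b)
        where
        bound : ∀ {k} → k ≤ l ∸ suc i → k + suc i ≤ l
        bound k≤ = ℕ.≤-trans (ℕ.+-monoˡ-≤ (suc i) k≤) (ℕ.≤-reflexive (ℕ.m∸n+n≡m i<))
      byEnds (no ¬b) (no ¬a) = record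
        { span = l ; post = z ; bridge-steps = steps ; bridge-simple = simple ; from-A = a ; to-B = b
        ; leaves-A = λ {i} i< a′ → ¬a (i , i< , a′) ; avoids-B = λ {i} i< b′ → ¬b (i , i< , b′) }

    bridge : ∀ {u w} → Star Adj u w → A u → B w → Bridge
    bridge {u} {w} path a b = trim (size Z) (<-wellFounded (size Z)) (node Z) (steps Z) (simple Z)
        (subst A (sym (start Z)) a) (subst B (sym (end Z)) b)
      where
      Z : Chain (λ _ → Unit.⊤) u w
      Z = chain _ (Star.map (λ adj → adj , _ , _) path)

  -- Informed of both bits is the common vertex of the cycles, or else the end on `D` of a bridge
  -- between them. In a cactus the cycles share at most one vertex, which keeps the two groups of
  -- informers disjoint.
  two-cycles-win : ∀ {p} → Code (suc p) → Cactus G → {C D : Cycle G} → ¬ (C ≈ D) →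
                   (∀ β → RootInfo (suc p) (length C) β) → (∀ β → RootInfo (suc p) (length D) β) → ∃ (Wins {suc p})
  two-cycles-win {p} code ((v₀ , connected) , almost-disjoint) {C} {D} C≉D info-C info-D =
      byMeeting (any? λ u → inC? u ×-dec inD? u)
    where
    open Code code
    open Signals code
    inC? = Around.through? C
    inD? = Around.through? D
    otherC? = Around.others? C
    otherD? = Around.others? D
    common : ∀ {u v} → Through C u → Through D u → Through C v → Through D v → u ≡ v
    common tC tD tC′ tD′ = almost-disjoint C D C≉D _ _ tC tD tC′ tD′
    byMeeting : Dec (∃[ u ] (Through C u × Through D u)) → ∃ (Wins {suc p})
    byMeeting (yes (u , tC , tD)) = join (Around.root-info C (info-C first) tC) (Around.root-info D (info-D second) tD)
      (λ u∈ → proj₂ (∈-subset⁻ (otherC? u) u∈) refl) (λ u∈ → proj₂ (∈-subset⁻ (otherD? u) u∈) refl)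
      (λ w∈ w∈′ → let wC , w≢u = ∈-subset⁻ (otherC? u) w∈ ; wD , _ = ∈-subset⁻ (otherD? u) w∈′ in w≢u (common wC wD tC tD))
    byMeeting (no apart) = connect span post bridge-steps bridge-simple
        (λ i≤ → notC i≤ , notD i≤)
        (λ w∈ w∈′ → apart (_ , proj₁ (∈-subset⁻ (otherC? (post 0)) w∈) , proj₁ (∈-subset⁻ (otherD? (post span)) w∈′)))
        (Around.root-info C (info-C first) from-A) (Around.root-info D (info-D second) to-B)
      where
      tC : Through C (Cycle.vertex C zero)
      tC = zero , refl
      tD : Through D (Cycle.vertex D zero)
      tD = zero , refl
      open Bridge (bridge inC? inD? (connected (Cycle.vertex C zero) (Cycle.vertex D zero)) tC tD)
      notC : ∀ {i} → i ≤ span → post i ∉ subset (otherC? (post 0))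
      notC {zero} _ u∈ = proj₂ (∈-subset⁻ (otherC? (post 0)) u∈) refl
      notC {suc i} i< u∈ = leaves-A i< (proj₁ (∈-subset⁻ (otherC? (post 0)) u∈))
      notD : ∀ {i} → i ≤ span → post i ∉ subset (otherD? (post span))
      notD i≤ u∈ = [ (λ i< → avoids-B i< (proj₁ (∈-subset⁻ (otherD? (post span)) u∈))) ,
        (λ { refl → proj₂ (∈-subset⁻ (otherD? (post span)) u∈) refl }) ]′ (ℕ.m≤n⇒m<n∨m≡n i≤)

  edge-wins : HasEdges G → ∃ (Wins {2})
  edge-wins (u , v , u-v) = s , λ c → byColours c (c u ≟ c v)
    where
    opposite : Fin 2 → Fin 2
    opposite 0F = 1F
    opposite 1F = 0F
    opposite-≢ : ∀ a b → a ≢ b → opposite a ≡ b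
    opposite-≢ 0F 0F d = contradiction refl d
    opposite-≢ 0F 1F d = refl
    opposite-≢ 1F 0F d = refl
    opposite-≢ 1F 1F d = contradiction refl d
    base t s : Local 2
    base = record { guess = λ _ _ → zero ; local = λ _ _ _ _ → refl }
    t-local : LocalAt v λ c → opposite (c u)
    t-local c c′ e = cong opposite (e u (Adj-sym u-v))
    s-local : LocalAt u λ c → c v
    s-local c c′ e = e v u-v
    t = assign v (λ c → opposite (c u)) t-local base
    s = assign u (λ c → c v) s-local t
    byColours : ∀ c → Dec (c u ≡ c v) → ∃[ w ] guess s w c ≡ c w
    byColours c (yes e) = u , trans (assign-≡ u (λ c → c v) s-local t c) (sym e)
    byColours c (no d) = v , trans (assign-≢ (λ c → c v) s-local t c λ { refl → Adj-irrefl u-v })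
      (trans (assign-≡ v (λ c → opposite (c u)) t-local base c) (opposite-≢ (c u) (c v) d))

  edgeless-loses : ¬ HasEdges G → ∀ {p} → ¬ ∃ (Wins {2 + p})
  edgeless-loses none (s , wins) = let v , e = wins c in wrong v (trans (local s v (λ _ → zero) c λ u a → contradiction (v , u , a) none) e)
    where
    other : ∀ {p} → Fin (2 + p) → Fin (2 + p)
    other zero    = 1F
    other (suc _) = zero
    c : Vertex → Fin _
    c v = other (guess s v (λ _ → zero))
    other-≢ : ∀ {p} (x : Fin (2 + p)) → x ≢ other x
    other-≢ zero ()
    other-≢ (suc _) ()
    wrong : ∀ v → guess s v (λ _ → zero) ≢ c v
    wrong v = other-≢ _

-- The classification

module CycleSearch (G : Graph) where
  open Strategise G

  -- The length is carried along so that conditions on it transfer without counting edges.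
  _∼_ : Cycle G → Cycle G → Set
  C ∼ D = Σ (length C ≡ length D) λ _ → C ≈ D

  ≈-sym : ∀ (C D : Cycle G) → C ≈ D → D ≈ C
  ≈-sym C D e u v = mk⇔ (Equivalence.from (e u v)) (Equivalence.to (e u v))

  ≈-trans : ∀ (C D E : Cycle G) → C ≈ D → D ≈ E → C ≈ E
  ≈-trans C D E e e′ u v = mk⇔ (λ h → Equivalence.to (e′ u v) (Equivalence.to (e u v) h))
    (λ h → Equivalence.from (e u v) (Equivalence.from (e′ u v) h))

  hasEdge? : ∀ (C : Cycle G) u v → Dec (HasEdge C u v)
  hasEdge? C u v = any? λ i → ((vertex i ≟ u) ×-dec (vertex (next i) ≟ v)) ⊎-dec ((vertex i ≟ v) ×-dec (vertex (next i) ≟ u))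
    where open Cycle C

  _≈?_ : ∀ (C D : Cycle G) → Dec (C ≈ D)
  C ≈? D = all? λ u → all? λ v → map′ (λ (f , g) → mk⇔ f g) (λ e → Equivalence.to e , Equivalence.from e)
    ((hasEdge? C u v →-dec hasEdge? D u v) ×-dec (hasEdge? D u v →-dec hasEdge? C u v))

  record Valid {e : ℕ} (v : Fin (3 + e) → Vertex) : Set where
    constructor valid
    field
      injective : Injective _≡_ _≡_ v
      closed : ∀ i → Adj (v i) (v (next i))

  fromValid : ∀ {e} {v : Fin (3 + e) → Vertex} → Valid v → Cycle G
  fromValid {e} {v} (valid d s) = record { excess = e ; vertex = v ; distinct = d ; step = s }

  valid? : ∀ {e} (v : Fin (3 + e) → Vertex) → Dec (Valid v)
  valid? v = map′ (λ (d , s) → valid (λ {i} {j} → d i j) s) (λ (valid d s) → (λ i j → d {i} {j}) , s)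
    ((all? λ i → all? λ j → (v i ≟ v j) →-dec (i ≟ j)) ×-dec (all? λ i → Adj? (v i) (v (next i))))

  valid-cong : ∀ {e} {v w : Fin (3 + e) → Vertex} → (∀ i → v i ≡ w i) → Valid v → Valid w
  valid-cong e (valid d s) = valid (λ {i} {j} eq → d (trans (e i) (trans eq (sym (e j)))))
    λ i → subst₂ Adj (e i) (e (next i)) (s i)

  same-edges : ∀ {e} {v w : Fin (3 + e) → Vertex} → (∀ i → v i ≡ w i) → (V : Valid v) (W : Valid w) →
               fromValid V ≈ fromValid W
  same-edges e V W x y = mk⇔ (move e) (move λ i → sym (e i))
    where
    move : ∀ {e} {v w : Fin (3 + e) → Vertex} {x y} → (∀ i → v i ≡ w i) →
           ∃[ i ] (v i ≡ x × v (next i) ≡ y ⊎ v i ≡ y × v (next i) ≡ x) →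
           ∃[ i ] (w i ≡ x × w (next i) ≡ y ⊎ w i ≡ y × w (next i) ≡ x)
    move e (i , inj₁ (p , q)) = i , inj₁ (trans (sym (e i)) p , trans (sym (e (next i))) q)
    move e (i , inj₂ (p , q)) = i , inj₂ (trans (sym (e i)) p , trans (sym (e (next i))) q)

  -- Decidability lets the classification escape the negations in which upper bounds are stated. The
  -- search is finite since distinct vertices bound the excess by `order`; it finds vertex functions
  -- only up to pointwise equality, hence the condition that `P` respects `_∼_`.
  cycle? : {P : Cycle G → Set} → (∀ C → Dec (P C)) → (∀ C D → C ∼ D → P C → P D) → Dec (∃ P)
  cycle? {P} P? resp = map′ (λ { (e , _ , v , V , p) → fromValid V , p })
      (λ { (C , p) → Cycle.excess C , short C , Cycle.vertex C , valid (Cycle.distinct C) (Cycle.step C) , p })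
      (ℕ.anyUpTo? (λ e → search (good? {e}) good-cong) order)
    where
    Good : ∀ {e} → (Fin (3 + e) → Vertex) → Set
    Good v = Σ (Valid v) λ V → P (fromValid V)
    good? : ∀ {e} (v : Fin (3 + e) → Vertex) → Dec (Good v)
    good? v with valid? v
    ... | no ¬V = no λ (V , _) → ¬V V
    ... | yes V = map′ (V ,_) (λ (W , p) → resp _ _ (refl , same-edges (λ _ → refl) W V) p) (P? (fromValid V))
    good-cong : ∀ {e} {v w : Fin (3 + e) → Vertex} → (∀ i → v i ≡ w i) → Good v → Good w
    good-cong e (V , p) = valid-cong e V , resp _ _ (refl , same-edges e V (valid-cong e V)) p
    short : ∀ (C : Cycle G) → Cycle.excess C < order
    short C = ℕ.≤-trans (s≤s (ℕ.m≤n+m (Cycle.excess C) 2)) (Fin.injective⇒≤ (Cycle.distinct C))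

  distinct-pair? : {R : ℕ → Set} → (∀ n → Dec (R n)) →
                   Dec (∃[ C ] ∃[ D ] (R (length C) × R (length D) × ¬ (_≈_ {G} C D)))
  distinct-pair? {R} R? = cycle?
    (λ C → cycle? (λ D → R? (length C) ×-dec (R? (length D) ×-dec ¬? (C ≈? D)))
      λ D E (e , D≈E) (r , r′ , C≉D) → r , subst R e r′ , λ C≈E → C≉D (≈-trans C E D C≈E (≈-sym D E D≈E)))
    λ C E (e , C≈E) (D , r , r′ , C≉D) → D , subst R e r , r′ , λ E≈D → C≉D (≈-trans C E D C≈E E≈D)

module Classification (G : Graph) (cactus : Cactus G) where
  open Strategise G
  open CycleSearch G

  Special : Set
  Special = ∃[ C ] (length {G} C ≡ 4 ⊎ 3 ∣ length C)

  almost-disjoint = proj₂ cactus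

  root : Vertex
  root = proj₁ (proj₁ cactus)

  two-triangles? : Dec (AtLeastTwoTriangles G)
  two-triangles? = distinct-pair? (ℕ._≟ 3)

  two-cycles? : Dec (AtLeastTwoCycles G)
  two-cycles? = map′ (λ (C , D , _ , _ , d) → C , D , d) (λ (C , D , d) → C , D , _ , _ , d)
    (distinct-pair? {λ _ → Unit.⊤} λ _ → yes _)

  special? : Dec Special
  special? = cycle? (λ C → (length C ℕ.≟ 4) ⊎-dec (3 ∣? length C))
    λ C D (e , _) → [ (λ e′ → inj₁ (trans (sym e) e′)) , (λ d → inj₂ (subst (3 ∣_) e d)) ]′

  win₄ : AtLeastTwoTriangles G → WinningWith G 4
  win₄ (C , D , tC , tD , C≉D) = local⇒winning (two-cycles-win code₄ cactus {C} {D} C≉D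
    (λ β → subst (λ n → RootInfo 4 n β) (sym tC) (root-info₄ β))
    (λ β → subst (λ n → RootInfo 4 n β) (sym tD) (root-info₄ β)))

  win₃ : AtLeastTwoCycles G ⊎ Special → WinningWith G 3
  win₃ (inj₁ (C , D , C≉D)) = local⇒winning (two-cycles-win code₃ cactus {C} {D} C≉D
    (root-info₃ (Cycle.excess C)) (root-info₃ (Cycle.excess D)))
  win₃ (inj₂ (C , inj₁ n≡4)) = local⇒winning (Around.cycle-wins C (subst (CycleWins 3) (sym n≡4) four-cycle-wins))
  win₃ (inj₂ (C , inj₂ 3∣n)) = local⇒winning (Around.cycle-wins C (multiple-of-three-wins (s≤s (s≤s z≤n)) 3∣n))

  win₂ : HasEdges G → WinningWith G 2
  win₂ edges = local⇒winning (edge-wins edges)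

  at-most : ∀ q → ¬ ∃ (Wins {suc q}) → ∀ r → WinningWith G r → r ≤ q
  at-most q lose r w = ℕ.≤-pred (ℕ.≰⇒> λ q<r → lose (fewer-colours q<r (winning⇒local w)))

  lose₅ : ¬ ∃ (Wins {5})
  lose₅ = Cacti.rooted-loses-⊤ almost-disjoint 2 (λ C → escaping (Cycle.excess C)) root
    where
    escaping : ∀ e {a b : Fin 5} → a ≢ b → CycleEscapes 5 (3 + e) (λ x → x ≡ a ⊎ x ≡ b)
    escaping zero    = two-colours-escape-triangle ℕ.≤-refl
    escaping (suc k) = two-colours-escape ℕ.≤-refl k

  -- A lone triangle is taken as the core, where its root has all four colours; the other cycles
  -- already lose with two colours at the root.
  lose₄ : ¬ AtLeastTwoTriangles G → ¬ ∃ (Wins {4})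
  lose₄ few = byTriangle (cycle? {Triangle} (λ C → length C ℕ.≟ 3) λ C D (e , _) t → trans (sym e) t)
    where
    escaping : ∀ e → 3 + e ≢ 3 → ∀ {a b : Fin 4} → a ≢ b → CycleEscapes 4 (3 + e) (λ x → x ≡ a ⊎ x ≡ b)
    escaping zero    ≢3 = contradiction refl ≢3
    escaping (suc k) _  = two-colours-escape (s≤s (s≤s (s≤s (s≤s (s≤s z≤n))))) k
    byTriangle : Dec (∃ Triangle) → ¬ ∃ (Wins {4})
    byTriangle (no none) = Cacti.rooted-loses-⊤ almost-disjoint 1
      (λ C → escaping (Cycle.excess C) λ t → none (C , t)) root
    byTriangle (yes (C , t)) = Cacti.core-loses almost-disjoint 1 C
      (subst (λ n → CycleEscapes 4 n Always) (sym t) triangle-escapes)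
      λ D C≉D → escaping (Cycle.excess D) λ t′ → few (C , D , t , t′ , C≉D)

  -- With the only cycle as core, all branches are acyclic, so no cycle ever has to lose with two
  -- colours at its root.
  lose₃ : ¬ AtLeastTwoCycles G → ¬ Special → ¬ ∃ (Wins {3})
  lose₃ few ordinary = byCycle (cycle? {λ _ → Unit.⊤} (λ _ → yes _) _)
    where
    escapes : ∀ e → 3 + e ≢ 4 → ¬ 3 ∣ 3 + e → CycleEscapes 3 (3 + e) Always
    escapes 0             _  3∤n = contradiction ∣-refl 3∤n
    escapes 1             ≢4 _   = contradiction refl ≢4
    escapes (suc (suc k)) _  3∤n = three-colours-escape k 3∤n
    byCycle : Dec (∃ λ (C : Cycle G) → Unit.⊤) → ¬ ∃ (Wins {3})
    byCycle (no none) = Cacti.rooted-loses-⊤ almost-disjoint 0 (λ C → contradiction (C , _) none) root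
    byCycle (yes (C , _)) = Cacti.core-loses almost-disjoint 0 C
      (escapes (Cycle.excess C) (λ e → ordinary (C , inj₁ e)) λ d → ordinary (C , inj₂ d))
      λ D C≉D → contradiction (C , D , C≉D) few

  HG≡4 : HG G is 4 ⇔ AtLeastTwoTriangles G
  HG≡4 = mk⇔
    (λ (w , _) → decidable-stable two-triangles? λ few → ℕ.<⇒≱ ℕ.≤-refl (at-most 3 (lose₄ few) 4 w))
    (λ two → win₄ two , at-most 4 lose₅)

  HG≡3 : HG G is 3 ⇔ ((AtLeastTwoCycles G ⊎ Special) × ¬ AtLeastTwoTriangles G)
  HG≡3 = mk⇔
    (λ (w , top) → decidable-stable (two-cycles? ⊎-dec special?)
        (λ none → ℕ.<⇒≱ ℕ.≤-refl (at-most 2 (lose₃ (λ t → none (inj₁ t)) λ s → none (inj₂ s)) 3 w)) ,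
      λ two → ℕ.<⇒≱ ℕ.≤-refl (top 4 (win₄ two)))
    (λ (many , few) → win₃ many , at-most 3 (lose₄ few))

  HG≡2 : HG G is 2 ⇔ (Pseudotree G × HasEdges G × ¬ Special)
  HG≡2 = mk⇔
    (λ (w , top) → let not-three = λ many → ℕ.<⇒≱ ℕ.≤-refl (top 3 (win₃ many)) in
      (proj₁ cactus , λ C D → decidable-stable (C ≈? D) λ C≉D → not-three (inj₁ (C , D , C≉D))) ,
      decidable-stable (any? λ u → any? λ v → Adj? u v)
        (λ none → edgeless-loses none (winning⇒local w)) ,
      λ s → not-three (inj₂ s))
    (λ ((_ , one) , edges , ordinary) → win₂ edges , at-most 2 (lose₃ (λ (C , D , C≉D) → C≉D (one C D)) ordinary))

theorem1p2 : (G : Graph) → Cactus G →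
    (HG G is 4 ⇔ AtLeastTwoTriangles G)
    × (HG G is 3 ⇔
    ((AtLeastTwoCycles G
    ⊎ (∃[ C ] (length {G} C ≡ 4 ⊎ 3 ∣ length C)))
    × ¬ AtLeastTwoTriangles G))
    × (HG G is 2 ⇔
    (Pseudotree G × HasEdges G
    × ¬ (∃[ C ] (length {G} C ≡ 4 ⊎ 3 ∣ length C))))
theorem1p2 G cactus = HG≡4 , HG≡3 , HG≡2
  where open Classification G cactus
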